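{- Let $\Gamma$ be a connected signed graph with $c(\Gamma)\geq1$. Then $\eta(\Gamma)=2c(\Gamma)+p(\Gamma)-1$ if and only if $\Gamma$ has one of the following forms: (1) a signed graph obtained from a signed tree $T$ with $\eta(T)=p(T)-1$ and $p(T)\geq c(\Gamma)$ by attaching $c(\Gamma)$ pairwise disjoint signed cycles, each of nullity $2$, at $c(\Gamma)$ distinct leaves of $T$ (each such leaf identified with a vertex of its cycle); (2) an $\infty$-graph $\infty(p,q,1)$ in which each cycle has nullity $2$; (3) a $\theta$-graph $\theta(p,q,l)$ in which each cycle has nullity $2$.
   Context: A signed graph $\Gamma=(G,\sigma)$ is a simple finite graph $G$ with a map $\sigma:E(G)\to\{+,-\}$; its adjacency matrix has entry $\sigma(v_iv_j)$ if $v_i\sim v_j$ and $0$ otherwise; $\eta(\Gamma)$ is the multiplicity of the eigenvalue $0$ of this matrix. The nullity of a cycle of $\Gamma$ is the nullity of that signed cycle with signs inherited from $\Gamma$. $c(\Gamma)=|E(G)|-|V(G)|+\omega(G)$ with $\omega(G)$ the number of components, and $p(\Gamma)$ is the number of vertices of degree one. $\infty(p,q,1)$ is the graph obtained from two vertex-disjoint cycles $C_p$ and $C_q$ by identifying a vertex of $C_p$ with a vertex of $C_q$. $\theta(p,q,l)$ is the union of three internally disjoint paths of lengths $p,q,l$ with common end vertices, where $p,q,l\geq1$ and at most one of them equals $1$ (with arbitrary signs on edges). -}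

module Defs where

open import Data.Nat using (ℕ; zero; suc; _+_; _∸_; _≤_; _<ᵇ_; _≡ᵇ_; NonZero)
open import Data.Nat.DivMod using (_mod_)
open import Data.Fin using (Fin; zero; suc; toℕ; fromℕ; inject₁; _≟_)
open import Data.Bool using (Bool; true; false; if_then_else_; _∨_; _∧_; T)
open import Data.Maybe using (Maybe; just; nothing; is-just)
open import Data.Sign using (Sign)
open import Data.Rational using (ℚ; 0ℚ; 1ℚ; -_) renaming (_+_ to _+ℚ_; _*_ to _*ℚ_)
open import Data.Product using (Σ; ∃; ∃-syntax; _×_; _,_)
open import Data.Sum using (_⊎_)
open import Data.Empty using (⊥)
open import Relation.Nullary using (¬_; does)
open import Relation.Binary.PropositionalEquality using (_≡_; _≢_)
open import Function.Definitions using (Injective)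

-- Signed graphs on the vertex set Fin n.
-- Γ u v = nothing      : u, v not adjacent
-- Γ u v = just s       : u ~ v with edge sign s ∈ {+,-}

SGraph : ℕ → Set
SGraph n = Fin n → Fin n → Maybe Sign

IsSignedGraph : ∀ {n} → SGraph n → Set
IsSignedGraph {n} Γ = (∀ u v → Γ u v ≡ Γ v u) × (∀ u → Γ u u ≡ nothing)

Adj : ∀ {n} → SGraph n → Fin n → Fin n → Set
Adj Γ u v = T (is-just (Γ u v))

entry : Maybe Sign → ℚ
entry nothing         = 0ℚ
entry (just Sign.+)   = 1ℚ
entry (just Sign.-)   = - 1ℚ

adjMat : ∀ {n} → SGraph n → Fin n → Fin n → ℚ
adjMat Γ i j = entry (Γ i j)

∑ : ∀ {n} → (Fin n → ℚ) → ℚ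
∑ {zero}  f = 0ℚ
∑ {suc n} f = f zero +ℚ ∑ (λ i → f (suc i))

InKernel : ∀ {n} → (Fin n → Fin n → ℚ) → (Fin n → ℚ) → Set
InKernel A x = ∀ i → ∑ (λ j → A i j *ℚ x j) ≡ 0ℚ

LinIndep : ∀ {n k} → (Fin k → Fin n → ℚ) → Set
LinIndep {n} {k} vs =
  ∀ (c : Fin k → ℚ) → (∀ j → ∑ (λ i → c i *ℚ vs i j) ≡ 0ℚ) → ∀ i → c i ≡ 0ℚ

KerDimAtLeast : ∀ {n} → (Fin n → Fin n → ℚ) → ℕ → Set
KerDimAtLeast {n} A k =
  Σ (Fin k → Fin n → ℚ) λ vs → LinIndep vs × (∀ i → InKernel A (vs i))

-- Nullity A k : dim ker A = k  (= multiplicity of eigenvalue 0, A symmetric)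
Nullity : ∀ {n} → (Fin n → Fin n → ℚ) → ℕ → Set
Nullity A k = KerDimAtLeast A k × ¬ KerDimAtLeast A (suc k)

η≡ : ∀ {n} → SGraph n → ℕ → Set
η≡ Γ k = Nullity (adjMat Γ) k

count : ∀ {n} → (Fin n → Bool) → ℕ
count {zero}  f = 0
count {suc n} f = (if f zero then 1 else 0) + count (λ i → f (suc i))

sumℕ : ∀ {n} → (Fin n → ℕ) → ℕ
sumℕ {zero}  f = 0
sumℕ {suc n} f = f zero + sumℕ (λ i → f (suc i))

numEdges : ∀ {n} → SGraph n → ℕ
numEdges {n} Γ = sumℕ (λ i → count (λ j → (toℕ i <ᵇ toℕ j) ∧ is-just (Γ i j)))

deg : ∀ {n} → SGraph n → Fin n → ℕ
deg Γ v = count (λ j → is-just (Γ v j))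

pendant : ∀ {n} → SGraph n → ℕ
pendant Γ = count (λ v → deg Γ v ≡ᵇ 1)

-- c(Γ) = |E| - |V| + ω for a CONNECTED graph (ω = 1)
cyc : ∀ {n} → SGraph n → ℕ
cyc {n} Γ = (numEdges Γ + 1) ∸ n

data Reach {n} (Γ : SGraph n) : Fin n → Fin n → Set where
  here : ∀ {u} → Reach Γ u u
  step : ∀ {u w v} → Adj Γ u w → Reach Γ w v → Reach Γ u v

Connected : ∀ {n} → SGraph n → Set
Connected Γ = ∀ u v → Reach Γ u v

next : ∀ {k} .{{_ : NonZero k}} → Fin k → Fin k
next {k} i = suc (toℕ i) mod k

record Cycle {n} (Γ : SGraph n) : Set where
  field
    len  : ℕ
    vtx  : Fin (3 + len) → Fin n
    inj  : Injective _≡_ _≡_ vtx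
    adj  : ∀ i → Adj Γ (vtx i) (vtx (next i))

open Cycle public

OnCycle : ∀ {n} {Γ : SGraph n} → Cycle Γ → Fin n → Set
OnCycle C u = ∃[ i ] vtx C i ≡ u

CycleEdge : ∀ {n} {Γ : SGraph n} → Cycle Γ → Fin n → Fin n → Set
CycleEdge C u v =
  ∃[ i ] ((vtx C i ≡ u × vtx C (next i) ≡ v) ⊎ (vtx C i ≡ v × vtx C (next i) ≡ u))

cycleGraph : ∀ {n} {Γ : SGraph n} → (C : Cycle Γ) → SGraph (3 + len C)
cycleGraph {Γ = Γ} C i j =
  if does (j ≟ next i) ∨ does (i ≟ next j) then Γ (vtx C i) (vtx C j) else nothing

cycleNullity≡ : ∀ {n} {Γ : SGraph n} → (C : Cycle Γ) → ℕ → Set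
cycleNullity≡ C k = η≡ (cycleGraph C) k

IsTree : ∀ {n} → SGraph n → Set
IsTree Γ = Connected Γ × ¬ Cycle Γ

induced : ∀ {m n} → SGraph n → (Fin m → Fin n) → SGraph m
induced Γ f i j = Γ (f i) (f j)

record Path {n} (Γ : SGraph n) (u v : Fin n) : Set where
  field
    plen   : ℕ
    ppos   : 1 ≤ plen
    pvtx   : Fin (suc plen) → Fin n
    pinj   : Injective _≡_ _≡_ pvtx
    pstart : pvtx zero ≡ u
    pend   : pvtx (fromℕ plen) ≡ v
    padj   : ∀ (i : Fin plen) → Adj Γ (pvtx (inject₁ i)) (pvtx (suc i))

open Path public

OnPath : ∀ {n} {Γ : SGraph n} {u v} → Path Γ u v → Fin n → Set
OnPath P w = ∃[ i ] pvtx P i ≡ w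

PathEdge : ∀ {n} {Γ : SGraph n} {u v} → Path Γ u v → Fin n → Fin n → Set
PathEdge P a b =
  ∃[ i ] ((pvtx P (inject₁ i) ≡ a × pvtx P (suc i) ≡ b)
         ⊎ (pvtx P (inject₁ i) ≡ b × pvtx P (suc i) ≡ a))

InternallyDisjoint : ∀ {n} {Γ : SGraph n} {u v} → Path Γ u v → Path Γ u v → Set
InternallyDisjoint {u = u} {v} P Q =
  ∀ i j → pvtx P i ≡ pvtx Q j → (pvtx P i ≡ u ⊎ pvtx P i ≡ v)

Form1 : ∀ {n} → SGraph n → Set
Form1 {n} Γ =
  Σ ℕ λ m → Σ (Fin m → Fin n) λ f →
  Σ (Fin (cyc Γ) → Cycle Γ) λ C → Σ (Fin (cyc Γ) → Fin m) λ leaf →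
    Injective _≡_ _≡_ f
  × IsTree (induced Γ f)
  × η≡ (induced Γ f) (pendant (induced Γ f) ∸ 1)
  × cyc Γ ≤ pendant (induced Γ f)
  × Injective _≡_ _≡_ leaf
  × (∀ a → deg (induced Γ f) (leaf a) ≡ 1)
  × (∀ a b → a ≢ b → ∀ i j → vtx (C a) i ≢ vtx (C b) j)
  × (∀ a → OnCycle (C a) (f (leaf a)))
  × (∀ a i → OnCycle (C a) (f i) → i ≡ leaf a)
  × (∀ a → cycleNullity≡ (C a) 2)
  × (∀ u → (∃[ i ] f i ≡ u) ⊎ (∃[ a ] OnCycle (C a) u))
  × (∀ u v → Adj Γ u v →
       (∃[ i ] ∃[ j ] (f i ≡ u × f j ≡ v)) ⊎ (∃[ a ] CycleEdge (C a) u v))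

IsInfinityGraph : ∀ {n} → SGraph n → Set
IsInfinityGraph {n} Γ =
  Σ (Cycle Γ) λ C₁ → Σ (Cycle Γ) λ C₂ → Σ (Fin n) λ w →
    OnCycle C₁ w × OnCycle C₂ w
  × (∀ u → OnCycle C₁ u → OnCycle C₂ u → u ≡ w)
  × (∀ u → OnCycle C₁ u ⊎ OnCycle C₂ u)
  × (∀ u v → Adj Γ u v → CycleEdge C₁ u v ⊎ CycleEdge C₂ u v)

IsThetaGraph : ∀ {n} → SGraph n → Set
IsThetaGraph {n} Γ =
  Σ (Fin n) λ u → Σ (Fin n) λ v →
  Σ (Path Γ u v) λ P₁ → Σ (Path Γ u v) λ P₂ → Σ (Path Γ u v) λ P₃ →
    InternallyDisjoint P₁ P₂ × InternallyDisjoint P₁ P₃ × InternallyDisjoint P₂ P₃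
  × ¬ (plen P₁ ≡ 1 × plen P₂ ≡ 1)
  × ¬ (plen P₁ ≡ 1 × plen P₃ ≡ 1)
  × ¬ (plen P₂ ≡ 1 × plen P₃ ≡ 1)
  × (∀ w → OnPath P₁ w ⊎ OnPath P₂ w ⊎ OnPath P₃ w)
  × (∀ a b → Adj Γ a b → PathEdge P₁ a b ⊎ PathEdge P₂ a b ⊎ PathEdge P₃ a b)

AllCyclesNullity2 : ∀ {n} → SGraph n → Set
AllCyclesNullity2 Γ = ∀ (C : Cycle Γ) → cycleNullity≡ C 2

Form2 : ∀ {n} → SGraph n → Set
Form2 Γ = IsInfinityGraph Γ × AllCyclesNullity2 Γ

Form3 : ∀ {n} → SGraph n → Set
Form3 Γ = IsThetaGraph Γ × AllCyclesNullity2 Γ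

{-# OPTIONS --safe #-}
-- Put e = Σ_v (deg v ∸ 2). By the handshake lemma 2 c + p − 1 = e + 1, so the condition says that the kernel has
-- dimension e + 1.
--
-- Explore the graph from a set Z on which kernel vectors are required to vanish. If y ∉ Z is the only neighbour of some
-- v ∈ Z outside Z, then the equation at v forces x y = 0; otherwise requiring x y = 0 costs one dimension. Hence the
-- dimension of the kernel vectors vanishing on Z is at most
--   Ψ Z = Σ_{v ∈ Z} (#(N(v) ∖ Z) ∸ 1) + Σ_{v ∉ Z} (deg v ∸ 2).
-- Starting at a leaf, or going round a cycle that ends in a vertex of degree ≥ 3, this gives the upper bound e + 1, and if
-- it is attained then the set reached is tight (the bound Ψ is attained) and remains so under all further exploration.
-- In a tight set no step may gain anything, and this forces a vertex with two explored neighbours to have degree 2, with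
-- no other unexplored neighbour at these two. So every ear of a tight set is a bare path, and every cycle disjoint from a
-- tight set is attached to the rest by a single edge at a single vertex of degree 3.
--
-- With a leaf, every cycle is therefore such a pendant cycle; it has nullity 2, and removing it leaves a smaller graph
-- that attains the bound and has a leaf, so one ends with a tree. Without leaves, a non-backtracking walk leaving a cycle C
-- at a vertex of degree ≥ 3 closes up in itself (a pendant cycle), or in C at its starting point (an ∞-graph) or elsewhere
-- (a θ-graph).
--
-- That a signed cycle has nullity 0 or 2 follows from the signed shift, which acts on the kernel with square −1.
-- Conversely, the e + 1 independent kernel vectors are glued from kernel vectors of the tree and of the cycles.
module Submission where

open import Defs
open import Data.Nat using (ℕ; zero; suc; pred; _+_; _*_; _∸_; _≤_; _<_; z≤n; s≤s; _<ᵇ_; _≡ᵇ_)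
import Data.Nat.Properties as ℕ
open import Data.Nat.Solver using () renaming (module +-*-Solver to ℕ-Solver)
open import Data.Nat.DivMod using (_%_; _mod_; m%n<n; m<n⇒m%n≡m; n%n≡0; [m+n]%n≡m%n; %-distribˡ-+; m%n%n≡m%n)
open import Data.Nat.Induction using (<-rec)
open import Data.Fin using (Fin; zero; suc; toℕ; fromℕ; fromℕ<; inject₁; punchIn; punchOut; splitAt; join; _≟_)
open import Data.Fin.Properties using (any?; punchInᵢ≢i; punchIn-injective; punchIn-punchOut; suc-injective; toℕ-injective; injective⇒≤; toℕ<n; toℕ-fromℕ<; toℕ-fromℕ; toℕ-inject₁; join-splitAt)
open import Data.Bool using (Bool; true; false; if_then_else_; _∨_; _∧_; not; T)
open import Data.Bool.Properties using (T?)
open import Data.Maybe using (just; nothing; is-just)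
open import Data.Sign using (Sign)
open import Data.Rational using (ℚ; 0ℚ; 1ℚ; -_; 1/_; ≢-nonZero; NonNegative; nonNegative) renaming (_+_ to _+ℚ_; _*_ to _*ℚ_)
import Data.Rational as ℚ
import Data.Rational.Properties as ℚ
open import Data.Rational.Solver using () renaming (module +-*-Solver to ℚ-Solver)
open import Data.List using (List; []; _∷_; length)
open import Data.List.Membership.Propositional using (_∈_; _∉_)
import Data.List.Membership.DecPropositional as DecMembership
open import Data.List.Relation.Unary.Any using (here; there)
open import Data.List.Relation.Unary.All as All using (All; []; _∷_)
open import Data.List.Relation.Unary.AllPairs using ([]; _∷_)
open import Data.List.Relation.Unary.Unique.Propositional using (Unique)
open import Data.Vec.Functional using (insertAt) renaming (_∷_ to _∷ᵛ_)
open import Data.Vec.Functional.Properties using (insertAt-lookup; insertAt-punchIn)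
open import Data.Product using (Σ; ∃; ∃₂; _×_; _,_; proj₁; proj₂)
open import Data.Sum using (_⊎_; inj₁; inj₂; [_,_]′)
open import Data.Unit using (tt)
open import Data.Empty using (⊥; ⊥-elim)
open import Function using (id)
open import Function.Bundles using (_⇔_; mk⇔)
open import Function.Definitions using (Injective)
open import Relation.Nullary using (¬_; yes; no; does; Dec; ¬?; _×-dec_)
open import Relation.Nullary.Decidable using (decidable-stable)
open import Relation.Binary using (tri<; tri≈; tri>)
open import Relation.Binary.PropositionalEquality using (_≡_; _≢_; refl; sym; trans; cong; cong₂; subst; module ≡-Reasoning)

-- Linear algebra over ℚ

-- The two terms of `Ψ` count free choices. The equation at v ∈ Z determines one unexplored
-- neighbour of v by the others, which leaves one choice fewer than v has such neighbours. A vertex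
-- outside Z will be entered through one edge and will then determine one neighbour, which leaves
-- deg - 2. The first vertex is entered through no edge: it keeps deg - 1 choices, and one dimension
-- has already gone into making it vanish. At a leaf truncation makes both counts 0; elsewhere the
-- start is worse by one, and the bound would come out as e + 2. A cycle repairs this, since the
-- vertex that closes it is entered through two edges. The repair shows only if that vertex has
-- degree at least 3, because for degree 2 the count is 0 either way. This is why 2-regular graphs
-- are treated apart. No sign or length of a cycle is ever computed. Nullity 2 is used only through
-- kernel vectors with the values 0 and 1 prescribed at two adjacent vertices.

∑-cong : ∀ {n} {f g : Fin n → ℚ} → (∀ i → f i ≡ g i) → ∑ f ≡ ∑ g
∑-cong {zero}  eq = refl
∑-cong {suc n} eq = cong₂ _+ℚ_ (eq zero) (∑-cong (λ i → eq (suc i)))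

∑-0 : ∀ {n} {f : Fin n → ℚ} → (∀ i → f i ≡ 0ℚ) → ∑ f ≡ 0ℚ
∑-0 {zero}  eq = refl
∑-0 {suc n} eq = cong₂ _+ℚ_ (eq zero) (∑-0 (λ i → eq (suc i)))

∑-+ : ∀ {n} (f g : Fin n → ℚ) → ∑ (λ i → f i +ℚ g i) ≡ ∑ f +ℚ ∑ g
∑-+ {zero}  f g = refl
∑-+ {suc n} f g = trans (cong ((f zero +ℚ g zero) +ℚ_) (∑-+ (λ i → f (suc i)) (λ i → g (suc i))))
  (solve 4 (λ a b c d → (a :+ b) :+ (c :+ d) := (a :+ c) :+ (b :+ d)) refl
    (f zero) (g zero) (∑ (λ i → f (suc i))) (∑ (λ i → g (suc i))))
  where open ℚ-Solver

∑-*ˡ : ∀ {n} (c : ℚ) (f : Fin n → ℚ) → ∑ (λ i → c *ℚ f i) ≡ c *ℚ ∑ f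
∑-*ˡ {zero}  c f = sym (ℚ.*-zeroʳ c)
∑-*ˡ {suc n} c f = trans (cong (c *ℚ f zero +ℚ_) (∑-*ˡ c (λ i → f (suc i))))
  (sym (ℚ.*-distribˡ-+ c (f zero) _))

∑-swap : ∀ {n m} (f : Fin n → Fin m → ℚ) → ∑ (λ i → ∑ (f i)) ≡ ∑ (λ j → ∑ (λ i → f i j))
∑-swap {zero} {m} f = sym (∑-0 {m} (λ _ → refl))
∑-swap {suc n} {m} f = trans (cong (∑ (f zero) +ℚ_) (∑-swap (λ i → f (suc i))))
  (sym (∑-+ (f zero) (λ j → ∑ (λ i → f (suc i) j))))

∑-remove : ∀ {n} (i : Fin (suc n)) (f : Fin (suc n) → ℚ) → ∑ f ≡ f i +ℚ ∑ (λ j → f (punchIn i j))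
∑-remove zero f = refl
∑-remove {suc n} (suc i) f = trans (cong (f zero +ℚ_) (∑-remove i (λ j → f (suc j))))
  (solve 3 (λ a b c → a :+ (b :+ c) := b :+ (a :+ c)) refl (f zero) (f (suc i)) _)
  where open ℚ-Solver

∑-single : ∀ {n} (f : Fin n → ℚ) a → (∀ j → j ≢ a → f j ≡ 0ℚ) → ∑ f ≡ f a
∑-single {suc n} f a z = trans (∑-remove a f)
  (trans (cong (f a +ℚ_) (∑-0 (λ j → z _ (punchInᵢ≢i a j)))) (ℚ.+-identityʳ (f a)))

∑-pair : ∀ {n} (f : Fin n → ℚ) {a b} → a ≢ b → (∀ j → j ≢ a → j ≢ b → f j ≡ 0ℚ) → ∑ f ≡ f a +ℚ f b
∑-pair {suc n} f {a} {b} a≢b z = trans (∑-remove a f) (cong (f a +ℚ_)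
  (trans (∑-single (λ j → f (punchIn a j)) (punchOut a≢b) away) (cong f (punchIn-punchOut a≢b))))
  where
  away : ∀ j → j ≢ punchOut a≢b → f (punchIn a j) ≡ 0ℚ
  away j j≢ = z _ (punchInᵢ≢i a j) (λ eq → j≢ (punchIn-injective a j (punchOut a≢b) (trans eq (sym (punchIn-punchOut a≢b)))))

rowOf : ∀ {n} → (Fin n → Fin n → ℚ) → (Fin n → ℚ) → Fin n → ℚ
rowOf A z i = ∑ (λ j → A i j *ℚ z j)

rowOf-pair : ∀ {n} (A : Fin n → Fin n → ℚ) (z : Fin n → ℚ) i {a b α β} → a ≢ b → (∀ j → j ≢ a → j ≢ b → A i j ≡ 0ℚ) →
  A i a ≡ α → A i b ≡ β → rowOf A z i ≡ α *ℚ z a +ℚ β *ℚ z b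
rowOf-pair A z i {a} {b} a≢b off refl refl = ∑-pair (λ j → A i j *ℚ z j) a≢b
  (λ j ne ne′ → trans (cong (_*ℚ z j) (off j ne ne′)) (ℚ.*-zeroˡ (z j)))

*-≢0 : ∀ {a b} → a ≢ 0ℚ → a *ℚ b ≡ 0ℚ → b ≡ 0ℚ
*-≢0 {a} {b} a≢0 eq = begin
  b                       ≡⟨ sym (ℚ.*-identityˡ b) ⟩
  1ℚ *ℚ b                 ≡⟨ cong (_*ℚ b) (sym (ℚ.*-inverseˡ a)) ⟩
  (1/ a *ℚ a) *ℚ b        ≡⟨ ℚ.*-assoc (1/ a) a b ⟩
  1/ a *ℚ (a *ℚ b)        ≡⟨ cong (1/ a *ℚ_) eq ⟩
  1/ a *ℚ 0ℚ              ≡⟨ ℚ.*-zeroʳ (1/ a) ⟩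
  0ℚ                      ∎
  where
  open ≡-Reasoning
  instance _ = ≢-nonZero a≢0

square-nonNeg : ∀ a → NonNegative (a *ℚ a)
square-nonNeg a with ℚ.≤-total 0ℚ a
... | inj₁ 0≤a = ℚ.nonNeg*nonNeg⇒nonNeg a {{nonNegative 0≤a}} a {{nonNegative 0≤a}}
... | inj₂ a≤0 = ℚ.nonPos*nonPos⇒nonPos a {{ℚ.nonPositive a≤0}} a {{ℚ.nonPositive a≤0}}

-- Squares of rationals are non-negative. This is what rules out a rational square root of -1 in
-- `nonzero⇒nullity2`.
sum-of-squares≢0 : ∀ {a} b → a ≢ 0ℚ → a *ℚ a +ℚ b *ℚ b ≢ 0ℚ
sum-of-squares≢0 {a} b a≢0 eq = a≢0 (*-≢0 a≢0 a²≡0)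
  where
  a²≡0 : a *ℚ a ≡ 0ℚ
  a²≡0 = ℚ.≤-antisym
    (subst (a *ℚ a ℚ.≤_) eq (subst (ℚ._≤ a *ℚ a +ℚ b *ℚ b) (ℚ.+-identityʳ _)
      (ℚ.+-monoʳ-≤ (a *ℚ a) (ℚ.nonNegative⁻¹ (b *ℚ b) {{square-nonNeg b}}))))
    (ℚ.nonNegative⁻¹ (a *ℚ a) {{square-nonNeg a}})

-- Closure under `x + c y` is exactly the operation of a row reduction. Applied to a member and
-- itself with `c = −1` it yields the zero vector, and `subspace-combination` derives nonempty
-- linear combinations from it.
record Subspace {n} (P : (Fin n → ℚ) → Set) : Set where
  constructor subspace
  field closed : ∀ {x y} c → P x → P y → P (λ j → x j +ℚ c *ℚ y j)
open Subspace public

-- The counterpart of `KerDimAtLeast` for an arbitrary predicate, so that vanishing at chosen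
-- vertices can be added to the kernel condition.
record DimAtLeast {n} (P : (Fin n → ℚ) → Set) (k : ℕ) : Set where
  constructor basis
  field
    vecs  : Fin k → Fin n → ℚ
    indep : LinIndep vecs
    mem   : ∀ i → P (vecs i)

record Ker {n} (A : Fin n → Fin n → ℚ) (x : Fin n → ℚ) : Set where
  constructor ker
  field rows : InKernel A x
open Ker public

fromKer : ∀ {n} (A : Fin n → Fin n → ℚ) {k} → KerDimAtLeast A k → DimAtLeast (Ker A) k
fromKer A (vs , ind , p) = basis vs ind (λ i → ker (p i))

toKer : ∀ {n} (A : Fin n → Fin n → ℚ) {k} → DimAtLeast (Ker A) k → KerDimAtLeast A k
toKer A (basis vs ind p) = vs , ind , λ i → rows (p i)

∩0-subspace : ∀ {n} {P : (Fin n → ℚ) → Set} (q : Fin n) → Subspace P → Subspace (λ x → P x × x q ≡ 0ℚ)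
∩0-subspace q S = subspace λ { c (px , xq) (py , yq) → closed S c px py ,
  trans (cong₂ (λ a b → a +ℚ c *ℚ b) xq yq) (trans (ℚ.+-identityˡ _) (ℚ.*-zeroʳ c)) }

rowOf-+* : ∀ {n} (A : Fin n → Fin n → ℚ) x c y i → rowOf A (λ j → x j +ℚ c *ℚ y j) i ≡ rowOf A x i +ℚ c *ℚ rowOf A y i
rowOf-+* A x c y i = begin
  ∑ (λ j → A i j *ℚ (x j +ℚ c *ℚ y j))
    ≡⟨ ∑-cong (λ j → solve 4 (λ a x c y → a :* (x :+ c :* y) := a :* x :+ c :* (a :* y)) refl (A i j) (x j) c (y j)) ⟩
  ∑ (λ j → A i j *ℚ x j +ℚ c *ℚ (A i j *ℚ y j))
    ≡⟨ ∑-+ (λ j → A i j *ℚ x j) (λ j → c *ℚ (A i j *ℚ y j)) ⟩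
  ∑ (λ j → A i j *ℚ x j) +ℚ ∑ (λ j → c *ℚ (A i j *ℚ y j))
    ≡⟨ cong (∑ (λ j → A i j *ℚ x j) +ℚ_) (∑-*ˡ c (λ j → A i j *ℚ y j)) ⟩
  rowOf A x i +ℚ c *ℚ rowOf A y i ∎
  where open ≡-Reasoning ; open ℚ-Solver

Ker-subspace : ∀ {n} (A : Fin n → Fin n → ℚ) → Subspace (Ker A)
Ker-subspace A = subspace λ {x} {y} c (ker px) (ker py) → ker λ i → trans (rowOf-+* A x c y i)
  (trans (cong₂ (λ a b → a +ℚ c *ℚ b) (px i) (py i)) (trans (ℚ.+-identityˡ _) (ℚ.*-zeroʳ c)))

module _ {n} {P : (Fin n → ℚ) → Set} where

  dim-map : ∀ {Q : (Fin n → ℚ) → Set} {k} → (∀ x → P x → Q x) → DimAtLeast P k → DimAtLeast Q k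
  dim-map h (basis vs ind p) = basis vs ind (λ i → h _ (p i))

  -- A relation `d` among the swept vectors is a relation among the original ones whose coefficient
  -- at `i₀` is the sum of all `d j * c j`. With `c = 0` the lemma merely discards `vs i₀`.
  sweep : ∀ {k} (vs : Fin (suc k) → Fin n → ℚ) (i₀ : Fin (suc k)) (c : Fin k → ℚ) → LinIndep vs →
    LinIndep (λ j q → vs (punchIn i₀ j) q +ℚ c j *ℚ vs i₀ q)
  sweep vs i₀ c ind d eq j = trans (sym (insertAt-punchIn d i₀ e₀ j)) (ind e e-eq (punchIn i₀ j))
    where
    e₀ = ∑ (λ j → d j *ℚ c j)
    e = insertAt d i₀ e₀
    open ≡-Reasoning
    open ℚ-Solver
    e-eq : ∀ q → ∑ (λ i → e i *ℚ vs i q) ≡ 0ℚ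
    e-eq q = begin
      ∑ (λ i → e i *ℚ vs i q)
        ≡⟨ ∑-remove i₀ (λ i → e i *ℚ vs i q) ⟩
      e i₀ *ℚ vs i₀ q +ℚ ∑ (λ j → e (punchIn i₀ j) *ℚ vs (punchIn i₀ j) q)
        ≡⟨ cong₂ _+ℚ_ (cong (_*ℚ vs i₀ q) (insertAt-lookup d i₀ e₀))
             (∑-cong (λ j → cong (_*ℚ vs (punchIn i₀ j) q) (insertAt-punchIn d i₀ e₀ j))) ⟩
      e₀ *ℚ vs i₀ q +ℚ ∑ (λ j → d j *ℚ vs (punchIn i₀ j) q)
        ≡⟨ cong (_+ℚ _) (trans (ℚ.*-comm e₀ _) (sym (∑-*ˡ (vs i₀ q) (λ j → d j *ℚ c j)))) ⟩
      ∑ (λ j → vs i₀ q *ℚ (d j *ℚ c j)) +ℚ ∑ (λ j → d j *ℚ vs (punchIn i₀ j) q)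
        ≡⟨ sym (∑-+ (λ j → vs i₀ q *ℚ (d j *ℚ c j)) _) ⟩
      ∑ (λ j → vs i₀ q *ℚ (d j *ℚ c j) +ℚ d j *ℚ vs (punchIn i₀ j) q)
        ≡⟨ ∑-cong (λ j → solve 4 (λ v d c w → v :* (d :* c) :+ d :* w := d :* (w :+ c :* v)) refl
             (vs i₀ q) (d j) (c j) (vs (punchIn i₀ j) q)) ⟩
      ∑ (λ j → d j *ℚ (vs (punchIn i₀ j) q +ℚ c j *ℚ vs i₀ q))
        ≡⟨ eq q ⟩
      0ℚ ∎

  -- If some vector is nonzero at `q`, it serves as pivot and clears the others there; if none is,
  -- any one of them may be discarded.
  dim-drop : ∀ {k} → Subspace P → DimAtLeast P (suc k) → (q : Fin n) → DimAtLeast (λ x → P x × x q ≡ 0ℚ) k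
  dim-drop {k} S (basis vs ind p) q with any? (λ i → ¬? (vs i q ℚ.≟ 0ℚ))
  ... | yes (i₀ , v≢0) = basis _ (sweep vs i₀ c ind) (λ j → closed S (c j) (p _) (p i₀) , vanish j)
    where
    instance _ = ≢-nonZero v≢0
    c : Fin k → ℚ
    c j = - (vs (punchIn i₀ j) q *ℚ 1/ vs i₀ q)
    open ℚ-Solver
    vanish : ∀ j → vs (punchIn i₀ j) q +ℚ c j *ℚ vs i₀ q ≡ 0ℚ
    vanish j = trans (solve 3 (λ a b c → a :+ (:- (a :* b)) :* c := a :+ (:- (a :* (b :* c)))) refl
        (vs (punchIn i₀ j) q) (1/ vs i₀ q) (vs i₀ q))
      (trans (cong (λ t → vs (punchIn i₀ j) q +ℚ - (vs (punchIn i₀ j) q *ℚ t)) (ℚ.*-inverseˡ (vs i₀ q)))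
        (trans (cong (λ t → vs (punchIn i₀ j) q +ℚ - t) (ℚ.*-identityʳ (vs (punchIn i₀ j) q))) (ℚ.+-inverseʳ (vs (punchIn i₀ j) q))))
  ... | no none = basis _ (sweep vs zero (λ _ → 0ℚ) ind) (λ j → closed S 0ℚ (p (suc j)) (p zero) ,
    trans (cong₂ _+ℚ_ (vanish j) (ℚ.*-zeroˡ (vs zero q))) (ℚ.+-identityˡ 0ℚ))
    where
    vanish : ∀ j → vs (suc j) q ≡ 0ℚ
    vanish j = decidable-stable (vs (suc j) q ℚ.≟ 0ℚ) (λ v≢0 → none (suc j , v≢0))

  dim-≤ : ∀ {j k} → Subspace P → j ≤ k → DimAtLeast P k → DimAtLeast P j
  dim-≤ {k = zero}  S z≤n D = D
  dim-≤ {j} {suc k} S j≤k D@(basis vs ind p) with ℕ.m≤n⇒m<n∨m≡n j≤k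
  ... | inj₂ refl = D
  ... | inj₁ (s≤s j≤k′) = dim-≤ S j≤k′
    (basis _ (sweep vs zero (λ _ → 0ℚ) ind) (λ i → closed S 0ℚ (p (suc i)) (p zero)))

  dim-nonzero : ∀ {k} → DimAtLeast P (suc k) → ∃ λ x → P x × ∃ λ q → x q ≢ 0ℚ
  dim-nonzero {k} (basis vs ind p) with any? (λ q → ¬? (vs zero q ℚ.≟ 0ℚ))
  ... | yes (q , v≢0) = vs zero , p zero , q , v≢0
  ... | no none = ⊥-elim (1≢0 (ind e e-eq zero))
    where
    1≢0 : 1ℚ ≢ 0ℚ
    1≢0 ()
    e : Fin (suc k) → ℚ
    e = 1ℚ ∷ᵛ (λ _ → 0ℚ)
    e-eq : ∀ q → ∑ (λ i → e i *ℚ vs i q) ≡ 0ℚ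
    e-eq q = cong₂ _+ℚ_
      (trans (ℚ.*-identityˡ _) (decidable-stable (vs zero q ℚ.≟ 0ℚ) (λ v≢0 → none (q , v≢0))))
      (∑-0 (λ i → ℚ.*-zeroˡ (vs (suc i) q)))

  dim-trivial : ∀ {k} → (∀ x → P x → ∀ q → x q ≡ 0ℚ) → DimAtLeast P k → k ≡ 0
  dim-trivial {zero}  z D = refl
  dim-trivial {suc k} z D with dim-nonzero D
  ... | x , px , q , x≢0 = ⊥-elim (x≢0 (z x px q))

  dim-0 : DimAtLeast P 0
  dim-0 = basis (λ ()) (λ _ _ ()) (λ ())

adjoin-indep : ∀ {n k} {vs : Fin k → Fin n → ℚ} {z : Fin n → ℚ} (q : Fin n) → LinIndep vs →
  (∀ i → vs i q ≡ 0ℚ) → z q ≢ 0ℚ → LinIndep {k = suc k} (z ∷ᵛ vs)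
adjoin-indep {vs = vs} {z} q ind vq zq c eq = λ { zero → c₀ ; (suc i) → ind (λ i → c (suc i)) rest i }
  where
  c₀ : c zero ≡ 0ℚ
  c₀ = *-≢0 zq (trans (ℚ.*-comm (z q) (c zero)) (trans (sym (ℚ.+-identityʳ _))
    (trans (cong (c zero *ℚ z q +ℚ_) (sym (∑-0 (λ i → trans (cong (c (suc i) *ℚ_) (vq i)) (ℚ.*-zeroʳ (c (suc i)))))))
      (eq q))))
  rest : ∀ j → ∑ (λ i → c (suc i) *ℚ vs i j) ≡ 0ℚ
  rest j = trans (sym (ℚ.+-identityˡ s)) (trans (cong (_+ℚ s) (sym (trans (cong (_*ℚ z j) c₀) (ℚ.*-zeroˡ (z j))))) (eq j))
    where s = ∑ (λ i → c (suc i) *ℚ vs i j)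

-- The lower bounds for the nullities of all three forms rest on this: the new vectors are diagonal
-- at the coordinates `q`, the old ones vanish there, and evaluation at `q a` isolates the
-- coefficient of `z a`.
adjoin-all : ∀ {n} {P : (Fin n → ℚ) → Set} c {k} {vs : Fin k → Fin n → ℚ} → LinIndep vs → (∀ i → P (vs i)) →
  (z : Fin c → Fin n → ℚ) (q : Fin c → Fin n) → (∀ a → P (z a)) → (∀ a → z a (q a) ≢ 0ℚ) →
  (∀ a b → a ≢ b → z a (q b) ≡ 0ℚ) → (∀ i a → vs i (q a) ≡ 0ℚ) → DimAtLeast P (c + k)
adjoin-all zero ind p z q pz zq off vq = basis _ ind p
adjoin-all {P = P} (suc c) {k} {vs} ind p z q pz zq off vq = subst (DimAtLeast P) (ℕ.+-suc c k)
  (adjoin-all {P = P} c {vs = z zero ∷ᵛ vs} (adjoin-indep (q zero) ind (λ i → vq i zero) (zq zero))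
    (λ { zero → pz zero ; (suc i) → p i }) (λ a → z (suc a)) (λ a → q (suc a)) (λ a → pz (suc a)) (λ a → zq (suc a))
    (λ a b a≢b → off (suc a) (suc b) λ { refl → a≢b refl })
    (λ { zero a → off zero (suc a) (λ ()) ; (suc i) a → vq i (suc a) }))

kernel-vanishing-at : ∀ {n} (A : Fin n → Fin n → ℚ) {k} → KerDimAtLeast A (2 + k) → ∀ q →
  ∃ λ x → Ker A x × x q ≡ 0ℚ × ∃ λ p → x p ≢ 0ℚ
kernel-vanishing-at A D q =
  let (x , (k , xq) , nz) = dim-nonzero (dim-drop (Ker-subspace A) (fromKer A D) q) in x , k , xq , nz

kernel-vanishing-at₂ : ∀ {n} (A : Fin n → Fin n → ℚ) {k} → KerDimAtLeast A (3 + k) → ∀ q q′ →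
  ∃ λ x → Ker A x × x q ≡ 0ℚ × x q′ ≡ 0ℚ × ∃ λ p → x p ≢ 0ℚ
kernel-vanishing-at₂ A D q q′ =
  let (x , ((k , xq) , xq′) , nz) = dim-nonzero (dim-drop (∩0-subspace q (Ker-subspace A)) (dim-drop (Ker-subspace A) (fromKer A D) q) q′)
  in x , k , xq , xq′ , nz

-- Sums and counting over Fin n

⟦_⟧ : Bool → ℕ
⟦ b ⟧ = if b then 1 else 0

δ : ∀ {n} → Fin n → Fin n → ℕ
δ a j = ⟦ does (j ≟ a) ⟧

δ-refl : ∀ {n} (a : Fin n) → δ a a ≡ 1
δ-refl a with a ≟ a
... | yes _ = refl
... | no a≢a = ⊥-elim (a≢a refl)

δ-≢ : ∀ {n} {a j : Fin n} → j ≢ a → δ a j ≡ 0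
δ-≢ {a = a} {j} j≢a with j ≟ a
... | yes j≡a = ⊥-elim (j≢a j≡a)
... | no _ = refl

sum-cong : ∀ {n} {f g : Fin n → ℕ} → (∀ i → f i ≡ g i) → sumℕ f ≡ sumℕ g
sum-cong {zero}  eq = refl
sum-cong {suc n} eq = cong₂ _+_ (eq zero) (sum-cong (λ i → eq (suc i)))

sum-mono : ∀ {n} {f g : Fin n → ℕ} → (∀ i → f i ≤ g i) → sumℕ f ≤ sumℕ g
sum-mono {zero}  le = z≤n
sum-mono {suc n} le = ℕ.+-mono-≤ (le zero) (sum-mono (λ i → le (suc i)))

sum-0 : ∀ {n} → sumℕ {n} (λ _ → 0) ≡ 0
sum-0 {zero}  = refl
sum-0 {suc n} = sum-0 {n}

sum-const : ∀ n c → sumℕ {n} (λ _ → c) ≡ n * c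
sum-const zero    c = refl
sum-const (suc n) c = cong (c +_) (sum-const n c)

sum-+ : ∀ {n} (f g : Fin n → ℕ) → sumℕ (λ i → f i + g i) ≡ sumℕ f + sumℕ g
sum-+ {zero}  f g = refl
sum-+ {suc n} f g = trans (cong (f zero + g zero +_) (sum-+ (λ i → f (suc i)) (λ i → g (suc i))))
  (solve 4 (λ a b c d → (a :+ b) :+ (c :+ d) := (a :+ c) :+ (b :+ d)) refl (f zero) (g zero) _ _)
  where open ℕ-Solver

sum-swap : ∀ {n m} (f : Fin n → Fin m → ℕ) → sumℕ (λ i → sumℕ (f i)) ≡ sumℕ (λ j → sumℕ (λ i → f i j))
sum-swap {zero} {m} f = sym (sum-0 {m})
sum-swap {suc n} {m} f = trans (cong (sumℕ (f zero) +_) (sum-swap (λ i → f (suc i))))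
  (sym (sum-+ (f zero) (λ j → sumℕ (λ i → f (suc i) j))))

sum-δ : ∀ {n} (a : Fin n) → sumℕ (δ a) ≡ 1
sum-δ {suc n} zero    = cong suc (sum-0 {n})
sum-δ {suc n} (suc a) = trans (sum-cong shift) (sum-δ a)
  where
  shift : ∀ j → δ (suc a) (suc j) ≡ δ a j
  shift j with j ≟ a
  ... | yes _ = refl
  ... | no _ = refl

sum-lookup≤ : ∀ {n} (f : Fin n → ℕ) a → f a ≤ sumℕ f
sum-lookup≤ f zero    = ℕ.m≤m+n _ _
sum-lookup≤ f (suc a) = ℕ.≤-trans (sum-lookup≤ (λ i → f (suc i)) a) (ℕ.m≤n+m _ _)

sum-lookup₂≤ : ∀ {n} (f : Fin n → ℕ) {a b} → a ≢ b → f a + f b ≤ sumℕ f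
sum-lookup₂≤ f {zero}  {zero}  a≢b = ⊥-elim (a≢b refl)
sum-lookup₂≤ f {zero}  {suc b} a≢b = ℕ.+-monoʳ-≤ (f zero) (sum-lookup≤ (λ i → f (suc i)) b)
sum-lookup₂≤ f {suc a} {zero}  a≢b = subst (_≤ sumℕ f) (ℕ.+-comm (f zero) (f (suc a)))
  (ℕ.+-monoʳ-≤ (f zero) (sum-lookup≤ (λ i → f (suc i)) a))
sum-lookup₂≤ f {suc a} {suc b} a≢b = ℕ.≤-trans (sum-lookup₂≤ (λ i → f (suc i)) (λ eq → a≢b (cong suc eq))) (ℕ.m≤n+m _ _)

sum-mono-< : ∀ {n} {f g : Fin n → ℕ} a → (∀ i → f i + δ a i ≤ g i) → suc (sumℕ f) ≤ sumℕ g
sum-mono-< {f = f} {g} a le = subst (_≤ sumℕ g)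
  (trans (sum-+ f (δ a)) (trans (cong (sumℕ f +_) (sum-δ a)) (ℕ.+-comm (sumℕ f) 1))) (sum-mono le)

-- Transports sums between an induced subgraph and the whole graph. The induction splits `g` into
-- its value at `e zero` and the rest, to which the remaining injection applies.
sum-image : ∀ {m n} (e : Fin m → Fin n) → Injective _≡_ _≡_ e → (g : Fin n → ℕ) →
  (∀ j → (∀ i → e i ≢ j) → g j ≡ 0) → sumℕ (λ i → g (e i)) ≡ sumℕ g
sum-image {zero}  {n} e inj g off = trans (sym (sum-0 {n})) (sum-cong (λ j → sym (off j (λ ()))))
sum-image {suc m} e inj g off = begin
  g a + sumℕ (λ i → g (e (suc i)))
    ≡⟨ cong₂ _+_ (sym g₀-sum) (sum-cong {m} (λ i → g₁-≢ (λ eq → ne {i} (sym (inj eq))))) ⟩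
  sumℕ g₀ + sumℕ (λ i → g₁ (e (suc i)))
    ≡⟨ cong (sumℕ g₀ +_) (sum-image (λ i → e (suc i)) (λ eq → suc-injective (inj eq)) g₁ off₁) ⟩
  sumℕ g₀ + sumℕ g₁ ≡⟨ sym (sum-+ g₀ g₁) ⟩
  sumℕ (λ j → g₀ j + g₁ j) ≡⟨ sum-cong split ⟩
  sumℕ g ∎
  where
  open ≡-Reasoning
  a = e zero
  ne : ∀ {i : Fin m} → zero ≢ suc i
  ne ()
  g₀ g₁ : Fin _ → ℕ
  g₀ j = g a * δ a j
  g₁ j = if does (j ≟ a) then 0 else g j
  g₁-≢ : ∀ {j} → j ≢ a → g j ≡ g₁ j
  g₁-≢ {j} j≢a with j ≟ a
  ... | yes j≡a = ⊥-elim (j≢a j≡a)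
  ... | no _ = refl
  sum-*ˡ : ∀ {n} c (f : Fin n → ℕ) → sumℕ (λ i → c * f i) ≡ c * sumℕ f
  sum-*ˡ {zero}  c f = sym (ℕ.*-zeroʳ c)
  sum-*ˡ {suc n} c f = trans (cong (c * f zero +_) (sum-*ˡ c (λ i → f (suc i)))) (sym (ℕ.*-distribˡ-+ c (f zero) _))
  g₀-sum : sumℕ g₀ ≡ g a
  g₀-sum = trans (sum-*ˡ (g a) (δ a)) (trans (cong (g a *_) (sum-δ a)) (ℕ.*-identityʳ (g a)))
  split : ∀ j → g₀ j + g₁ j ≡ g j
  split j with j ≟ a
  ... | yes refl = trans (ℕ.+-identityʳ _) (ℕ.*-identityʳ (g a))
  ... | no _ = cong (_+ g j) (ℕ.*-zeroʳ (g a))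
  off₁ : ∀ j → (∀ i → e (suc i) ≢ j) → g₁ j ≡ 0
  off₁ j h with j ≟ a
  ... | yes _ = refl
  ... | no j≢a = off j λ { zero eq → j≢a (sym eq) ; (suc i) eq → h i eq }

∑-image : ∀ {m n} (e : Fin m → Fin n) → Injective _≡_ _≡_ e → (g : Fin n → ℚ) →
  (∀ j → (∀ i → e i ≢ j) → g j ≡ 0ℚ) → ∑ (λ i → g (e i)) ≡ ∑ g
∑-image {zero}  {n} e inj g off = sym (∑-0 (λ j → off j (λ ())))
∑-image {suc m} e inj g off = begin
  g a +ℚ ∑ (λ i → g (e (suc i)))
    ≡⟨ cong₂ _+ℚ_ (sym g₀-sum) (∑-cong {m} (λ i → g₁-≢ (λ eq → ne {i} (sym (inj eq))))) ⟩
  ∑ g₀ +ℚ ∑ (λ i → g₁ (e (suc i)))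
    ≡⟨ cong (∑ g₀ +ℚ_) (∑-image (λ i → e (suc i)) (λ eq → suc-injective (inj eq)) g₁ off₁) ⟩
  ∑ g₀ +ℚ ∑ g₁ ≡⟨ sym (∑-+ g₀ g₁) ⟩
  ∑ (λ j → g₀ j +ℚ g₁ j) ≡⟨ ∑-cong split ⟩
  ∑ g ∎
  where
  open ≡-Reasoning
  a = e zero
  ne : ∀ {i : Fin m} → zero ≢ suc i
  ne ()
  g₀ g₁ : Fin _ → ℚ
  g₀ j = if does (j ≟ a) then g j else 0ℚ
  g₁ j = if does (j ≟ a) then 0ℚ else g j
  g₁-≢ : ∀ {j} → j ≢ a → g j ≡ g₁ j
  g₁-≢ {j} j≢a with j ≟ a
  ... | yes j≡a = ⊥-elim (j≢a j≡a)
  ... | no _ = refl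
  g₀-sum : ∑ g₀ ≡ g a
  g₀-sum = trans (∑-single g₀ a g₀-≢) g₀-≡
    where
    g₀-≢ : ∀ j → j ≢ a → g₀ j ≡ 0ℚ
    g₀-≢ j j≢a with j ≟ a
    ... | yes j≡a = ⊥-elim (j≢a j≡a)
    ... | no _ = refl
    g₀-≡ : g₀ a ≡ g a
    g₀-≡ with a ≟ a
    ... | yes _ = refl
    ... | no a≢a = ⊥-elim (a≢a refl)
  split : ∀ j → g₀ j +ℚ g₁ j ≡ g j
  split j with j ≟ a
  ... | yes _ = ℚ.+-identityʳ (g j)
  ... | no _ = ℚ.+-identityˡ (g j)
  off₁ : ∀ j → (∀ i → e (suc i) ≢ j) → g₁ j ≡ 0ℚ
  off₁ j h with j ≟ a
  ... | yes _ = refl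
  ... | no j≢a = off j λ { zero eq → j≢a (sym eq) ; (suc i) eq → h i eq }

count≡sum : ∀ {n} (P : Fin n → Bool) → count P ≡ sumℕ (λ i → ⟦ P i ⟧)
count≡sum {zero}  P = refl
count≡sum {suc n} P = cong (⟦ P zero ⟧ +_) (count≡sum (λ i → P (suc i)))

⟦⟧-mono : ∀ {a b} → (T a → T b) → ⟦ a ⟧ ≤ ⟦ b ⟧
⟦⟧-mono {false}         h = z≤n
⟦⟧-mono {true}  {true}  h = ℕ.≤-refl
⟦⟧-mono {true}  {false} h = ⊥-elim (h tt)

count-mono : ∀ {n} {P Q : Fin n → Bool} → (∀ j → T (P j) → T (Q j)) → count P ≤ count Q
count-mono {P = P} {Q} h = subst (_≤ count Q) (sym (count≡sum P))
  (subst (sumℕ (λ i → ⟦ P i ⟧) ≤_) (sym (count≡sum Q)) (sum-mono (λ i → ⟦⟧-mono (h i))))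

count-0 : ∀ {n} {P : Fin n → Bool} → (∀ j → ¬ T (P j)) → count P ≡ 0
count-0 {n} {P} h = ℕ.n≤0⇒n≡0 (subst (count P ≤_) (trans (count≡sum {n} (λ _ → false)) (sum-0 {n}))
  (count-mono {P = P} {λ _ → false} (λ j p → h j p)))

infixl 5 _∖_
_∖_ : ∀ {n} → (Fin n → Bool) → Fin n → Fin n → Bool
(P ∖ a) j = P j ∧ not (does (j ≟ a))

∖-intro : ∀ {n} (P : Fin n → Bool) {a j} → T (P j) → j ≢ a → T ((P ∖ a) j)
∖-intro P {a} {j} p j≢a with P j | j ≟ a
... | true | yes j≡a = ⊥-elim (j≢a j≡a)
... | true | no _    = tt

∖-elim : ∀ {n} (P : Fin n → Bool) {a j} → T ((P ∖ a) j) → T (P j) × j ≢ a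
∖-elim P {a} {j} p with P j | j ≟ a
... | true | no j≢a = tt , j≢a

count-∖ : ∀ {n} (P : Fin n → Bool) {a} → T (P a) → count P ≡ suc (count (P ∖ a))
count-∖ P {a} pa = begin
  count P ≡⟨ count≡sum P ⟩
  sumℕ (λ i → ⟦ P i ⟧) ≡⟨ sum-cong split ⟩
  sumℕ (λ i → δ a i + ⟦ (P ∖ a) i ⟧) ≡⟨ sum-+ (δ a) _ ⟩
  sumℕ (δ a) + sumℕ (λ i → ⟦ (P ∖ a) i ⟧) ≡⟨ cong₂ _+_ (sum-δ a) (sym (count≡sum (P ∖ a))) ⟩
  suc (count (P ∖ a)) ∎
  where
  open ≡-Reasoning
  split : ∀ j → ⟦ P j ⟧ ≡ δ a j + ⟦ (P ∖ a) j ⟧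
  split j with j ≟ a
  split j | yes refl with P j
  split j | yes refl | true = refl
  split j | no _ with P j
  ... | true = refl
  ... | false = refl

length≤count : ∀ {n} {P : Fin n → Bool} {L : List (Fin n)} → Unique L → All (λ j → T (P j)) L → length L ≤ count P
length≤count [] [] = z≤n
length≤count {P = P} {a ∷ L} (a∉ ∷ u) (pa ∷ ps) = subst (suc (length L) ≤_) (sym (count-∖ P pa))
  (s≤s (length≤count {P = P ∖ a} u (All.zipWith (λ { (ne , p) → ∖-intro P p (λ eq → ne (sym eq)) }) (a∉ , ps))))

count≤length : ∀ {n} {P : Fin n → Bool} (L : List (Fin n)) → (∀ j → T (P j) → j ∈ L) → count P ≤ length L
count≤length {P = P} [] h = ℕ.≤-reflexive (count-0 {P = P} (λ j p → none (h j p)))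
  where
  none : ∀ {j} → j ∉ []
  none ()
count≤length {P = P} (a ∷ L) h = bound
  where
  rest : count (P ∖ a) ≤ length L
  rest = count≤length L λ j p → drop j (∖-elim P p)
    where
    drop : ∀ j → T (P j) × j ≢ a → j ∈ L
    drop j (pj , j≢a) with h j pj
    ... | here j≡a = ⊥-elim (j≢a j≡a)
    ... | there j∈L = j∈L
  bound : count P ≤ suc (length L)
  bound with T? (P a)
  ... | yes pa = subst (_≤ suc (length L)) (sym (count-∖ P pa)) (s≤s rest)
  ... | no ¬pa = ℕ.≤-trans (count-mono {P = P} {P ∖ a} (λ j p → ∖-intro P p (λ { refl → ¬pa p })))
    (ℕ.≤-trans rest (ℕ.n≤1+n _))

-- Pigeonhole, used to find a neighbour that differs from finitely many given ones.
count-∃∉ : ∀ {n} {P : Fin n → Bool} (L : List (Fin n)) → length L < count P → ∃ λ j → T (P j) × j ∉ L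
count-∃∉ {P = P} L lt with any? (λ j → T? (P j) ×-dec ¬? (DecMembership._∈?_ _≟_ j L))
... | yes (j , p , j∉) = j , p , j∉
... | no none = ⊥-elim (ℕ.<⇒≱ lt (count≤length {P = P} L inL))
  where
  inL : ∀ j → T (P j) → j ∈ L
  inL j p with DecMembership._∈?_ _≟_ j L
  ... | yes j∈ = j∈
  ... | no j∉ = ⊥-elim (none (j , p , j∉))

record Enumeration {n} (P : Fin n → Bool) : Set where
  field
    size      : ℕ
    size≡     : size ≡ count P
    elt       : Fin size → Fin n
    elt-inj   : Injective _≡_ _≡_ elt
    elt-T     : ∀ i → T (P (elt i))
    elt-index : ∀ {j} → T (P j) → ∃ λ i → elt i ≡ j

enumerate : ∀ {n} (P : Fin n → Bool) → Enumeration P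
enumerate {zero}  P = record
  { size = 0 ; size≡ = refl ; elt = λ () ; elt-inj = λ { {()} } ; elt-T = λ () ; elt-index = λ { {()} } }
enumerate {suc n} P = extend (P zero) refl
  where
  open Enumeration (enumerate (λ i → P (suc i)))
  extend : ∀ b → P zero ≡ b → Enumeration P
  extend true eq = record
    { size = suc size ; size≡ = cong₂ _+_ (sym (cong ⟦_⟧ eq)) size≡ ; elt = e ; elt-inj = e-inj ; elt-T = e-T ; elt-index = e-index }
    where
    e : Fin (suc size) → Fin (suc n)
    e zero = zero
    e (suc i) = suc (elt i)
    e-inj : Injective _≡_ _≡_ e
    e-inj {zero}  {zero}  _ = refl
    e-inj {suc i} {suc j} q = cong suc (elt-inj (suc-injective q))
    e-T : ∀ i → T (P (e i))
    e-T zero    = subst T (sym eq) tt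
    e-T (suc i) = elt-T i
    e-index : ∀ {j} → T (P j) → ∃ λ i → e i ≡ j
    e-index {zero}  p = zero , refl
    e-index {suc j} p = suc (proj₁ (elt-index p)) , cong suc (proj₂ (elt-index p))
  extend false eq = record
    { size = size ; size≡ = trans size≡ (cong (λ b → ⟦ b ⟧ + count (λ i → P (suc i))) (sym eq))
    ; elt = λ i → suc (elt i) ; elt-inj = λ q → elt-inj (suc-injective q) ; elt-T = elt-T ; elt-index = e-index }
    where
    e-index : ∀ {j} → T (P j) → ∃ λ i → suc (elt i) ≡ j
    e-index {zero}  p = ⊥-elim (subst T eq p)
    e-index {suc j} p = proj₁ (elt-index p) , cong suc (proj₂ (elt-index p))

injection≤count : ∀ {k n} {P : Fin n → Bool} {h : Fin k → Fin n} → Injective _≡_ _≡_ h → (∀ i → T (P (h i))) → k ≤ count P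
injection≤count {k} {P = P} {h} inj hT = subst (k ≤_) size≡ (injective⇒≤ {f = λ i → proj₁ (elt-index (hT i))}
    (λ {i} {j} q → inj (trans (sym (proj₂ (elt-index (hT i)))) (trans (cong elt q) (proj₂ (elt-index (hT j)))))))
  where open Enumeration (enumerate P)

-- Degrees, edges and the excess

module _ {n} (Γ : SGraph n) (sg : IsSignedGraph Γ) where

  -- `numEdges` counts each edge from its end of smaller index. Of `up i j` and `up j i` only one
  -- can be nonzero, so together they account for one ordered adjacency.
  handshake : sumℕ (deg Γ) ≡ numEdges Γ + numEdges Γ
  handshake = begin
    sumℕ (deg Γ) ≡⟨ sum-cong (λ i → count≡sum (λ j → is-just (Γ i j))) ⟩
    sumℕ (λ i → sumℕ (λ j → ⟦ is-just (Γ i j) ⟧))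
      ≡⟨ sum-cong (λ i → trans (sum-cong (split i)) (sum-+ (up i) (λ j → up j i))) ⟩
    sumℕ (λ i → sumℕ (up i) + sumℕ (λ j → up j i)) ≡⟨ sum-+ (λ i → sumℕ (up i)) _ ⟩
    sumℕ (λ i → sumℕ (up i)) + sumℕ (λ i → sumℕ (λ j → up j i))
      ≡⟨ cong (sumℕ (λ i → sumℕ (up i)) +_) (sum-swap (λ i j → up j i)) ⟩
    sumℕ (λ i → sumℕ (up i)) + sumℕ (λ i → sumℕ (up i)) ≡⟨ cong₂ _+_ edges edges ⟩
    numEdges Γ + numEdges Γ ∎
    where
    open ≡-Reasoning
    up : Fin n → Fin n → ℕ
    up i j = ⟦ (toℕ i <ᵇ toℕ j) ∧ is-just (Γ i j) ⟧
    edges : sumℕ (λ i → sumℕ (up i)) ≡ numEdges Γ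
    edges = sum-cong (λ i → sym (count≡sum (λ j → (toℕ i <ᵇ toℕ j) ∧ is-just (Γ i j))))
    <ᵇ-true : ∀ {a b} → a < b → (a <ᵇ b) ≡ true
    <ᵇ-true {a} {b} a<b with a <ᵇ b | ℕ.<⇒<ᵇ a<b
    ... | true | _ = refl
    <ᵇ-false : ∀ {a b} → ¬ a < b → (a <ᵇ b) ≡ false
    <ᵇ-false {a} {b} a≮b with a <ᵇ b in eq
    ... | false = refl
    ... | true = ⊥-elim (a≮b (ℕ.<ᵇ⇒< a b (subst T (sym eq) tt)))
    split : ∀ i j → ⟦ is-just (Γ i j) ⟧ ≡ up i j + up j i
    split i j with ℕ.<-cmp (toℕ i) (toℕ j)
    ... | tri< lt _ ngt rewrite <ᵇ-true lt | <ᵇ-false ngt = sym (ℕ.+-identityʳ _)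
    ... | tri> nlt _ gt rewrite <ᵇ-false nlt | <ᵇ-true gt | proj₁ sg i j = refl
    ... | tri≈ nlt eq ngt rewrite <ᵇ-false nlt | <ᵇ-false ngt | toℕ-injective eq | proj₂ sg j = refl

excess : ∀ {n} → SGraph n → ℕ
excess Γ = sumℕ (λ v → deg Γ v ∸ 2)

-- For `d ≥ 1`, truncation makes `d ∸ 2` too large by one exactly at `d = 1`, and the number of
-- leaves compensates for it. An isolated vertex would upset the balance, hence the positivity.
excess-handshake : ∀ {n} (Γ : SGraph n) → IsSignedGraph Γ → (∀ v → 1 ≤ deg Γ v) →
  numEdges Γ + numEdges Γ + pendant Γ ≡ n * 2 + excess Γ
excess-handshake {n} Γ sg pos = begin
  numEdges Γ + numEdges Γ + pendant Γ
    ≡⟨ cong₂ _+_ (sym (handshake Γ sg)) (count≡sum (λ v → deg Γ v ≡ᵇ 1)) ⟩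
  sumℕ (deg Γ) + sumℕ (λ v → ⟦ deg Γ v ≡ᵇ 1 ⟧) ≡⟨ sym (sum-+ (deg Γ) _) ⟩
  sumℕ (λ v → deg Γ v + ⟦ deg Γ v ≡ᵇ 1 ⟧) ≡⟨ sum-cong (λ v → point (deg Γ v) (pos v)) ⟩
  sumℕ (λ v → 2 + (deg Γ v ∸ 2)) ≡⟨ sum-+ (λ (v : Fin n) → 2) _ ⟩
  sumℕ {n} (λ v → 2) + excess Γ ≡⟨ cong (_+ excess Γ) (sum-const n 2) ⟩
  n * 2 + excess Γ ∎
  where
  open ≡-Reasoning
  point : ∀ d → 1 ≤ d → d + ⟦ d ≡ᵇ 1 ⟧ ≡ 2 + (d ∸ 2)
  point (suc zero) _ = refl
  point (suc (suc d)) _ = ℕ.+-identityʳ _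

cyc≡ : ∀ {n} (Γ : SGraph n) {k} → n + k ≡ numEdges Γ + 1 → cyc Γ ≡ k
cyc≡ {n} Γ {k} eq = trans (cong (_∸ n) (sym eq)) (ℕ.m+n∸m≡n n k)

1≤cyc⇒n≤E : ∀ {n} (Γ : SGraph n) → 1 ≤ cyc Γ → n ≤ numEdges Γ
1≤cyc⇒n≤E {n} Γ 1≤c = ℕ.≤-pred (subst (suc n ≤_) (ℕ.+-comm (numEdges Γ) 1) (ℕ.m∸n≢0⇒n<m (λ eq → ℕ.1+n≰n (subst (1 ≤_) eq 1≤c))))

-- The equation is proved with `n * 2` added on both sides, where `n + cyc Γ` can be replaced by
-- `numEdges Γ + 1`: as `1 ≤ cyc Γ`, nothing is truncated.
2cyc+pendant∸1 : ∀ {n} (Γ : SGraph n) → IsSignedGraph Γ → (∀ v → 1 ≤ deg Γ v) → 1 ≤ cyc Γ →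
  2 * cyc Γ + pendant Γ ∸ 1 ≡ suc (excess Γ)
2cyc+pendant∸1 {n} Γ sg pos 1≤c = cong (_∸ 1) (ℕ.+-cancelˡ-≡ (n * 2) _ _ (begin
  n * 2 + (2 * c + p) ≡⟨ solve 3 (λ n c p → n :* con 2 :+ (con 2 :* c :+ p) := (n :+ c) :+ (n :+ c) :+ p) refl n c p ⟩
  (n + c) + (n + c) + p ≡⟨ cong (λ t → t + t + p) (ℕ.m+[n∸m]≡n (ℕ.≤-trans (1≤cyc⇒n≤E Γ 1≤c) (ℕ.m≤m+n E 1))) ⟩
  (E + 1) + (E + 1) + p ≡⟨ solve 2 (λ E p → (E :+ con 1) :+ (E :+ con 1) :+ p := (E :+ E :+ p) :+ con 2) refl E p ⟩
  (E + E + p) + 2 ≡⟨ cong (_+ 2) (excess-handshake Γ sg pos) ⟩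
  n * 2 + excess Γ + 2 ≡⟨ solve 2 (λ n e → n :* con 2 :+ e :+ con 2 := n :* con 2 :+ (con 2 :+ e)) refl n (excess Γ) ⟩
  n * 2 + (2 + excess Γ) ∎))
  where
  open ≡-Reasoning
  open ℕ-Solver
  c = cyc Γ
  p = pendant Γ
  E = numEdges Γ

-- Exploring a signed graph

sum-mono-at : ∀ {n} {f g : Fin n → ℕ} a → (∀ i → f i ≤ g i) → f a < g a → suc (sumℕ f) ≤ sumℕ g
sum-mono-at {f = f} {g} a le lt = sum-mono-< a bump
  where
  bump : ∀ i → f i + δ a i ≤ g i
  bump i with i ≟ a
  ... | yes refl = subst (_≤ g i) (ℕ.+-comm 1 (f i)) lt
  ... | no _ = subst (_≤ g i) (sym (ℕ.+-identityʳ (f i))) (le i)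

-- The two strict drops are spent one after the other: `h` is `g` lowered at `b` only.
sum-mono-at₂ : ∀ {n} {f g : Fin n → ℕ} {a b} → a ≢ b → (∀ i → f i ≤ g i) → f a < g a → f b < g b → 2 + sumℕ f ≤ sumℕ g
sum-mono-at₂ {f = f} {g} {a} {b} a≢b le lt lt′ = ℕ.≤-trans (s≤s (sum-mono-at a inc inc-a)) (sum-mono-< b bump)
  where
  h : Fin _ → ℕ
  h i = g i ∸ δ b i
  inc : ∀ i → f i ≤ h i
  inc i with i ≟ b
  ... | yes refl = ℕ.≤-pred (subst (suc (f i) ≤_) (sym (ℕ.m+[n∸m]≡n (ℕ.≤-trans (s≤s z≤n) lt′))) lt′)
  ... | no _ = le i
  inc-a : f a < h a
  inc-a = subst (λ t → f a < g a ∸ t) (sym (δ-≢ a≢b)) lt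
  bump : ∀ i → h i + δ b i ≤ g i
  bump i with i ≟ b
  ... | yes refl = ℕ.≤-reflexive (ℕ.m∸n+n≡m (ℕ.≤-trans (s≤s z≤n) lt′))
  ... | no _ = ℕ.≤-reflexive (ℕ.+-identityʳ (g i))

module Basic {n} (Γ : SGraph n) (sg : IsSignedGraph Γ) where

  adj-sym : ∀ {u v} → Adj Γ u v → Adj Γ v u
  adj-sym {u} {v} = subst (λ e → T (is-just e)) (proj₁ sg u v)

  adj-irrefl : ∀ {u v} → Adj Γ u v → u ≢ v
  adj-irrefl {u} a refl = subst (λ e → T (is-just e)) (proj₂ sg u) a

  adj? : ∀ u v → Dec (Adj Γ u v)
  adj? u v = T? (is-just (Γ u v))

  private A = adjMat Γ

  A-sym : ∀ u v → A u v ≡ A v u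
  A-sym u v = cong entry (proj₁ sg u v)

  A-nonadj : ∀ {u v} → ¬ Adj Γ u v → A u v ≡ 0ℚ
  A-nonadj {u} {v} na with Γ u v
  ... | nothing = refl
  ... | just _ = ⊥-elim (na tt)

  A-square : ∀ {u v} → Adj Γ u v → A u v *ℚ A u v ≡ 1ℚ
  A-square {u} {v} a with Γ u v
  ... | just Sign.+ = refl
  ... | just Sign.- = refl

  A≢0 : ∀ {u v} → Adj Γ u v → A u v ≢ 0ℚ
  A≢0 {u} {v} a with Γ u v
  ... | just Sign.+ = λ ()
  ... | just Sign.- = λ ()

  row : Fin n → (Fin n → ℚ) → ℚ
  row v x = ∑ (λ j → A v j *ℚ x j)

  row-single : ∀ {v a} x → (∀ j → Adj Γ v j → j ≢ a → x j ≡ 0ℚ) → row v x ≡ A v a *ℚ x a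
  row-single {v} {a} x z = ∑-single _ a vanish
    where
    vanish : ∀ j → j ≢ a → A v j *ℚ x j ≡ 0ℚ
    vanish j j≢a with adj? v j
    ... | yes vj = trans (cong (A v j *ℚ_) (z j vj j≢a)) (ℚ.*-zeroʳ (A v j))
    ... | no nvj = trans (cong (_*ℚ x j) (A-nonadj nvj)) (ℚ.*-zeroˡ (x j))

  row-pair : ∀ {v a b} x → a ≢ b → (∀ j → Adj Γ v j → j ≢ a → j ≢ b → x j ≡ 0ℚ) →
    row v x ≡ A v a *ℚ x a +ℚ A v b *ℚ x b
  row-pair {v} {a} {b} x a≢b z = ∑-pair _ a≢b vanish
    where
    vanish : ∀ j → j ≢ a → j ≢ b → A v j *ℚ x j ≡ 0ℚ
    vanish j j≢a j≢b with adj? v j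
    ... | yes vj = trans (cong (A v j *ℚ_) (z j vj j≢a j≢b)) (ℚ.*-zeroʳ (A v j))
    ... | no nvj = trans (cong (_*ℚ x j) (A-nonadj nvj)) (ℚ.*-zeroˡ (x j))

  row-0 : ∀ {v} x → (∀ j → Adj Γ v j → x j ≡ 0ℚ) → row v x ≡ 0ℚ
  row-0 {v} x z = ∑-0 vanish
    where
    vanish : ∀ j → A v j *ℚ x j ≡ 0ℚ
    vanish j with adj? v j
    ... | yes vj = trans (cong (A v j *ℚ_) (z j vj)) (ℚ.*-zeroʳ (A v j))
    ... | no nvj = trans (cong (_*ℚ x j) (A-nonadj nvj)) (ℚ.*-zeroˡ (x j))

  deg≥1 : ∀ {v a} → Adj Γ v a → 1 ≤ deg Γ v
  deg≥1 {v} va = length≤count {P = λ j → is-just (Γ v j)} ([] ∷ []) (va ∷ [])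

  deg≥2 : ∀ {v a b} → Adj Γ v a → Adj Γ v b → a ≢ b → 2 ≤ deg Γ v
  deg≥2 {v} va vb a≢b = length≤count {P = λ j → is-just (Γ v j)} ((a≢b ∷ []) ∷ [] ∷ []) (va ∷ vb ∷ [])

  deg≥3 : ∀ {v a b c} → Adj Γ v a → Adj Γ v b → Adj Γ v c → a ≢ b → a ≢ c → b ≢ c → 3 ≤ deg Γ v
  deg≥3 {v} va vb vc a≢b a≢c b≢c = length≤count {P = λ j → is-just (Γ v j)}
    ((a≢b ∷ a≢c ∷ []) ∷ (b≢c ∷ []) ∷ [] ∷ []) (va ∷ vb ∷ vc ∷ [])

  deg≤ : ∀ {v} (L : List (Fin n)) → (∀ j → Adj Γ v j → j ∈ L) → deg Γ v ≤ length L
  deg≤ {v} L h = count≤length {P = λ j → is-just (Γ v j)} L h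

  deg-∃∉ : ∀ {v} (L : List (Fin n)) → length L < deg Γ v → ∃ λ j → Adj Γ v j × j ∉ L
  deg-∃∉ {v} L lt = count-∃∉ {P = λ j → is-just (Γ v j)} L lt

  deg2-nbr : ∀ {v a b j} → deg Γ v ≡ 2 → Adj Γ v a → Adj Γ v b → a ≢ b → Adj Γ v j → j ≡ a ⊎ j ≡ b
  deg2-nbr {v} {a} {b} {j} d va vb a≢b vj with j ≟ a | j ≟ b
  ... | yes p | _ = inj₁ p
  ... | no _ | yes q = inj₂ q
  ... | no p | no q = ⊥-elim (ℕ.1+n≰n (subst (3 ≤_) d (deg≥3 vj va vb p q a≢b)))

  reach-end-nbr : ∀ {u v} → Reach Γ u v → u ≢ v → ∃ λ w → Adj Γ u w
  reach-end-nbr here ne = ⊥-elim (ne refl)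
  reach-end-nbr (step a _) _ = _ , a

  connected⇒deg≥1 : Connected Γ → ∀ {a b} → Adj Γ a b → ∀ v → 1 ≤ deg Γ v
  connected⇒deg≥1 conn {a} {b} ab v with v ≟ a
  ... | yes refl = deg≥1 ab
  ... | no v≢a = deg≥1 (proj₂ (reach-end-nbr (conn v a) v≢a))

  closed⇒all : Connected Γ → (P : Fin n → Set) → ∀ {a} → P a → (∀ u v → P u → Adj Γ u v → P v) → ∀ v → P v
  closed⇒all conn P {a} pa cl v = go (conn a v) pa
    where
    go : ∀ {u v} → Reach Γ u v → P u → P v
    go here p = p
    go (step uw r) p = go r (cl _ _ p uw)

module Explore {n} (Γ : SGraph n) (sg : IsSignedGraph Γ) where

  open Basic Γ sg

  VSet : Set
  VSet = Fin n → Bool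

  abstract
    ins : Fin n → VSet → VSet
    ins y Z j = does (j ≟ y) ∨ Z j

    ins-self : ∀ {y} Z → T (ins y Z y)
    ins-self {y} Z with y ≟ y
    ... | yes _ = tt
    ... | no y≢y = ⊥-elim (y≢y refl)

    ins-old : ∀ {y j} Z → T (Z j) → T (ins y Z j)
    ins-old {y} {j} Z p with j ≟ y
    ... | yes _ = tt
    ... | no _ = p

    ins-elim : ∀ {y j} Z → T (ins y Z j) → j ≡ y ⊎ T (Z j)
    ins-elim {y} {j} Z p with j ≟ y
    ... | yes eq = inj₁ eq
    ... | no _ = inj₂ p

  ⁅_⁆ : Fin n → VSet
  ⁅ v ⁆ = ins v (λ _ → false)

  outside : VSet → Fin n → VSet
  outside Z v j = is-just (Γ v j) ∧ not (Z j)

  outside-intro : ∀ Z {v j} → Adj Γ v j → ¬ T (Z j) → T (outside Z v j)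
  outside-intro Z {v} {j} a nz with is-just (Γ v j) | Z j
  ... | true | false = tt
  ... | true | true = ⊥-elim (nz tt)

  outside-elim : ∀ Z {v j} → T (outside Z v j) → Adj Γ v j × ¬ T (Z j)
  outside-elim Z {v} {j} p with is-just (Γ v j) | Z j
  ... | true | false = tt , λ ()

  r : VSet → Fin n → ℕ
  r Z v = count (outside Z v)

  r-ins≤ : ∀ {y} Z v → r (ins y Z) v ≤ r Z v
  r-ins≤ {y} Z v = count-mono {P = outside (ins y Z) v} {outside Z v} λ j p →
    outside-intro Z (proj₁ (outside-elim (ins y Z) p)) (λ z → proj₂ (outside-elim (ins y Z) p) (ins-old Z z))

  r-ins< : ∀ {y} Z v → Adj Γ v y → ¬ T (Z y) → r (ins y Z) v < r Z v
  r-ins< {y} Z v vy y∉ = subst (suc (r (ins y Z) v) ≤_) (sym (count-∖ (outside Z v) (outside-intro Z vy y∉)))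
    (s≤s (count-mono {P = outside (ins y Z) v} {outside Z v ∖ y} λ j p →
      let (vj , j∉) = outside-elim (ins y Z) p in
      ∖-intro (outside Z v) (outside-intro Z vj (λ z → j∉ (ins-old Z z))) (λ { refl → j∉ (ins-self Z) })))

  r<deg : ∀ Z {v a} → Adj Γ v a → T (Z a) → r Z v < deg Γ v
  r<deg Z {v} {a} va a∈ = subst (suc (r Z v) ≤_) (sym (count-∖ (λ j → is-just (Γ v j)) va))
    (s≤s (count-mono {P = outside Z v} {(λ j → is-just (Γ v j)) ∖ a} λ j p →
      let (vj , j∉) = outside-elim Z p in ∖-intro (λ j → is-just (Γ v j)) vj (λ { refl → j∉ a∈ })))

  2+r≤deg : ∀ Z {v a b} → Adj Γ v a → T (Z a) → Adj Γ v b → T (Z b) → a ≢ b → 2 + r Z v ≤ deg Γ v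
  2+r≤deg Z {v} {a} {b} va a∈ vb b∈ a≢b = subst (2 + r Z v ≤_)
    (sym (trans (count-∖ nb va) (cong suc (count-∖ (nb ∖ a) (∖-intro nb vb (λ eq → a≢b (sym eq)))))))
    (s≤s (s≤s (count-mono {P = outside Z v} {nb ∖ a ∖ b} λ j p →
      let (vj , j∉) = outside-elim Z p in
      ∖-intro (nb ∖ a) (∖-intro nb vj (λ { refl → j∉ a∈ })) (λ { refl → j∉ b∈ }))))
    where
    nb : VSet
    nb j = is-just (Γ v j)

  1≤r : ∀ Z {v y} → Adj Γ v y → ¬ T (Z y) → 1 ≤ r Z v
  1≤r Z {v} vy y∉ = length≤count {P = outside Z v} ([] ∷ []) (outside-intro Z vy y∉ ∷ [])

  r≡1-unique : ∀ Z {v y j} → r Z v ≡ 1 → Adj Γ v y → ¬ T (Z y) → Adj Γ v j → j ≢ y → T (Z j)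
  r≡1-unique Z {v} {y} {j} r1 vy y∉ vj j≢y with T? (Z j)
  ... | yes z = z
  ... | no nz = ⊥-elim (ℕ.1+n≰n (subst (2 ≤_) r1 (length≤count {P = outside Z v} ((j≢y ∷ []) ∷ [] ∷ [])
    (outside-intro Z vj nz ∷ outside-intro Z vy y∉ ∷ []))))

  ψ : VSet → Fin n → ℕ
  ψ Z v = if Z v then pred (r Z v) else deg Γ v ∸ 2

  ψ-in : ∀ Z {v} → T (Z v) → ψ Z v ≡ pred (r Z v)
  ψ-in Z {v} p with Z v
  ... | true = refl

  ψ-out : ∀ Z {v} → ¬ T (Z v) → ψ Z v ≡ deg Γ v ∸ 2
  ψ-out Z {v} np with Z v
  ... | false = refl
  ... | true = ⊥-elim (np tt)

  Ψ : VSet → ℕ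
  Ψ Z = sumℕ (ψ Z)

  -- Old vertices of `Z` can only lose unexplored neighbours. The new vertex `y` has the explored
  -- neighbour `v`, so at most `deg y − 1` of its neighbours remain, and `pred` brings this down to
  -- `deg y ∸ 2`.
  ψ-mono : ∀ Z {v y} → T (Z v) → Adj Γ v y → ∀ j → ψ (ins y Z) j ≤ ψ Z j
  ψ-mono Z {v} {y} v∈ vy j with T? (Z j) | T? (ins y Z j)
  ... | yes p | _ = ℕ.≤-trans (ℕ.≤-reflexive (ψ-in (ins y Z) (ins-old Z p)))
    (ℕ.≤-trans (ℕ.pred-mono-≤ (r-ins≤ Z j)) (ℕ.≤-reflexive (sym (ψ-in Z p))))
  ... | no np | no nq = ℕ.≤-reflexive (trans (ψ-out (ins y Z) nq) (sym (ψ-out Z np)))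
  ... | no np | yes q with ins-elim Z q
  ...   | inj₂ p = ⊥-elim (np p)
  ...   | inj₁ refl = ℕ.≤-trans (ℕ.≤-reflexive (ψ-in (ins y Z) q))
    (ℕ.≤-trans (ℕ.pred-mono-≤ (ℕ.pred-mono-≤ (r<deg (ins y Z) (adj-sym vy) (ins-old Z v∈))))
      (ℕ.≤-reflexive (trans (ℕ.∸-+-assoc (deg Γ y) 1 1) (sym (ψ-out Z np)))))

  -- Two unexplored neighbours are required: with `r Z v = 1` the term at `v` is 0 already and
  -- cannot drop.
  ψ-drop-at : ∀ Z {v y} → T (Z v) → Adj Γ v y → ¬ T (Z y) → 2 ≤ r Z v → ψ (ins y Z) v < ψ Z v
  ψ-drop-at Z {v} {y} v∈ vy y∉ 2≤r = subst (_< ψ Z v) (sym (ψ-in (ins y Z) (ins-old Z v∈)))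
    (subst (pred (r (ins y Z) v) <_) (sym (ψ-in Z v∈)) (lemma 2≤r (r-ins< Z v vy y∉)))
    where
    lemma : ∀ {a b} → 2 ≤ b → a < b → pred a < pred b
    lemma {zero}  (s≤s (s≤s _)) _ = s≤s z≤n
    lemma {suc a} _ (s≤s (s≤s le)) = s≤s le

  -- With two explored neighbours, `y` retains at most `deg y − 2` unexplored ones, and `pred`
  -- subtracts one more. Degree at least 3 keeps the old term positive, so that truncation does not
  -- hide the drop.
  ψ-drop-new : ∀ Z {v v′ y} → T (Z v) → Adj Γ v y → T (Z v′) → Adj Γ v′ y → v ≢ v′ → ¬ T (Z y) → 3 ≤ deg Γ y →
    ψ (ins y Z) y < ψ Z y
  ψ-drop-new Z {y = y} v∈ vy v′∈ v′y v≢v′ y∉ 3≤d = subst (_< ψ Z y) (sym (ψ-in (ins y Z) (ins-self Z)))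
    (subst (pred (r (ins y Z) y) <_) (sym (ψ-out Z y∉)) (lemma 3≤d
      (2+r≤deg (ins y Z) (adj-sym vy) (ins-old Z v∈) (adj-sym v′y) (ins-old Z v′∈) v≢v′)))
    where
    lemma : ∀ {a d} → 3 ≤ d → 2 + a ≤ d → pred a < d ∸ 2
    lemma {zero}  (s≤s (s≤s (s≤s _))) _ = s≤s z≤n
    lemma {suc a} _ (s≤s (s≤s le)) = le

  record K (Z : VSet) (x : Fin n → ℚ) : Set where
    constructor inK
    field
      kernel   : Ker (adjMat Γ) x
      vanishes : ∀ j → T (Z j) → x j ≡ 0ℚ
  open K public

  K-subspace : ∀ Z → Subspace (K Z)
  K-subspace Z = subspace λ { c (inK kx zx) (inK ky zy) → inK (closed (Ker-subspace (adjMat Γ)) c kx ky)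
    (λ j p → trans (cong₂ (λ a b → a +ℚ c *ℚ b) (zx j p) (zy j p)) (trans (ℚ.+-identityˡ _) (ℚ.*-zeroʳ c))) }

  K-ins : ∀ Z y x → K Z x × x y ≡ 0ℚ → K (ins y Z) x
  K-ins Z y x (inK k z , xy) = inK k (λ j p → case (ins-elim Z p))
    where
    case : ∀ {j} → j ≡ y ⊎ T (Z j) → x j ≡ 0ℚ
    case (inj₁ refl) = xy
    case (inj₂ p) = z _ p

  -- The remaining neighbours of `v` lie in `Z`, so row `v` has a single term left.
  forced : ∀ Z {v y x} → T (Z v) → Adj Γ v y → ¬ T (Z y) → r Z v ≡ 1 → K Z x → x y ≡ 0ℚ
  forced Z {v} {y} {x} v∈ vy y∉ r1 (inK k z) = *-≢0 (A≢0 vy) (trans (sym (row-single x others)) (rows k v))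
    where
    others : ∀ j → Adj Γ v j → j ≢ y → x j ≡ 0ℚ
    others j vj j≢y = z j (r≡1-unique Z r1 vy y∉ vj j≢y)

  dim-ins : ∀ Z {v y d} → T (Z v) → Adj Γ v y → ¬ T (Z y) → r Z v ≡ 1 → DimAtLeast (K Z) d → DimAtLeast (K (ins y Z)) d
  dim-ins Z {y = y} v∈ vy y∉ r1 = dim-map (λ x kx → K-ins Z y x (kx , forced Z v∈ vy y∉ r1 kx))

  dim-ins-pred : ∀ Z y {d} → DimAtLeast (K Z) d → DimAtLeast (K (ins y Z)) (pred d)
  dim-ins-pred Z y {zero}  D = dim-0
  dim-ins-pred Z y {suc d} D = dim-map (K-ins Z y) (dim-drop (K-subspace Z) D y)

  r-case : ∀ Z {v y} → Adj Γ v y → ¬ T (Z y) → r Z v ≡ 1 ⊎ 2 ≤ r Z v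
  r-case Z vy y∉ with ℕ.m≤n⇒m<n∨m≡n (1≤r Z vy y∉)
  ... | inj₁ lt = inj₂ lt
  ... | inj₂ eq = inj₁ (sym eq)

  boundary : ∀ (Z : VSet) {a b} → Reach Γ a b → T (Z a) → ¬ T (Z b) → ∃₂ λ v y → T (Z v) × ¬ T (Z y) × Adj Γ v y
  boundary Z here p np = ⊥-elim (np p)
  boundary Z (step {w = w} aw rw) p np with T? (Z w)
  ... | yes q = boundary Z rw q np
  ... | no nq = _ , _ , p , nq , aw

  -- Exploring the graph from Z, a new neighbour y of v ∈ Z carries a forced zero if it is the last unexplored
  -- neighbour of v, and otherwise costs one dimension, which is paid for by the decrease of ψ at v.
  dim≤Ψ : Connected Γ → ∀ Z {a} → T (Z a) → ∀ {k} → DimAtLeast (K Z) k → k ≤ Ψ Z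
  dim≤Ψ conn Z {a} a∈ {k} D = go (count (λ j → not (Z j))) Z a∈ ℕ.≤-refl D
    where
    not-intro : ∀ {b} → ¬ T b → T (not b)
    not-intro {false} _ = tt
    not-intro {true} h = h tt
    not-elim : ∀ {b} → T (not b) → ¬ T b
    not-elim {false} _ ()
    go : ∀ m Z {a} → T (Z a) → count (λ j → not (Z j)) ≤ m → ∀ {k} → DimAtLeast (K Z) k → k ≤ Ψ Z
    go m Z {a} a∈ le {k} D with any? (λ j → T? (not (Z j)))
    ... | no full = subst (_≤ Ψ Z) (sym (dim-trivial (λ x kx q → vanishes kx q (all q)) D)) z≤n
      where
      all : ∀ q → T (Z q)
      all q with T? (Z q)
      ... | yes p = p
      ... | no np = ⊥-elim (full (q , not-intro np))
    ... | yes (b , b∉) with boundary Z (conn a b) a∈ (not-elim b∉)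
    ...   | v , y , v∈ , y∉ , vy = more m le (r-case Z vy y∉)
      where
      Z′ = ins y Z
      fewer : count (λ j → not (Z′ j)) < count (λ j → not (Z j))
      fewer = subst (suc (count (λ j → not (Z′ j))) ≤_) (sym (count-∖ (λ j → not (Z j)) (not-intro y∉)))
        (s≤s (count-mono {P = λ j → not (Z′ j)} {(λ j → not (Z j)) ∖ y} λ j p →
          ∖-intro (λ j → not (Z j)) (not-intro (λ z → not-elim p (ins-old Z z))) (λ { refl → not-elim p (ins-self Z) })))
      more : ∀ m → count (λ j → not (Z j)) ≤ m → r Z v ≡ 1 ⊎ 2 ≤ r Z v → k ≤ Ψ Z
      more zero le _ = ⊥-elim (ℕ.n≮0 (ℕ.≤-trans fewer le))
      more (suc m) le (inj₁ r1) = ℕ.≤-trans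
        (go m Z′ (ins-self Z) (ℕ.≤-pred (ℕ.≤-trans fewer le)) (dim-ins Z v∈ vy y∉ r1 D))
        (sum-mono (ψ-mono Z v∈ vy))
      more (suc m) le (inj₂ 2≤r) = ℕ.≤-trans (suc-pred-≤ k)
        (ℕ.≤-trans (s≤s (go m Z′ (ins-self Z) (ℕ.≤-pred (ℕ.≤-trans fewer le)) (dim-ins-pred Z y D)))
          (sum-mono-at v (ψ-mono Z v∈ vy) (ψ-drop-at Z v∈ vy y∉ 2≤r)))
        where
        suc-pred-≤ : ∀ k → k ≤ suc (pred k)
        suc-pred-≤ zero = z≤n
        suc-pred-≤ (suc k) = ℕ.≤-refl

  -- `dim≤Ψ` is the opposite inequality, so `s` bounds the gap between the dimension and `Ψ Z`.
  -- Slack 1 is what a start at a vertex of degree at least 2 has when the kernel has dimension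
  -- `excess Γ + 1`.
  Slack : ℕ → VSet → Set
  Slack s Z = ∃ λ d → DimAtLeast (K Z) d × Ψ Z ≤ d + s

  Tight : VSet → Set
  Tight = Slack 0

  private
    shrink : ∀ {a b} d {s} → suc a ≤ b → b ≤ d + s → a ≤ pred d + s
    shrink zero lt le = ℕ.≤-trans (ℕ.n≤1+n _) (ℕ.≤-trans lt le)
    shrink (suc d) lt le = ℕ.≤-pred (ℕ.≤-trans lt le)

  -- A forced zero leaves the dimension alone while `Ψ` does not grow; an imposed zero costs one
  -- dimension but lowers `Ψ` by at least one, at `v`.
  slack-ins : ∀ {s} Z {v y} → T (Z v) → Adj Γ v y → Slack s Z → Slack s (ins y Z)
  slack-ins Z {v} {y} v∈ vy (d , D , le) with T? (Z y)
  ... | yes y∈ = d , dim-map (λ x kx → K-ins Z y x (kx , vanishes kx y y∈)) D , ℕ.≤-trans (sum-mono (ψ-mono Z v∈ vy)) le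
  ... | no y∉ with r-case Z vy y∉
  ...   | inj₁ r1 = d , dim-ins Z v∈ vy y∉ r1 D , ℕ.≤-trans (sum-mono (ψ-mono Z v∈ vy)) le
  ...   | inj₂ 2≤r = pred d , dim-ins-pred Z y D , shrink d (sum-mono-at v (ψ-mono Z v∈ vy) (ψ-drop-at Z v∈ vy y∉ 2≤r)) le

  -- A vertex of degree at least 3 that is reached from two sides lowers `Ψ` by one more than the
  -- step has to pay for.
  slack-gain : ∀ {s} Z {v v′ y} → T (Z v) → Adj Γ v y → T (Z v′) → Adj Γ v′ y → v ≢ v′ → ¬ T (Z y) → 3 ≤ deg Γ y →
    Slack (suc s) Z → Slack s (ins y Z)
  slack-gain {s} Z {v} {v′} {y} v∈ vy v′∈ v′y v≢v′ y∉ 3≤d (d , D , le) with r-case Z vy y∉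
  ... | inj₁ r1 = d , dim-ins Z v∈ vy y∉ r1 D ,
    ℕ.≤-pred (ℕ.≤-trans (sum-mono-at y (ψ-mono Z v∈ vy) (ψ-drop-new Z v∈ vy v′∈ v′y v≢v′ y∉ 3≤d))
      (ℕ.≤-trans le (ℕ.≤-reflexive (ℕ.+-suc d s))))
  ... | inj₂ 2≤r = pred d , dim-ins-pred Z y D ,
    shrink d (ℕ.≤-pred (ℕ.≤-trans (sum-mono-at₂ (adj-irrefl vy) (ψ-mono Z v∈ vy) (ψ-drop-at Z v∈ vy y∉ 2≤r)
      (ψ-drop-new Z v∈ vy v′∈ v′y v≢v′ y∉ 3≤d)) (ℕ.≤-trans le (ℕ.≤-reflexive (ℕ.+-suc d s))))) ℕ.≤-refl

  module _ (conn : Connected Γ) where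

    -- In a tight set no exploration step can gain, which determines how the graph closes up cycles.
    tight-closing : ∀ Z {v v′ y} → Tight Z → T (Z v) → Adj Γ v y → T (Z v′) → Adj Γ v′ y → v ≢ v′ → ¬ T (Z y) →
      deg Γ y ≡ 2 × r Z v ≡ 1 × r Z v′ ≡ 1
    tight-closing Z {v} {v′} {y} (d , D , le) v∈ vy v′∈ v′y v≢v′ y∉ = decide (r-case Z vy y∉) (r-case Z v′y y∉)
      where
      Z′ = ins y Z
      le′ : Ψ Z ≤ d
      le′ = ℕ.≤-trans le (ℕ.≤-reflexive (ℕ.+-identityʳ d))
      bound : ∀ {d} → DimAtLeast (K Z′) d → d ≤ Ψ Z′
      bound = dim≤Ψ conn Z′ (ins-self Z)
      no-gain : ∀ {w w′} → T (Z w) → Adj Γ w y → r Z w ≡ 1 → T (Z w′) → Adj Γ w′ y → w ≢ w′ → 2 ≤ r Z w′ → ⊥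
      no-gain w∈ wy r1 w′∈ w′y w≢w′ 2≤r = ℕ.1+n≰n (ℕ.≤-trans
        (ℕ.≤-trans (sum-mono-at _ (ψ-mono Z w′∈ w′y) (ψ-drop-at Z w′∈ w′y y∉ 2≤r)) le′)
        (bound (dim-ins Z w∈ wy y∉ r1 D)))
      d≡2 : r Z v ≡ 1 → deg Γ y ≡ 2
      d≡2 r1 with ℕ.m≤n⇒m<n∨m≡n (deg≥2 (adj-sym vy) (adj-sym v′y) v≢v′)
      ... | inj₂ eq = sym eq
      ... | inj₁ 3≤d = ⊥-elim (ℕ.1+n≰n (ℕ.≤-trans
        (ℕ.≤-trans (sum-mono-at y (ψ-mono Z v∈ vy) (ψ-drop-new Z v∈ vy v′∈ v′y v≢v′ y∉ 3≤d)) le′)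
        (bound (dim-ins Z v∈ vy y∉ r1 D))))
      -- If `y` is forced from one side only, the drop of `ψ` at the other side is gained for free.
      -- If it is forced from neither, one imposed zero pays for drops at both `v` and `v′`. Either
      -- gain contradicts `dim≤Ψ`.
      decide : r Z v ≡ 1 ⊎ 2 ≤ r Z v → r Z v′ ≡ 1 ⊎ 2 ≤ r Z v′ → deg Γ y ≡ 2 × r Z v ≡ 1 × r Z v′ ≡ 1
      decide (inj₁ r1) (inj₁ r1′) = d≡2 r1 , r1 , r1′
      decide (inj₁ r1) (inj₂ 2≤r′) = ⊥-elim (no-gain v∈ vy r1 v′∈ v′y v≢v′ 2≤r′)
      decide (inj₂ 2≤r) (inj₁ r1′) = ⊥-elim (no-gain v′∈ v′y r1′ v∈ vy (λ eq → v≢v′ (sym eq)) 2≤r)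
      decide (inj₂ 2≤r) (inj₂ 2≤r′) = ⊥-elim (ℕ.1+n≰n (ℕ.≤-trans
        (shrink d {0} (ℕ.≤-trans (sum-mono-at₂ v≢v′ (ψ-mono Z v∈ vy) (ψ-drop-at Z v∈ vy y∉ 2≤r) (ψ-drop-at Z v′∈ v′y y∉ 2≤r′)) le′)
          (ℕ.≤-reflexive (sym (ℕ.+-identityʳ d))))
        (ℕ.≤-trans (ℕ.≤-reflexive (ℕ.+-identityʳ _)) (bound (dim-ins-pred Z y D)))))

  private
    ∉-singleton : ∀ {j v} → j ≢ v → ¬ T (⁅ v ⁆ j)
    ∉-singleton j≢v p with ins-elim (λ _ → false) p
    ... | inj₁ eq = j≢v eq

    r≤deg : ∀ Z v → r Z v ≤ deg Γ v
    r≤deg Z v = count-mono {P = outside Z v} (λ j p → proj₁ (outside-elim Z p))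

  Ψ-leaf : ∀ {v} → deg Γ v ≡ 1 → Ψ ⁅ v ⁆ ≤ excess Γ
  Ψ-leaf {v} d1 = sum-mono pointwise
    where
    pointwise : ∀ j → ψ ⁅ v ⁆ j ≤ deg Γ j ∸ 2
    pointwise j with j ≟ v
    ... | yes refl = subst (_≤ deg Γ v ∸ 2) (sym (ψ-in ⁅ v ⁆ (ins-self _)))
      (ℕ.≤-trans (ℕ.pred-mono-≤ (subst (r ⁅ v ⁆ v ≤_) d1 (r≤deg ⁅ v ⁆ v))) z≤n)
    ... | no j≢v = ℕ.≤-reflexive (ψ-out ⁅ v ⁆ (∉-singleton j≢v))

  -- The start is entered through no edge, so its term is bounded by `deg v − 1`, one more than its
  -- share of `excess Γ`. Closing a cycle has to win this back.
  Ψ-vertex : ∀ {v} → 2 ≤ deg Γ v → Ψ ⁅ v ⁆ ≤ suc (excess Γ)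
  Ψ-vertex {v} 2≤d = subst (Ψ ⁅ v ⁆ ≤_) (trans (sum-+ (δ v) (λ j → deg Γ j ∸ 2)) (cong (_+ excess Γ) (sum-δ v)))
    (sum-mono pointwise)
    where
    pointwise : ∀ j → ψ ⁅ v ⁆ j ≤ δ v j + (deg Γ j ∸ 2)
    pointwise j with j ≟ v
    ... | yes refl = subst (_≤ 1 + (deg Γ v ∸ 2)) (sym (ψ-in ⁅ v ⁆ (ins-self _)))
      (ℕ.≤-trans (ℕ.pred-mono-≤ (r≤deg ⁅ v ⁆ v)) (lemma 2≤d))
      where
      lemma : ∀ {d} → 2 ≤ d → pred d ≤ 1 + (d ∸ 2)
      lemma (s≤s (s≤s _)) = ℕ.≤-refl
    ... | no j≢v = ℕ.≤-reflexive (ψ-out ⁅ v ⁆ (∉-singleton j≢v))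

  dim-start : ∀ v {d} → KerDimAtLeast (adjMat Γ) (suc d) → DimAtLeast (K ⁅ v ⁆) d
  dim-start v D = dim-map (λ { x (k , xv) → K-ins (λ _ → false) v x (inK k (λ _ ()) , xv) })
    (dim-drop (Ker-subspace (adjMat Γ)) (fromKer (adjMat Γ) D) v)

  tight-leaf : ∀ {v} → deg Γ v ≡ 1 → KerDimAtLeast (adjMat Γ) (suc (excess Γ)) → Tight ⁅ v ⁆
  tight-leaf {v} d1 D = excess Γ , dim-start v D , ℕ.≤-trans (Ψ-leaf d1) (ℕ.≤-reflexive (sym (ℕ.+-identityʳ _)))

  leaf⇒nullity≤ : Connected Γ → ∀ {v} → deg Γ v ≡ 1 → ¬ KerDimAtLeast (adjMat Γ) (2 + excess Γ)
  leaf⇒nullity≤ conn {v} d1 D = ℕ.1+n≰n (ℕ.≤-trans (dim≤Ψ conn ⁅ v ⁆ (ins-self _) (dim-start v D)) (Ψ-leaf d1))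

  -- Inserts `g 1` to `g k`. The vertex `g 0` is expected to lie in `Z` already, so that each
  -- insertion is a step along the walk.
  insRange : (ℕ → Fin n) → ℕ → VSet → VSet
  insRange g zero    Z = Z
  insRange g (suc k) Z = ins (g (suc k)) (insRange g k Z)

  insRange-old : ∀ g k Z {j} → T (Z j) → T (insRange g k Z j)
  insRange-old g zero    Z p = p
  insRange-old g (suc k) Z p = ins-old (insRange g k Z) (insRange-old g k Z p)

  insRange-new : ∀ g k Z {i} → 1 ≤ i → i ≤ k → T (insRange g k Z (g i))
  insRange-new g zero    Z (s≤s _) ()
  insRange-new g (suc k) Z 1≤i i≤k with ℕ.m≤n⇒m<n∨m≡n i≤k
  ... | inj₁ (s≤s i≤k′) = ins-old (insRange g k Z) (insRange-new g k Z 1≤i i≤k′)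
  ... | inj₂ refl = ins-self (insRange g k Z)

  insRange-new₀ : ∀ g k Z {i} → T (Z (g 0)) → i ≤ k → T (insRange g k Z (g i))
  insRange-new₀ g k Z {zero}  p _ = insRange-old g k Z p
  insRange-new₀ g k Z {suc i} p le = insRange-new g k Z (s≤s z≤n) le

  insRange-elim : ∀ g k Z {j} → T (insRange g k Z j) → T (Z j) ⊎ ∃ λ i → 1 ≤ i × i ≤ k × j ≡ g i
  insRange-elim g zero    Z p = inj₁ p
  insRange-elim g (suc k) Z p with ins-elim (insRange g k Z) p
  ... | inj₁ eq = inj₂ (suc k , s≤s z≤n , ℕ.≤-refl , eq)
  ... | inj₂ q with insRange-elim g k Z q
  ...   | inj₁ z = inj₁ z
  ...   | inj₂ (i , 1≤i , i≤k , eq) = inj₂ (i , 1≤i , ℕ.m≤n⇒m≤1+n i≤k , eq)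

  slack-range : ∀ {s} g k Z → T (Z (g 0)) → (∀ i → i < k → Adj Γ (g i) (g (suc i))) → Slack s Z → Slack s (insRange g k Z)
  slack-range g zero    Z z w S = S
  slack-range g (suc k) Z z w S = slack-ins (insRange g k Z) (insRange-new₀ g k Z z ℕ.≤-refl) (w k ℕ.≤-refl)
    (slack-range g k Z z (λ i lt → w i (ℕ.m≤n⇒m≤1+n lt)) S)

  record CycSeq (f : ℕ → Fin n) (l : ℕ) : Set where
    field
      inj-<  : ∀ {i j} → i < l → j < l → f i ≡ f j → i ≡ j
      walk   : ∀ i → i < l → Adj Γ (f i) (f (suc i))
      closes : f l ≡ f 0

  -- Going round a cycle and ending in a branch vertex gains one.
  module CycleTight (conn : Connected Γ) {f m} (c : CycSeq f (3 + m)) (3≤d : 3 ≤ deg Γ (f (2 + m))) where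
    open CycSeq c

    private
      y = f (2 + m)
      Z₀ = insRange f (1 + m) ⁅ f 0 ⁆

      0y : Adj Γ (f 0) y
      0y = adj-sym (subst (Adj Γ y) closes (walk (2 + m) ℕ.≤-refl))

      1y : Adj Γ (f (1 + m)) y
      1y = walk (1 + m) (ℕ.n≤1+n _)

      ends-≢ : f 0 ≢ f (1 + m)
      ends-≢ eq with inj-< (s≤s z≤n) (ℕ.m≤n⇒m≤1+n ℕ.≤-refl) eq
      ... | ()

      0∈ : T (Z₀ (f 0))
      0∈ = insRange-old f (1 + m) ⁅ f 0 ⁆ (ins-self _)

      1∈ : T (Z₀ (f (1 + m)))
      1∈ = insRange-new f (1 + m) ⁅ f 0 ⁆ (s≤s z≤n) ℕ.≤-refl

      y∉ : ¬ T (Z₀ y)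
      y∉ p with insRange-elim f (1 + m) ⁅ f 0 ⁆ p
      ... | inj₂ (i , _ , i≤ , eq) = ℕ.1+n≰n (subst (_≤ 1 + m) (sym (inj-< ℕ.≤-refl (s≤s (ℕ.m≤n⇒m≤1+n i≤)) eq)) i≤)
      ... | inj₁ q with ins-elim (λ _ → false) q
      ...   | inj₁ eq = adj-irrefl 0y (sym eq)

      2≤deg₀ : 2 ≤ deg Γ (f 0)
      2≤deg₀ = deg≥2 (walk 0 (s≤s z≤n)) 0y λ eq → one≢ (inj-< (s≤s (s≤s z≤n)) ℕ.≤-refl eq)
        where
        one≢ : 1 ≢ 2 + m
        one≢ ()

      explore : ∀ {s} → Slack s ⁅ f 0 ⁆ → Slack s Z₀
      explore = slack-range f (1 + m) ⁅ f 0 ⁆ (ins-self _) (λ i lt → walk i (ℕ.m≤n⇒m≤1+n (ℕ.m≤n⇒m≤1+n lt)))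

    verts : VSet
    verts = ins y Z₀

    -- The start at `f 0` has slack 1. The last vertex `y` is adjacent to both ends of the path
    -- explored before it, and the gain there uses the slack up.
    verts-tight : KerDimAtLeast (adjMat Γ) (suc (excess Γ)) → Tight verts
    verts-tight D = slack-gain Z₀ 0∈ 0y 1∈ 1y ends-≢ y∉ 3≤d
      (explore (excess Γ , dim-start (f 0) D , ℕ.≤-trans (Ψ-vertex 2≤deg₀) (ℕ.≤-reflexive (ℕ.+-comm 1 (excess Γ)))))

    verts-∋ : ∀ {i} → i < 3 + m → T (verts (f i))
    verts-∋ {i} (s≤s i≤) with ℕ.m≤n⇒m<n∨m≡n i≤
    ... | inj₂ refl = ins-self Z₀
    ... | inj₁ (s≤s i≤′) = ins-old Z₀ (insRange-new₀ f (1 + m) ⁅ f 0 ⁆ (ins-self _) i≤′)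

    verts-elim : ∀ {j} → T (verts j) → ∃ λ i → i < 3 + m × f i ≡ j
    verts-elim p with ins-elim Z₀ p
    ... | inj₁ eq = 2 + m , ℕ.≤-refl , sym eq
    ... | inj₂ q with insRange-elim f (1 + m) ⁅ f 0 ⁆ q
    ...   | inj₂ (i , _ , i≤ , eq) = i , s≤s (ℕ.m≤n⇒m≤1+n i≤) , sym eq
    ...   | inj₁ s with ins-elim (λ _ → false) s
    ...     | inj₁ eq = 0 , s≤s z≤n , sym eq

    -- With one dimension more the start is tight already, and `tight-closing` would give `y` degree
    -- 2.
    nullity≤ : ¬ KerDimAtLeast (adjMat Γ) (2 + excess Γ)
    nullity≤ D = ℕ.1+n≰n (subst (3 ≤_) (proj₁ (tight-closing conn Z₀
      (explore (suc (excess Γ) , dim-start (f 0) D , ℕ.≤-trans (Ψ-vertex 2≤deg₀) (ℕ.≤-reflexive (sym (ℕ.+-identityʳ _)))))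
      0∈ 0y 1∈ 1y ends-≢ y∉)) 3≤d)

-- Signed cycles

module _ {l : ℕ} where
  private L = 3 + l

  toℕ-mod : ∀ k → toℕ (k mod L) ≡ k % L
  toℕ-mod k = toℕ-fromℕ< (m%n<n k L)

  mod-cong : ∀ a b → a % L ≡ b % L → a mod L ≡ b mod L
  mod-cong a b eq = toℕ-injective (trans (toℕ-mod a) (trans eq (sym (toℕ-mod b))))

  toℕ-mod-id : ∀ (i : Fin L) → toℕ i mod L ≡ i
  toℕ-mod-id i = toℕ-injective (trans (toℕ-mod (toℕ i)) (m<n⇒m%n≡m (toℕ<n i)))

  next-mod : ∀ k → next (k mod L) ≡ suc k mod L
  next-mod k = mod-cong (suc (toℕ (k mod L))) (suc k) (begin
    suc (toℕ (k mod L)) % L ≡⟨ cong (λ t → suc t % L) (toℕ-mod k) ⟩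
    (1 + k % L) % L ≡⟨ %-distribˡ-+ 1 (k % L) L ⟩
    (1 % L + k % L % L) % L ≡⟨ cong (λ t → (1 % L + t) % L) (m%n%n≡m%n k L) ⟩
    (1 % L + k % L) % L ≡⟨ sym (%-distribˡ-+ 1 k L) ⟩
    suc k % L ∎)
    where open ≡-Reasoning

  toℕ-next : ∀ (i : Fin L) → suc (toℕ i) < L → toℕ (next i) ≡ suc (toℕ i)
  toℕ-next i lt = trans (toℕ-mod (suc (toℕ i))) (m<n⇒m%n≡m lt)

  toℕ-next-last : ∀ (i : Fin L) → suc (toℕ i) ≡ L → toℕ (next i) ≡ 0
  toℕ-next-last i eq = trans (toℕ-mod (suc (toℕ i))) (trans (cong (_% L) eq) (n%n≡0 L))

  next-case : ∀ (i : Fin L) → (suc (toℕ i) < L × toℕ (next i) ≡ suc (toℕ i)) ⊎ (suc (toℕ i) ≡ L × toℕ (next i) ≡ 0)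
  next-case i with ℕ.m≤n⇒m<n∨m≡n (toℕ<n i)
  ... | inj₁ lt = inj₁ (lt , toℕ-next i lt)
  ... | inj₂ eq = inj₂ (eq , toℕ-next-last i eq)

  next-injective : ∀ {i j : Fin L} → next i ≡ next j → i ≡ j
  next-injective {i} {j} eq with next-case i | next-case j
  ... | inj₁ (_ , p) | inj₁ (_ , q) = toℕ-injective (ℕ.suc-injective (trans (sym p) (trans (cong toℕ eq) q)))
  ... | inj₂ (p , _) | inj₂ (q , _) = toℕ-injective (ℕ.suc-injective (trans p (sym q)))
  ... | inj₁ (_ , p) | inj₂ (_ , q) = ⊥-elim (ℕ.1+n≢0 (trans (sym p) (trans (cong toℕ eq) q)))
  ... | inj₂ (_ , p) | inj₁ (_ , q) = ⊥-elim (ℕ.1+n≢0 (trans (sym q) (trans (cong toℕ (sym eq)) p)))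

  -- The summand `2 + l` is `L − 1`, that is, -1 modulo `L`.
  prev : Fin L → Fin L
  prev i = (toℕ i + (2 + l)) mod L

  next-prev : ∀ i → next (prev i) ≡ i
  next-prev i = trans (next-mod (toℕ i + (2 + l))) (trans (mod-cong (suc (toℕ i + (2 + l))) (toℕ i) (trans (cong (_% L) (sym (ℕ.+-suc (toℕ i) (2 + l)))) ([m+n]%n≡m%n (toℕ i) L))) (toℕ-mod-id i))

  next≢ : ∀ (i : Fin L) → next i ≢ i
  next≢ i eq with next-case i
  ... | inj₁ (_ , p) = ℕ.1+n≢n (trans (sym p) (cong toℕ eq))
  ... | inj₂ (q , p) = ℕ.1+n≢0 (ℕ.suc-injective (trans (sym q) (cong suc (trans (cong toℕ (sym eq)) p))))

  -- Length at least 3 enters here: the two neighbours of a vertex along the cycle are distinct.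
  nextnext≢ : ∀ (i : Fin L) → next (next i) ≢ i
  nextnext≢ i eq with next-case i | next-case (next i)
  ... | inj₁ (_ , p) | inj₁ (_ , q) = ℕ.m+1+n≢n 1 (trans (cong suc (sym p)) (trans (sym q) (cong toℕ eq)))
  ... | inj₁ (_ , p) | inj₂ (e , q) = ℕ.1+n≢0 (ℕ.suc-injective (ℕ.suc-injective (trans (sym e)
        (cong suc (trans p (cong suc (trans (cong toℕ (sym eq)) q)))))))
  ... | inj₂ (e , p) | inj₁ (_ , q) = ℕ.1+n≢0 (ℕ.suc-injective (ℕ.suc-injective (trans (sym e)
        (cong suc (trans (cong toℕ (sym eq)) (trans q (cong suc p)))))))
  ... | inj₂ (e , p) | inj₂ (e′ , q) = ℕ.1+n≢0 (ℕ.suc-injective (trans (sym e′) (cong suc p)))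

module Cycles {n} (Γ : SGraph n) (sg : IsSignedGraph Γ) where

  open Basic Γ sg
  open Explore Γ sg

  onCycle? : (C : Cycle Γ) → ∀ u → Dec (OnCycle C u)
  onCycle? C u = any? (λ i → vtx C i ≟ u)

  -- A cycle unrolled periodically over ℕ, so that a change of the starting vertex is a shift of the
  -- index and needs no reduction modulo the length.
  record PSeq (f : ℕ → Fin n) (m : ℕ) : Set where
    field
      inj-<  : ∀ {i j} → i < 3 + m → j < 3 + m → f i ≡ f j → i ≡ j
      walk   : ∀ i → Adj Γ (f i) (f (suc i))
      period : ∀ i → f (i + (3 + m)) ≡ f i

  toCycSeq : ∀ {f m} → PSeq f m → CycSeq f (3 + m)
  toCycSeq P = record { inj-< = inj-< ; walk = λ i _ → walk i ; closes = period 0 }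
    where open PSeq P

  shift₁ : ∀ {f m} → PSeq f m → PSeq (λ k → f (suc k)) m
  shift₁ {f} {m} P = record { inj-< = inj′ ; walk = λ i → walk (suc i) ; period = λ i → period (suc i) }
    where
    open PSeq P
    inj′ : ∀ {i j} → i < 3 + m → j < 3 + m → f (suc i) ≡ f (suc j) → i ≡ j
    inj′ {i} {j} i< j< eq with ℕ.m≤n⇒m<n∨m≡n i< | ℕ.m≤n⇒m<n∨m≡n j<
    ... | inj₁ i<′ | inj₁ j<′ = ℕ.suc-injective (inj-< i<′ j<′ eq)
    ... | inj₂ refl | inj₂ refl = refl
    ... | inj₁ i<′ | inj₂ refl = ⊥-elim (ℕ.1+n≢0 (inj-< i<′ (s≤s z≤n) (trans eq (period 0))))
    ... | inj₂ refl | inj₁ j<′ = ⊥-elim (ℕ.1+n≢0 (inj-< j<′ (s≤s z≤n) (trans (sym eq) (period 0))))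

  seq-no-back : ∀ {f m} → PSeq f m → ∀ i → f i ≢ f (2 + i)
  seq-no-back P zero eq with PSeq.inj-< P (s≤s z≤n) (s≤s (s≤s (s≤s z≤n))) eq
  ... | ()
  seq-no-back P (suc i) eq = seq-no-back (shift₁ P) i eq

  record Orientation (C : Cycle Γ) : Set where
    field
      seq   : ℕ → Fin n
      pseq  : PSeq seq (len C)
      on    : ∀ k → OnCycle C (seq k)
      cover : ∀ {v} → OnCycle C v → ∃ λ k → k < 3 + len C × seq k ≡ v
      edge  : ∀ k → CycleEdge C (seq k) (seq (suc k))

  orient : (C : Cycle Γ) → Orientation C
  orient C = record
    { seq = λ k → vtx C (k mod L)
    ; pseq = record
      { inj-< = λ {i} {j} i< j< eq → trans (sym (m<n⇒m%n≡m i<)) (trans (trans (sym (toℕ-mod i)) (trans (cong toℕ (inj C eq)) (toℕ-mod j))) (m<n⇒m%n≡m j<))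
      ; walk = λ i → subst (λ t → Adj Γ (vtx C (i mod L)) (vtx C t)) (next-mod i) (adj C (i mod L))
      ; period = λ i → cong (vtx C) (mod-cong (i + L) i ([m+n]%n≡m%n i L)) }
    ; on = λ k → k mod L , refl
    ; cover = λ { (i , eq) → toℕ i , toℕ<n i , trans (cong (vtx C) (toℕ-mod-id i)) eq }
    ; edge = λ k → k mod L , inj₁ (refl , cong (vtx C) (next-mod k)) }
    where L = 3 + len C

  shift : ∀ {C} → Orientation C → Orientation C
  shift {C} O = record { seq = λ k → seq (suc k) ; pseq = shift₁ pseq ; on = λ k → on (suc k) ; cover = cover′ ; edge = λ k → edge (suc k) }
    where
    open Orientation O
    cover′ : ∀ {v} → OnCycle C v → ∃ λ k → k < 3 + len C × seq (suc k) ≡ v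
    cover′ c with cover c
    ... | suc k , lt , eq = k , ℕ.<-trans ℕ.≤-refl lt , eq
    ... | zero , lt , eq = 2 + len C , ℕ.≤-refl , trans (PSeq.period pseq 0) eq

  abstract
    orientFrom : (C : Cycle Γ) → ∀ {u} → OnCycle C u → Σ (Orientation C) λ O → Orientation.seq O 0 ≡ u
    orientFrom C {u} c with Orientation.cover (orient C) c
    ... | k , _ , eq = go k (orient C) eq
      where
      go : ∀ k (O : Orientation C) → Orientation.seq O k ≡ u → Σ (Orientation C) λ O → Orientation.seq O 0 ≡ u
      go zero    O eq = O , eq
      go (suc k) O eq = go k (shift O) eq

  seqCycle : ∀ {f m} → CycSeq f (3 + m) → Cycle Γ
  seqCycle {f} {m} c = record
    { len = m ; vtx = λ i → f (toℕ i) ; inj = λ eq → toℕ-injective (inj-< (toℕ<n _) (toℕ<n _) eq) ; adj = λ i → adj′ i (next-case i) }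
    where
    open CycSeq c
    adj′ : ∀ (i : Fin (3 + m)) → (suc (toℕ i) < 3 + m × toℕ (next i) ≡ suc (toℕ i)) ⊎ (suc (toℕ i) ≡ 3 + m × toℕ (next i) ≡ 0) →
      Adj Γ (f (toℕ i)) (f (toℕ (next i)))
    adj′ i (inj₁ (lt , eq)) = subst (λ t → Adj Γ (f (toℕ i)) (f t)) (sym eq) (walk (toℕ i) (toℕ<n i))
    adj′ i (inj₂ (e , eq)) = subst (λ t → Adj Γ (f (toℕ i)) (f t)) (sym eq)
      (subst (Adj Γ (f (toℕ i))) (trans (cong f e) closes) (walk (toℕ i) (toℕ<n i)))

  seqCycle-on : ∀ {f m} (c : CycSeq f (3 + m)) {k} → k < 3 + m → OnCycle (seqCycle c) (f k)
  seqCycle-on {f} c k< = fromℕ< k< , cong f (toℕ-fromℕ< k<)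

  seqCycle-edge : ∀ {f m} (c : CycSeq f (3 + m)) {k} → k < 3 + m → CycleEdge (seqCycle c) (f k) (f (suc k))
  seqCycle-edge {f} {m} c {k} k< = i , inj₁ (cong f (toℕ-fromℕ< k<) , at (next-case i))
    where
    i : Fin (3 + m)
    i = fromℕ< k<
    at : (suc (toℕ i) < 3 + m × toℕ (next i) ≡ suc (toℕ i)) ⊎ (suc (toℕ i) ≡ 3 + m × toℕ (next i) ≡ 0) → f (toℕ (next i)) ≡ f (suc k)
    at (inj₁ (_ , eq)) = cong f (trans eq (cong suc (toℕ-fromℕ< k<)))
    at (inj₂ (e , eq)) = trans (cong f eq) (trans (sym (CycSeq.closes c)) (cong f (trans (sym e) (cong suc (toℕ-fromℕ< k<)))))

  CycleEdge-sym : ∀ (C : Cycle Γ) {u v} → CycleEdge C u v → CycleEdge C v u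
  CycleEdge-sym C (i , inj₁ p) = i , inj₂ p
  CycleEdge-sym C (i , inj₂ p) = i , inj₁ p

  CycleEdge-on : ∀ (C : Cycle Γ) {u v} → CycleEdge C u v → OnCycle C u × OnCycle C v
  CycleEdge-on C (i , inj₁ (p , q)) = (i , p) , (next i , q)
  CycleEdge-on C (i , inj₂ (p , q)) = (next i , q) , (i , p)

  cycleEdge-nbr : (C : Cycle Γ) → ∀ {i j} → CycleEdge C (vtx C (next i)) j → j ≡ vtx C i ⊎ j ≡ vtx C (next (next i))
  cycleEdge-nbr C {i} (m , inj₁ (p , q)) = inj₂ (trans (sym q) (cong (λ t → vtx C (next t)) (inj C p)))
  cycleEdge-nbr C {i} (m , inj₂ (p , q)) = inj₁ (trans (sym p) (cong (vtx C) (next-injective (inj C q))))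

  module _ (C : Cycle Γ) where

    private
      L = 3 + len C
      v = vtx C

    around : ∀ {u} → OnCycle C u → ∃ λ i → v (next i) ≡ u × Adj Γ u (v i) × Adj Γ u (v (next (next i))) × v i ≢ v (next (next i))
    around (j , refl) = prev j , cong v (next-prev j) ,
      adj-sym (subst (λ t → Adj Γ (v (prev j)) (v t)) (next-prev j) (adj C (prev j))) ,
      subst (λ t → Adj Γ (v j) (v (next t))) (sym (next-prev j)) (adj C j) ,
      λ eq → nextnext≢ (prev j) (sym (inj C eq))

    onCycle⇒deg≥2 : ∀ {u} → OnCycle C u → 2 ≤ deg Γ u
    onCycle⇒deg≥2 c with around c
    ... | _ , _ , a , b , ne = deg≥2 a b ne

    -- The two cycle edges at `u` use up its degree.
    deg2-edge : ∀ {u w} → OnCycle C u → deg Γ u ≡ 2 → Adj Γ u w → CycleEdge C u w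
    deg2-edge c d2 uw with around c
    ... | i , eq , a , b , ne with deg2-nbr d2 a b ne uw
    ...   | inj₁ refl = i , inj₂ (refl , eq)
    ...   | inj₂ refl = next i , inj₁ (eq , refl)

    σ : Fin L → ℚ
    σ i = adjMat Γ (v i) (v (next i))

    -- The kernel equation at `next i`, which links its two neighbours. Indexing by the predecessor
    -- keeps `prev` out of the equation.
    Tri : (Fin L → ℚ) → Set
    Tri z = ∀ i → σ i *ℚ z i +ℚ σ (next i) *ℚ z (next (next i)) ≡ 0ℚ

    private
      B = adjMat (cycleGraph C)

      does-yes : ∀ {i j : Fin L} → i ≡ j → does (i ≟ j) ≡ true
      does-yes {i} {j} eq with i ≟ j
      ... | yes _ = refl
      ... | no ne = ⊥-elim (ne eq)

      does-no : ∀ {i j : Fin L} → i ≢ j → does (i ≟ j) ≡ false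
      does-no {i} {j} ne with i ≟ j
      ... | yes eq = ⊥-elim (ne eq)
      ... | no _ = refl

      B-next : ∀ i → B i (next i) ≡ σ i
      B-next i rewrite does-yes {next i} refl = refl

      B-prev : ∀ i → B (next i) i ≡ σ i
      B-prev i rewrite does-yes {next i} refl with does (i ≟ next (next i))
      ... | true = A-sym (v (next i)) (v i)
      ... | false = A-sym (v (next i)) (v i)

      B-off : ∀ i j → j ≢ i → j ≢ next (next i) → B (next i) j ≡ 0ℚ
      B-off i j ne ne′ rewrite does-no ne′ | does-no {next i} {next j} (λ eq → ne (sym (next-injective eq))) = refl

    cycle-row : ∀ z i → rowOf B z (next i) ≡ σ i *ℚ z i +ℚ σ (next i) *ℚ z (next (next i))
    cycle-row z i = rowOf-pair B z (next i) (λ eq → nextnext≢ i (sym eq)) (B-off i) (B-prev i) (B-next (next i))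

    kernel⇒Tri : ∀ {z} → Ker B z → Tri z
    kernel⇒Tri {z} k i = trans (sym (cycle-row z i)) (rows k (next i))

    Tri⇒kernel : ∀ {z} → Tri z → Ker B z
    Tri⇒kernel {z} t = ker λ j → subst (λ j → rowOf B z j ≡ 0ℚ) (next-prev j) (trans (cycle-row z (prev j)) (t (prev j)))

    σ² : ∀ i → σ i *ℚ σ i ≡ 1ℚ
    σ² i = A-square (adj C i)

    -- Each equation carries a zero two vertices further, so two adjacent zeros go round the whole
    -- cycle.
    Tri-force : ∀ {z} → Tri z → ∀ i → z i ≡ 0ℚ → z (next i) ≡ 0ℚ → ∀ j → z j ≡ 0ℚ
    -- From `i`, the vertex `j` is reached in `toℕ j + L ∸ toℕ i` forward steps; the added `L`
    -- prevents truncation.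
    Tri-force {z} t i zi zn j = subst (λ j → z j ≡ 0ℚ) (trans (mod-cong (toℕ j + L) (toℕ j) ([m+n]%n≡m%n (toℕ j) L)) (toℕ-mod-id j))
      (subst (λ k → z (k mod L) ≡ 0ℚ) (ℕ.m+[n∸m]≡n i≤) (proj₁ (go (toℕ j + L ∸ toℕ i))))
      where
      i≤ : toℕ i ≤ toℕ j + L
      i≤ = ℕ.≤-trans (ℕ.<⇒≤ (toℕ<n i)) (ℕ.m≤n+m L (toℕ j))
      two : ∀ i → z i ≡ 0ℚ → z (next (next i)) ≡ 0ℚ
      two i zi = *-≢0 (A≢0 (adj C (next i))) (trans (sym (ℚ.+-identityˡ _))
        (trans (cong (_+ℚ σ (next i) *ℚ z (next (next i))) (sym (trans (cong (σ i *ℚ_) zi) (ℚ.*-zeroʳ (σ i))))) (t i)))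
      Zero₂ : Fin L → Set
      Zero₂ j = z j ≡ 0ℚ × z (next j) ≡ 0ℚ
      go : ∀ k → Zero₂ ((toℕ i + k) mod L)
      go zero = subst Zero₂ (sym (trans (cong (_mod L) (ℕ.+-identityʳ (toℕ i))) (toℕ-mod-id i))) (zi , zn)
      go (suc k) = subst Zero₂ (trans (next-mod (toℕ i + k)) (cong (_mod L) (sym (ℕ.+-suc (toℕ i) k))))
        (proj₂ (go k) , two _ (proj₁ (go k)))

    ¬dim3 : ¬ KerDimAtLeast B 3
    ¬dim3 D = let (z , k , z0 , z1 , q , z≢0) = kernel-vanishing-at₂ B D zero (next zero) in
      z≢0 (Tri-force (kernel⇒Tri k) zero z0 z1 q)

    -- The signed shift z ↦ σ·(z ∘ next) acts on the kernel with square −1, so over ℚ the kernel of a signed cycle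
    -- is never one-dimensional.
    nonzero⇒nullity2 : ∀ {z} → Tri z → ∀ {q} → z q ≢ 0ℚ → cycleNullity≡ C 2
    nonzero⇒nullity2 {z} t {q} zq = (vs , ind , λ { zero → rows (Tri⇒kernel t) ; (suc zero) → rows (Tri⇒kernel tS) }) , ¬dim3
      where
      open ℚ-Solver
      open ≡-Reasoning
      S : Fin L → ℚ
      S i = σ i *ℚ z (next i)
      vs : Fin 2 → Fin L → ℚ
      vs zero = z
      vs (suc zero) = S
      tS : Tri S
      tS i = begin
        σ i *ℚ (σ i *ℚ z (next i)) +ℚ σ (next i) *ℚ (σ nn *ℚ z (next nn))
          ≡⟨ solve 5 (λ s a p q b → s :* (s :* a) :+ p :* (q :* b) := (s :* s) :* a :+ p :* (q :* b)) refl
               (σ i) (z (next i)) (σ (next i)) (σ nn) (z (next nn)) ⟩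
        (σ i *ℚ σ i) *ℚ z (next i) +ℚ σ (next i) *ℚ (σ nn *ℚ z (next nn))
          ≡⟨ cong (λ c → c *ℚ z (next i) +ℚ σ (next i) *ℚ (σ nn *ℚ z (next nn))) (trans (σ² i) (sym (σ² (next i)))) ⟩
        (σ (next i) *ℚ σ (next i)) *ℚ z (next i) +ℚ σ (next i) *ℚ (σ nn *ℚ z (next nn))
          ≡⟨ solve 4 (λ s a q b → (s :* s) :* a :+ s :* (q :* b) := s :* (s :* a :+ q :* b)) refl
               (σ (next i)) (z (next i)) (σ nn) (z (next nn)) ⟩
        σ (next i) *ℚ (σ (next i) *ℚ z (next i) +ℚ σ nn *ℚ z (next nn))
          ≡⟨ cong (σ (next i) *ℚ_) (t (next i)) ⟩
        σ (next i) *ℚ 0ℚ ≡⟨ ℚ.*-zeroʳ (σ (next i)) ⟩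
        0ℚ ∎
        where nn = next (next i)
      ind : LinIndep vs
      ind c eq = λ { zero → c₀ ; (suc zero) → c₁ }
        where
        a = c zero
        b = c (suc zero)
        rel : ∀ i → a *ℚ z i +ℚ b *ℚ (σ i *ℚ z (next i)) ≡ 0ℚ
        rel i = trans (cong (a *ℚ z i +ℚ_) (sym (ℚ.+-identityʳ (b *ℚ (σ i *ℚ z (next i)))))) (eq i)
        z₀ = z q
        z₁ = z (next q)
        z₂ = z (next (next q))
        s = σ q
        p = σ (next q)
        -- The relation `rel` and the kernel equation at `next q` share the term in `z₂`, and
        -- eliminating it leaves this. Inserted into `a` times the relation at `q`, it gives `norm`.
        az₁ : a *ℚ z₁ ≡ b *ℚ (s *ℚ z₀)
        az₁ = begin
          a *ℚ z₁ ≡⟨ solve 3 (λ u b w → u := (u :+ b :* w) :+ b :* (:- w)) refl (a *ℚ z₁) b (p *ℚ z₂) ⟩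
          (a *ℚ z₁ +ℚ b *ℚ (p *ℚ z₂)) +ℚ b *ℚ (- (p *ℚ z₂)) ≡⟨ cong (_+ℚ b *ℚ (- (p *ℚ z₂))) (rel (next q)) ⟩
          0ℚ +ℚ b *ℚ (- (p *ℚ z₂)) ≡⟨ ℚ.+-identityˡ _ ⟩
          b *ℚ (- (p *ℚ z₂)) ≡⟨ cong (b *ℚ_) (trans (sym (ℚ.+-identityˡ (- (p *ℚ z₂)))) (trans (cong (_+ℚ - (p *ℚ z₂)) (sym (t q)))
               (solve 2 (λ u w → (u :+ w) :+ (:- w) := u) refl (s *ℚ z₀) (p *ℚ z₂)))) ⟩
          b *ℚ (s *ℚ z₀) ∎
        norm : (a *ℚ a +ℚ b *ℚ b) *ℚ z₀ ≡ 0ℚ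
        norm = begin
          (a *ℚ a +ℚ b *ℚ b) *ℚ z₀ ≡⟨ cong (λ c → (a *ℚ a +ℚ c) *ℚ z₀) (sym (ℚ.*-identityʳ (b *ℚ b))) ⟩
          (a *ℚ a +ℚ b *ℚ b *ℚ 1ℚ) *ℚ z₀ ≡⟨ cong (λ c → (a *ℚ a +ℚ b *ℚ b *ℚ c) *ℚ z₀) (sym (σ² q)) ⟩
          (a *ℚ a +ℚ b *ℚ b *ℚ (s *ℚ s)) *ℚ z₀
            ≡⟨ solve 4 (λ a b s z → (a :* a :+ b :* b :* (s :* s)) :* z := a :* (a :* z) :+ b :* s :* (b :* (s :* z))) refl a b s z₀ ⟩
          a *ℚ (a *ℚ z₀) +ℚ b *ℚ s *ℚ (b *ℚ (s *ℚ z₀)) ≡⟨ cong (λ c → a *ℚ (a *ℚ z₀) +ℚ b *ℚ s *ℚ c) (sym az₁) ⟩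
          a *ℚ (a *ℚ z₀) +ℚ b *ℚ s *ℚ (a *ℚ z₁)
            ≡⟨ solve 5 (λ a b s z w → a :* (a :* z) :+ b :* s :* (a :* w) := a :* (a :* z :+ b :* (s :* w))) refl a b s z₀ z₁ ⟩
          a *ℚ (a *ℚ z₀ +ℚ b *ℚ (s *ℚ z₁)) ≡⟨ cong (a *ℚ_) (rel q) ⟩
          a *ℚ 0ℚ ≡⟨ ℚ.*-zeroʳ a ⟩
          0ℚ ∎
        n0 : a *ℚ a +ℚ b *ℚ b ≡ 0ℚ
        n0 = *-≢0 zq (trans (ℚ.*-comm (z q) _) norm)
        c₀ : a ≡ 0ℚ
        c₀ with a ℚ.≟ 0ℚ
        ... | yes p = p
        ... | no ne = ⊥-elim (sum-of-squares≢0 b ne n0)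
        c₁ : b ≡ 0ℚ
        c₁ with b ℚ.≟ 0ℚ
        ... | yes p = p
        ... | no ne = ⊥-elim (sum-of-squares≢0 a ne (trans (ℚ.+-comm (b *ℚ b) (a *ℚ a)) n0))

    ext : (Fin L → ℚ) → Fin n → ℚ
    ext z u with onCycle? C u
    ... | yes (i , _) = z i
    ... | no _ = 0ℚ

    ext-vtx : ∀ z i → ext z (v i) ≡ z i
    ext-vtx z i with onCycle? C (v i)
    ... | yes (j , eq) = cong z (inj C eq)
    ... | no off = ⊥-elim (off (i , refl))

    ext-off : ∀ z {u} → ¬ OnCycle C u → ext z u ≡ 0ℚ
    ext-off z {u} off with onCycle? C u
    ... | yes on = ⊥-elim (off on)
    ... | no _ = refl

    ext-Tri : ∀ {z} → Tri z → Tri (λ i → ext z (v i))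
    ext-Tri {z} t i = trans (cong₂ (λ a b → σ i *ℚ a +ℚ σ (next i) *ℚ b) (ext-vtx z i) (ext-vtx z (next (next i)))) (t i)

    private
      scale : ∀ {z} → Tri z → ∀ q → z q ≢ 0ℚ → ∃ λ y → Tri y × y q ≡ 1ℚ × (∀ j → z j ≡ 0ℚ → y j ≡ 0ℚ)
      scale {z} t q zq = (λ j → c *ℚ z j) , tri , ℚ.*-inverseˡ (z q) , λ j zj → trans (cong (c *ℚ_) zj) (ℚ.*-zeroʳ c)
        where
        instance _ = ≢-nonZero zq
        c = 1/ z q
        open ℚ-Solver
        tri : Tri (λ j → c *ℚ z j)
        tri i = trans (solve 5 (λ c a x b y → a :* (c :* x) :+ b :* (c :* y) := c :* (a :* x :+ b :* y)) refl
          c (σ i) (z i) (σ (next i)) (z (next (next i)))) (trans (cong (c *ℚ_) (t i)) (ℚ.*-zeroʳ c))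

      -- Dimension 2 leaves a nonzero kernel vector with `z i = 0`. By `force` it does not vanish at
      -- `j`, so it can be scaled to 1 there.
      pick : KerDimAtLeast B 2 → ∀ i j → (∀ {z} → Tri z → z i ≡ 0ℚ → z j ≡ 0ℚ → ∀ q → z q ≡ 0ℚ) →
        ∃ λ y → Tri y × y i ≡ 0ℚ × y j ≡ 1ℚ
      pick D i j force =
        let (z , k , zi , q , zq) = kernel-vanishing-at B D i
            (y , ty , y1 , y0) = scale (kernel⇒Tri k) j (λ zj → zq (force (kernel⇒Tri k) zi zj q))
        in y , ty , y0 i zi , y1

    kernel-01 : KerDimAtLeast B 2 → ∀ i → ∃ λ z → Tri z × z i ≡ 0ℚ × z (next i) ≡ 1ℚ
    kernel-01 D i = pick D i (next i) (λ t zi zn → Tri-force t i zi zn)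

    kernel-10 : KerDimAtLeast B 2 → ∀ i → ∃ λ z → Tri z × z (next i) ≡ 0ℚ × z i ≡ 1ℚ
    kernel-10 D i = pick D (next i) i (λ t zn zi → Tri-force t i zi zn)

    -- The hypothesis covers chords as well as edges that leave the cycle: their other ends must
    -- carry the value 0.
    kernel⇒Tri-restrict : ∀ {x} → Ker (adjMat Γ) x →
      (∀ i j → Adj Γ (v (next i)) j → j ≢ v i → j ≢ v (next (next i)) → x j ≡ 0ℚ) → Tri (λ i → x (v i))
    kernel⇒Tri-restrict {x} k z i = trans (cong (λ a → a *ℚ x (v i) +ℚ σ (next i) *ℚ x (v (next (next i)))) (A-sym (v i) (v (next i))))
      (trans (sym (row-pair x (λ eq → nextnext≢ i (sym (inj C eq))) (z i))) (rows k (v (next i))))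

    Tri⇒row : ∀ {x} → Tri (λ i → x (v i)) → ∀ i →
      (∀ j → Adj Γ (v (next i)) j → j ≢ v i → j ≢ v (next (next i)) → x j ≡ 0ℚ) → row (v (next i)) x ≡ 0ℚ
    Tri⇒row {x} t i z = trans (row-pair x (λ eq → nextnext≢ i (sym (inj C eq))) z)
      (trans (cong (λ a → a *ℚ x (v i) +ℚ σ (next i) *ℚ x (v (next (next i)))) (A-sym (v (next i)) (v i))) (t i))

    -- The kernel equation at `b` in terms of its two cycle edges, independent of the direction in
    -- which `C` is listed.
    cycle-eq : ∀ {x : Fin n → ℚ} → Tri (λ i → x (v i)) → ∀ {a b c} → CycleEdge C b a → CycleEdge C b c → a ≢ c →
      adjMat Γ b a *ℚ x a +ℚ adjMat Γ b c *ℚ x c ≡ 0ℚ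
    cycle-eq {x} t {a} {b} {c} ba bc a≢c with around (proj₁ (CycleEdge-on C ba))
    ... | i , refl , _ , _ , _ with cycleEdge-nbr C {i} ba | cycleEdge-nbr C {i} bc
    ...   | inj₁ refl | inj₁ e = ⊥-elim (a≢c (sym e))
    ...   | inj₂ refl | inj₂ e = ⊥-elim (a≢c (sym e))
    ...   | inj₁ refl | inj₂ refl = trans (cong (λ s → s *ℚ x (v i) +ℚ σ (next i) *ℚ x (v (next (next i)))) (A-sym (v (next i)) (v i))) (t i)
    ...   | inj₂ refl | inj₁ refl = trans (ℚ.+-comm (σ (next i) *ℚ x (v (next (next i)))) (adjMat Γ (v (next i)) (v i) *ℚ x (v i)))
            (trans (cong (λ s → s *ℚ x (v i) +ℚ σ (next i) *ℚ x (v (next (next i)))) (A-sym (v (next i)) (v i))) (t i))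

    edge-vector : KerDimAtLeast B 2 → ∀ {a b} → CycleEdge C a b →
      ∃ λ x → Tri (λ i → x (v i)) × (∀ {u} → ¬ OnCycle C u → x u ≡ 0ℚ) × x a ≡ 0ℚ × x b ≡ 1ℚ
    edge-vector D (i , inj₁ (refl , refl)) = let (z , t , z0 , z1) = kernel-01 D i in
      ext z , ext-Tri t , ext-off z , trans (ext-vtx z i) z0 , trans (ext-vtx z (next i)) z1
    edge-vector D (i , inj₂ (refl , refl)) = let (z , t , z0 , z1) = kernel-10 D i in
      ext z , ext-Tri t , ext-off z , trans (ext-vtx z (next i)) z0 , trans (ext-vtx z i) z1

-- Ears and pendant cycles of tight sets

module Structure {n} (Γ : SGraph n) (sg : IsSignedGraph Γ) (conn : Connected Γ) where

  open Basic Γ sg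
  open Explore Γ sg
  open Cycles Γ sg

  record TightOn (C : Cycle Γ) : Set where
    field
      Z     : VSet
      tight : Tight Z
      on⇒   : ∀ {v} → OnCycle C v → T (Z v)
      ⇒on   : ∀ {v} → T (Z v) → OnCycle C v

  module _ (C : Cycle Γ) {u} (u∈ : OnCycle C u) (3≤d : 3 ≤ deg Γ u) where
    private
      O = orientFrom C u∈
      -- One shift moves `u` from index 0 to index `2 + len C`, the position at which `CycleTight`
      -- needs a branch vertex.
      open Orientation (shift (proj₁ O))
      last≡u : seq (2 + len C) ≡ u
      last≡u = trans (PSeq.period (Orientation.pseq (proj₁ O)) 0) (proj₂ O)
      module CT = CycleTight conn (toCycSeq pseq) (subst (λ t → 3 ≤ deg Γ t) (sym last≡u) 3≤d)

    abstract
      tightOn : KerDimAtLeast (adjMat Γ) (suc (excess Γ)) → TightOn C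
      tightOn D = record
        { Z = CT.verts ; tight = CT.verts-tight D
        ; on⇒ = λ c → let (k , k< , eq) = cover c in subst (λ t → T (CT.verts t)) eq (CT.verts-∋ k<)
        ; ⇒on = λ p → let (k , _ , eq) = CT.verts-elim p in subst (OnCycle C) eq (on k) }

      cycle⇒nullity≤ : ¬ KerDimAtLeast (adjMat Γ) (2 + excess Γ)
      cycle⇒nullity≤ = CT.nullity≤

  -- The ends may coincide, so a cycle that meets `Z` in one vertex is an ear too. `no-back`
  -- guarantees that an interior vertex has two different neighbours along `g`; for `k = 2` the
  -- other fields do not imply this.
  record IsEar (Z : VSet) (g : ℕ → Fin n) (k : ℕ) : Set where
    field
      start∈   : T (Z (g 0))
      end∈     : T (Z (g k))
      walk     : ∀ i → i < k → Adj Γ (g i) (g (suc i))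
      interior : ∀ {i} → 1 ≤ i → i < k → ¬ T (Z (g i))
      inj-int  : ∀ {i j} → 1 ≤ i → i < k → 1 ≤ j → j < k → g i ≡ g j → i ≡ j
      no-back  : ∀ i → suc i < k → g i ≢ g (2 + i)

  module Ear {Z : VSet} {g : ℕ → Fin n} where

    rev-ear : ∀ {k} → IsEar Z g k → IsEar Z (λ t → g (k ∸ t)) k
    rev-ear {k} e = record
      { start∈ = end∈ ; end∈ = subst (λ t → T (Z (g t))) (sym (ℕ.n∸n≡0 k)) start∈
      ; walk = λ i i<k → adj-sym (subst (λ t → Adj Γ (g (k ∸ suc i)) (g t)) (back i<k) (walk (k ∸ suc i) (ℕ.∸-monoʳ-< (s≤s z≤n) i<k)))
      ; interior = λ 1≤i i<k → interior (ℕ.m<n⇒0<n∸m i<k) (ℕ.∸-monoʳ-< 1≤i (ℕ.<⇒≤ i<k))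
      ; inj-int = λ 1≤i i<k 1≤j j<k eq → ℕ.∸-cancelˡ-≡ (ℕ.<⇒≤ i<k) (ℕ.<⇒≤ j<k)
          (inj-int (ℕ.m<n⇒0<n∸m i<k) (ℕ.∸-monoʳ-< 1≤i (ℕ.<⇒≤ i<k)) (ℕ.m<n⇒0<n∸m j<k) (ℕ.∸-monoʳ-< 1≤j (ℕ.<⇒≤ j<k)) eq)
      ; no-back = λ i si<k eq → no-back (k ∸ (2 + i)) (subst (_< k) (sym (back si<k)) (ℕ.∸-monoʳ-< (s≤s z≤n) (ℕ.<⇒≤ si<k)))
          (trans (sym eq) (cong g (sym (trans (cong suc (back si<k)) (back (ℕ.<⇒≤ si<k)))))) }
      where
      open IsEar e
      back : ∀ {k i} → i < k → suc (k ∸ suc i) ≡ k ∸ i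
      back {suc k} {i} (s≤s i≤k) = sym (ℕ.+-∸-assoc 1 i≤k)

    module _ (tZ : Tight Z) where

      module _ {a b} (e : IsEar Z g (2 + a + b)) where
        open IsEar e
        private
          k = 2 + a + b
          g′ : ℕ → Fin n
          g′ t = g (k ∸ t)
          Z₁ = insRange g a Z
          Z₂ = insRange g′ b Z₁
          a<k : a < k
          a<k = ℕ.m≤n⇒m≤1+n (s≤s (ℕ.m≤m+n a b))
          Z₂-tight : Tight Z₂
          Z₂-tight = slack-range g′ b Z₁ (insRange-old g a Z end∈)
            (λ t t<b → IsEar.walk (rev-ear e) t (ℕ.<-≤-trans t<b (ℕ.m≤n+m b (2 + a))))
            (slack-range g a Z start∈ (λ i i<a → walk i (ℕ.<-trans i<a a<k)) tZ)
          k∸b : k ∸ b ≡ 2 + a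
          k∸b = ℕ.m+n∸n≡m (2 + a) b
          before∈ : T (Z₂ (g a))
          before∈ = insRange-old g′ b Z₁ (insRange-new₀ g a Z start∈ ℕ.≤-refl)
          after∈ : T (Z₂ (g (2 + a)))
          after∈ = subst (λ t → T (Z₂ (g t))) k∸b (insRange-new₀ g′ b Z₁ (insRange-old g a Z end∈) ℕ.≤-refl)
          1+a<k : 1 + a < k
          1+a<k = s≤s (s≤s (ℕ.m≤m+n a b))
          low : ∀ {t} → 1 ≤ t → t ≤ b → 2 + a ≤ k ∸ t × k ∸ t < k
          low {t} 1≤t t≤b = subst (_≤ k ∸ t) k∸b (ℕ.∸-monoʳ-≤ k t≤b) , ℕ.∸-monoʳ-< 1≤t (ℕ.≤-trans t≤b (ℕ.m≤n+m b (2 + a)))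
          mid∉ : ¬ T (Z₂ (g (1 + a)))
          mid∉ p with insRange-elim g′ b Z₁ p
          ... | inj₂ (t , 1≤t , t≤b , eq) with low 1≤t t≤b
          ...   | lo , hi = ℕ.1+n≰n (subst (2 + a ≤_) (sym (inj-int (s≤s z≤n) 1+a<k (ℕ.≤-trans (s≤s z≤n) lo) hi eq)) lo)
          mid∉ p | inj₁ q with insRange-elim g a Z q
          ... | inj₁ z = interior (s≤s z≤n) 1+a<k z
          ... | inj₂ (i , 1≤i , i≤a , eq) = ℕ.1+n≰n (subst (_≤ a) (sym (inj-int (s≤s z≤n) 1+a<k 1≤i (ℕ.≤-<-trans i≤a a<k) eq)) i≤a)
          closing = tight-closing conn Z₂ Z₂-tight before∈ (walk a a<k) after∈ (adj-sym (walk (1 + a) 1+a<k)) (no-back a 1+a<k) mid∉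

        -- Exploring `a` vertices from the front and `b` from the back leaves `g (1 + a)` as the
        -- only vertex of the ear outside a tight set. Its two neighbours along the ear are
        -- explored, so `tight-closing` applies.
        ear-split-deg : deg Γ (g (1 + a)) ≡ 2
        ear-split-deg = proj₁ closing

        -- `tight-closing` also makes `g (1 + a)` the only unexplored neighbour of `g a`. For
        -- `a = 0` this describes the neighbours of the start of the ear.
        ear-split-nbr : ∀ {j} → Adj Γ (g a) j → j ≢ g (1 + a) → T (Z j) ⊎ ∃ λ i → 1 ≤ i × i < k × j ≡ g i
        ear-split-nbr {j} aj j≢ = sort (r≡1-unique Z₂ (proj₁ (proj₂ closing)) (walk a a<k) mid∉ aj j≢)
          where
          sort : T (Z₂ j) → T (Z j) ⊎ ∃ λ i → 1 ≤ i × i < k × j ≡ g i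
          sort p with insRange-elim g′ b Z₁ p
          ... | inj₂ (t , 1≤t , t≤b , eq) = inj₂ (k ∸ t , ℕ.≤-trans (s≤s z≤n) (proj₁ (low 1≤t t≤b)) , proj₂ (low 1≤t t≤b) , eq)
          ... | inj₁ q with insRange-elim g a Z q
          ...   | inj₁ z = inj₁ z
          ...   | inj₂ (i , 1≤i , i≤a , eq) = inj₂ (i , 1≤i , ℕ.≤-<-trans i≤a a<k , eq)

      ear-deg : ∀ {k i} → IsEar Z g k → 1 ≤ i → i < k → deg Γ (g i) ≡ 2
      ear-deg {k} {suc a} e _ i<k = ear-split-deg {a} {k ∸ (2 + a)} (subst (IsEar Z g) (sym (ℕ.m+[n∸m]≡n i<k)) e)

      ear-start-nbr : ∀ {k j} → IsEar Z g (2 + k) → Adj Γ (g 0) j → j ≢ g 1 → T (Z j) ⊎ ∃ λ i → 1 ≤ i × i < 2 + k × j ≡ g i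
      ear-start-nbr e = ear-split-nbr {0} e

  open Ear public using (ear-deg; ear-start-nbr; rev-ear)

  ear-end-nbr : ∀ {Z g k j} → Tight Z → IsEar Z g (2 + k) → Adj Γ (g (2 + k)) j → j ≢ g (1 + k) →
    T (Z j) ⊎ ∃ λ i → 1 ≤ i × i < 2 + k × j ≡ g i
  ear-end-nbr {Z} {g} {k} tZ e a j≢ with ear-start-nbr tZ (rev-ear e) a j≢
  ... | inj₁ z = inj₁ z
  ... | inj₂ (i , 1≤i , i< , eq) = inj₂ (2 + k ∸ i , ℕ.m<n⇒0<n∸m i< , ℕ.∸-monoʳ-< 1≤i (ℕ.<⇒≤ i<) , eq)

  record Pendant (D : Cycle Γ) : Set where
    field
      w u      : Fin n
      w∈       : OnCycle D w
      u∉       : ¬ OnCycle D u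
      wu       : Adj Γ w u
      deg-rest : ∀ {d} → OnCycle D d → d ≢ w → deg Γ d ≡ 2
      w-nbr    : ∀ {j} → Adj Γ w j → j ≡ u ⊎ CycleEdge D w j
      deg-w    : deg Γ w ≡ 3
      null     : cycleNullity≡ D 2

  module _ (Z : VSet) (tZ : Tight Z) (D : Cycle Γ) (disj : ∀ {d} → OnCycle D d → ¬ T (Z d))
           {u w} (u∈ : T (Z u)) (w∈ : OnCycle D w) (uw : Adj Γ u w) where
    private
      module O = Orientation (proj₁ (orientFrom D w∈))
      module P = PSeq O.pseq
      g = O.seq
      m = len D
      g0 : g 0 ≡ w
      g0 = proj₂ (orientFrom D w∈)
      Z₁ = ins w Z
      tZ₁ : Tight Z₁
      tZ₁ = slack-ins Z u∈ uw tZ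
      int∉ : ∀ {i} → 1 ≤ i → i < 3 + m → ¬ T (Z₁ (g i))
      int∉ {suc i} 1≤i i< p with ins-elim Z p
      ... | inj₂ z = disj (O.on (suc i)) z
      ... | inj₁ eq = ℕ.1+n≢0 (P.inj-< i< (s≤s z≤n) (trans eq (sym g0)))
      ear : IsEar Z₁ g (3 + m)
      ear = record
        { start∈ = subst (λ t → T (Z₁ t)) (sym g0) (ins-self Z)
        ; end∈ = subst (λ t → T (Z₁ t)) (sym (trans (P.period 0) g0)) (ins-self Z)
        ; walk = λ i _ → P.walk i ; interior = int∉
        ; inj-int = λ _ i< _ j< eq → P.inj-< i< j< eq ; no-back = λ i _ → seq-no-back O.pseq i }
      u≢on : ∀ {d} → OnCycle D d → u ≢ d
      u≢on d∈ refl = disj d∈ u∈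
      w1 : Adj Γ w (g 1)
      w1 = subst (λ t → Adj Γ t (g 1)) g0 (P.walk 0)
      wl : Adj Γ w (g (2 + m))
      wl = adj-sym (subst (Adj Γ (g (2 + m))) (trans (P.period 0) g0) (P.walk (2 + m)))
      1≢l : g 1 ≢ g (2 + m)
      1≢l eq with P.inj-< (s≤s (s≤s z≤n)) ℕ.≤-refl eq
      ... | ()
      3≤deg-w : 3 ≤ deg Γ w
      3≤deg-w = deg≥3 (adj-sym uw) w1 wl (u≢on (O.on 1)) (u≢on (O.on (2 + m))) 1≢l
      rest : ∀ {d} → OnCycle D d → d ≢ w → deg Γ d ≡ 2
      rest d∈ d≢w with O.cover d∈
      ... | zero , _ , eq = ⊥-elim (d≢w (trans (sym eq) g0))
      ... | suc i , i< , refl = ear-deg tZ₁ ear (s≤s z≤n) i<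
      nbr : ∀ {j} → Adj Γ w j → j ≡ u ⊎ CycleEdge D w j
      nbr {j} wj with j ≟ g 1
      ... | yes refl = inj₂ (subst (λ t → CycleEdge D t (g 1)) g0 (O.edge 0))
      ... | no j≢1 with ear-start-nbr tZ₁ ear (subst (λ t → Adj Γ t j) (sym g0) wj) j≢1
      ...   | inj₂ (i , 1≤i , i< , refl) = inj₂ (CycleEdge-sym D (deg2-edge D (O.on i) (ear-deg tZ₁ ear 1≤i i<) (adj-sym wj)))
      ...   | inj₁ p with ins-elim Z p
      ...     | inj₁ j≡w = ⊥-elim (adj-irrefl wj (sym j≡w))
      ...     | inj₂ z with j ≟ u
      ...       | yes j≡u = inj₁ j≡u
      ...       | no j≢u = ⊥-elim (ℕ.1+n≰n (subst (3 ≤_) (proj₁ (tight-closing conn Z tZ z (adj-sym wj) u∈ uw j≢u (disj w∈))) 3≤deg-w))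
      deg3 : deg Γ w ≡ 3
      deg3 with around D w∈
      ... | i , refl , _ , _ , _ = ℕ.≤-antisym (deg≤ (u ∷ vtx D i ∷ vtx D (next (next i)) ∷ []) mem) 3≤deg-w
        where
        mem : ∀ j → Adj Γ w j → j ∈ (u ∷ vtx D i ∷ vtx D (next (next i)) ∷ [])
        mem j wj with nbr wj
        ... | inj₁ eq = here eq
        ... | inj₂ ce with cycleEdge-nbr D ce
        ...   | inj₁ eq = there (here eq)
        ...   | inj₂ eq = there (there (here eq))
      2≤r : 2 ≤ r Z₁ w
      2≤r = length≤count {P = outside Z₁ w} ((1≢l ∷ []) ∷ [] ∷ [])
        (outside-intro Z₁ w1 (int∉ (s≤s z≤n) (s≤s (s≤s z≤n))) ∷ outside-intro Z₁ wl (int∉ (s≤s z≤n) ℕ.≤-refl) ∷ [])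
      -- If every kernel vector vanishing on Z₁ vanished at g 1 too, the bound for Z₁ ∪ {g 1} would be violated.
      witness : ∃ λ x → K Z₁ x × x (g 1) ≢ 0ℚ
      witness = go tZ₁
        where
        go : Tight Z₁ → ∃ λ x → K Z₁ x × x (g 1) ≢ 0ℚ
        go (d , basis vs ind p , le) with any? (λ i → ¬? (vs i (g 1) ℚ.≟ 0ℚ))
        ... | yes (i , nz) = vs i , p i , nz
        ... | no none = ⊥-elim (ℕ.1+n≰n (ℕ.≤-trans
          (ℕ.≤-trans (sum-mono-at w (ψ-mono Z₁ (ins-self Z) w1) (ψ-drop-at Z₁ (ins-self Z) w1 (int∉ (s≤s z≤n) (s≤s (s≤s z≤n))) 2≤r))
            (ℕ.≤-trans le (ℕ.≤-reflexive (ℕ.+-identityʳ d))))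
          (dim≤Ψ conn (ins (g 1) Z₁) (ins-self Z₁) (basis vs ind (λ i → K-ins Z₁ (g 1) (vs i)
            (p i , decidable-stable (vs i (g 1) ℚ.≟ 0ℚ) (λ nz → none (i , nz))))))))

    -- Going round `D` from `w` back to `w` is an ear of `Z` with `w` added, so the other vertices
    -- of `D` have degree 2. A second neighbour of `w` in `Z` would force degree 2 on `w` by
    -- `tight-closing`, but `u` and the two cycle neighbours already make three. The witness
    -- vanishes at `u`, so its restriction to `D` solves the equations of the cycle.
    pendant-cycle : Pendant D
    pendant-cycle = record
      { w = w ; u = u ; w∈ = w∈ ; u∉ = λ u∈D → u≢on u∈D refl ; wu = adj-sym uw ; deg-rest = rest ; w-nbr = nbr ; deg-w = deg3
      ; null = nullity witness }
      where
      nullity : (∃ λ x → K Z₁ x × x (g 1) ≢ 0ℚ) → cycleNullity≡ D 2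
      nullity (x , kx , nz) = nonzero⇒nullity2 D (kernel⇒Tri-restrict D (kernel kx) off) (subst (λ t → x t ≢ 0ℚ) (sym (proj₂ (O.on 1))) nz)
        where
        off : ∀ i j → Adj Γ (vtx D (next i)) j → j ≢ vtx D i → j ≢ vtx D (next (next i)) → x j ≡ 0ℚ
        off i j a ne ne′ with vtx D (next i) ≟ w
        ... | no ≢w = ⊥-elim (no-edge (deg2-edge D (next i , refl) (rest (next i , refl) ≢w) a))
          where
          no-edge : ¬ CycleEdge D (vtx D (next i)) j
          no-edge ce with cycleEdge-nbr D ce
          ... | inj₁ eq = ne eq
          ... | inj₂ eq = ne′ eq
        ... | yes refl with nbr a
        ...   | inj₁ refl = vanishes kx u (ins-old Z u∈)
        ...   | inj₂ ce with cycleEdge-nbr D ce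
        ...     | inj₁ eq = ⊥-elim (ne eq)
        ...     | inj₂ eq = ⊥-elim (ne′ eq)

  -- Exploring along the walk preserves tightness until the next vertex lies on `D`; the edge to it
  -- is the attaching one.
  reach-pendant : ∀ (D : Cycle Γ) Z → Tight Z → (∀ {d} → OnCycle D d → ¬ T (Z d)) → ∀ {a b} → T (Z a) → Reach Γ a b → OnCycle D b → Pendant D
  reach-pendant D Z tZ disj a∈ here b∈ = ⊥-elim (disj b∈ a∈)
  reach-pendant D Z tZ disj a∈ (step {w = w} aw rw) b∈ with onCycle? D w
  ... | yes w∈ = pendant-cycle Z tZ D disj a∈ w∈ aw
  ... | no w∉ = reach-pendant D (ins w Z) (slack-ins Z a∈ aw tZ) disj′ (ins-self Z) rw b∈
    where
    disj′ : ∀ {d} → OnCycle D d → ¬ T (ins w Z d)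
    disj′ d∈ p with ins-elim Z p
    ... | inj₁ refl = w∉ d∈
    ... | inj₂ z = disj d∈ z

  leaf⇒pendant : ∀ {v} → deg Γ v ≡ 1 → KerDimAtLeast (adjMat Γ) (suc (excess Γ)) → (D : Cycle Γ) → Pendant D
  leaf⇒pendant {v} d1 K D = reach-pendant D ⁅ v ⁆ (tight-leaf d1 K) disj (ins-self _) (conn v (vtx D zero)) (zero , refl)
    where
    disj : ∀ {d} → OnCycle D d → ¬ T (⁅ v ⁆ d)
    disj d∈ p with ins-elim (λ _ → false) p
    ... | inj₁ refl = ℕ.1+n≰n (subst (2 ≤_) d1 (onCycle⇒deg≥2 D d∈))

-- Walks and cycles

-- Index 0 is exempt from all conditions, since the walks in question start inside `B`.
record FirstHit {n} (B : Fin n → Set) (f : ℕ → Fin n) : Set where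
  field
    k        : ℕ
    1≤k      : 1 ≤ k
    avoids   : ∀ {i} → 1 ≤ i → i < k → ¬ B (f i)
    distinct : ∀ {i j} → 1 ≤ i → i < k → 1 ≤ j → j < k → f i ≡ f j → i ≡ j
    hit      : B (f k) ⊎ ∃ λ j → 1 ≤ j × j < k × f k ≡ f j

firstHit : ∀ {n} {B : Fin n → Set} → (∀ v → Dec (B v)) → (f : ℕ → Fin n) → FirstHit B f
firstHit {n} {B} B? f = go n 0 (ℕ.≤-reflexive (sym (ℕ.+-identityʳ n))) (λ { (s≤s _) () }) (λ { (s≤s _) () })
  where
  go : ∀ fuel m → n ≤ fuel + m → (∀ {i} → 1 ≤ i → i ≤ m → ¬ B (f i)) →
    (∀ {i j} → 1 ≤ i → i ≤ m → 1 ≤ j → j ≤ m → f i ≡ f j → i ≡ j) → FirstHit B f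
  go fuel m le av di with B? (f (suc m)) | any? (λ (j : Fin m) → f (suc m) ≟ f (suc (toℕ j)))
  ... | yes b | _ = record { k = suc m ; 1≤k = s≤s z≤n ; avoids = λ { 1≤i (s≤s i≤) → av 1≤i i≤ }
    ; distinct = λ { 1≤i (s≤s i≤) 1≤j (s≤s j≤) → di 1≤i i≤ 1≤j j≤ } ; hit = inj₁ b }
  ... | no _ | yes (j , eq) = record { k = suc m ; 1≤k = s≤s z≤n ; avoids = λ { 1≤i (s≤s i≤) → av 1≤i i≤ }
    ; distinct = λ { 1≤i (s≤s i≤) 1≤j (s≤s j≤) → di 1≤i i≤ 1≤j j≤ } ; hit = inj₂ (suc (toℕ j) , s≤s z≤n , s≤s (toℕ<n j) , eq) }
  ... | no ¬b | no none = continue fuel le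
    where
    av′ : ∀ {i} → 1 ≤ i → i ≤ suc m → ¬ B (f i)
    av′ 1≤i i≤ with ℕ.m≤n⇒m<n∨m≡n i≤
    ... | inj₁ (s≤s i≤m) = av 1≤i i≤m
    ... | inj₂ refl = ¬b
    new : ∀ {i} → 1 ≤ i → i ≤ m → f (suc m) ≢ f i
    new {suc i} _ i< eq = none (fromℕ< i< , trans eq (cong (λ t → f (suc t)) (sym (toℕ-fromℕ< i<))))
    di′ : ∀ {i j} → 1 ≤ i → i ≤ suc m → 1 ≤ j → j ≤ suc m → f i ≡ f j → i ≡ j
    di′ 1≤i i≤ 1≤j j≤ eq with ℕ.m≤n⇒m<n∨m≡n i≤ | ℕ.m≤n⇒m<n∨m≡n j≤
    ... | inj₁ (s≤s i≤m) | inj₁ (s≤s j≤m) = di 1≤i i≤m 1≤j j≤m eq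
    ... | inj₂ refl | inj₂ refl = refl
    ... | inj₁ (s≤s i≤m) | inj₂ refl = ⊥-elim (new 1≤i i≤m (sym eq))
    ... | inj₂ refl | inj₁ (s≤s j≤m) = ⊥-elim (new 1≤j j≤m eq)
    continue : ∀ fuel → n ≤ fuel + m → FirstHit B f
    continue (suc fuel) le = go fuel (suc m) (subst (n ≤_) (sym (ℕ.+-suc fuel m)) le) av′ di′
    -- With no fuel left, `suc m` distinct vertices would exceed `n`.
    continue zero le = ⊥-elim (ℕ.1+n≰n (ℕ.≤-trans (injective⇒≤ {f = λ (i : Fin (suc m)) → f (suc (toℕ i))}
      (λ {i} {j} eq → toℕ-injective (ℕ.suc-injective (di′ (s≤s z≤n) (toℕ<n i) (s≤s z≤n) (toℕ<n j) eq)))) le))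

module Walks {n} (Γ : SGraph n) (sg : IsSignedGraph Γ) (2≤deg : ∀ v → 2 ≤ deg Γ v) where

  open Basic Γ sg
  open Explore Γ sg
  open Cycles Γ sg

  abstract
    other : ∀ v a → ∃ λ j → Adj Γ v j × j ≢ a
    other v a with deg-∃∉ (a ∷ []) (2≤deg v)
    ... | j , vj , j∉ = j , vj , λ { refl → j∉ (here refl) }

  module _ (u y : Fin n) where
    private
      -- The current vertex and the following one; the vertex after these is chosen different from
      -- the current one, which is possible by the minimum degree.
      state : ℕ → Fin n × Fin n
      state zero = u , y
      state (suc k) = proj₂ (state k) , proj₁ (other (proj₂ (state k)) (proj₁ (state k)))

    stroll : ℕ → Fin n
    stroll k = proj₁ (state k)

    stroll-adj : Adj Γ u y → ∀ k → Adj Γ (stroll k) (stroll (suc k))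
    stroll-adj uy zero = uy
    stroll-adj uy (suc k) = proj₁ (proj₂ (other (proj₂ (state k)) (proj₁ (state k))))

    stroll-no-back : ∀ k → stroll k ≢ stroll (2 + k)
    stroll-no-back k eq = proj₂ (proj₂ (other (proj₂ (state k)) (proj₁ (state k)))) (sym eq)

  -- A closed segment has length at least 3: length 1 would be a loop, and length 2 a step back.
  loopSeq : ∀ {f : ℕ → Fin n} → (∀ k → Adj Γ (f k) (f (suc k))) → (∀ k → f k ≢ f (2 + k)) → ∀ {j k} → j < k → f k ≡ f j →
    (∀ {a b} → j ≤ a → a < k → j ≤ b → b < k → f a ≡ f b → a ≡ b) → ∃ λ m → j + (3 + m) ≡ k × CycSeq (λ i → f (j + i)) (3 + m)
  loopSeq {f} adj nb {j} {k} j<k eq di = size (k ∸ j) (ℕ.m+[n∸m]≡n (ℕ.<⇒≤ j<k))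
    where
    size : ∀ l → j + l ≡ k → ∃ λ m → j + (3 + m) ≡ k × CycSeq (λ i → f (j + i)) (3 + m)
    size 0 e = ⊥-elim (ℕ.<⇒≢ j<k (trans (sym (ℕ.+-identityʳ j)) e))
    size 1 e = ⊥-elim (adj-irrefl (adj j) (trans (sym eq) (cong f (trans (sym e) (ℕ.+-comm j 1)))))
    size 2 e = ⊥-elim (nb j (trans (sym eq) (cong f (trans (sym e) (ℕ.+-comm j 2)))))
    size (suc (suc (suc m))) e = m , e , record
      { inj-< = λ {a} {b} a< b< q → ℕ.+-cancelˡ-≡ j a b (di (ℕ.m≤m+n j a) (subst (j + a <_) e (ℕ.+-monoʳ-< j a<))
          (ℕ.m≤m+n j b) (subst (j + b <_) e (ℕ.+-monoʳ-< j b<)) q)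
      ; walk = λ i _ → subst (λ t → Adj Γ (f (j + i)) (f t)) (sym (ℕ.+-suc j i)) (adj (j + i))
      ; closes = trans (cong f e) (trans eq (cong f (sym (ℕ.+-identityʳ j)))) }

  min-deg-cycle : Fin n → Cycle Γ
  min-deg-cycle u = found (firstHit (λ v → v ≟ u) f)
    where
    start = other u u
    f = stroll u (proj₁ start)
    f-adj = stroll-adj u (proj₁ start) (proj₁ (proj₂ start))
    f-nb = stroll-no-back u (proj₁ start)
    found : FirstHit (_≡ u) f → Cycle Γ
    found h = from hit
      where
      open FirstHit h
      from : f k ≡ u ⊎ (∃ λ j → 1 ≤ j × j < k × f k ≡ f j) → Cycle Γ
      from (inj₁ eq) = seqCycle (proj₂ (proj₂ (loopSeq f-adj f-nb 1≤k eq di)))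
        where
        di : ∀ {a b} → 0 ≤ a → a < k → 0 ≤ b → b < k → f a ≡ f b → a ≡ b
        di {zero} {zero} _ _ _ _ _ = refl
        di {zero} {suc b} _ _ _ b< q = ⊥-elim (avoids (s≤s z≤n) b< (sym q))
        di {suc a} {zero} _ a< _ _ q = ⊥-elim (avoids (s≤s z≤n) a< q)
        di {suc a} {suc b} _ a< _ b< q = distinct (s≤s z≤n) a< (s≤s z≤n) b< q
      from (inj₂ (j , 1≤j , j<k , eq)) = seqCycle (proj₂ (proj₂ (loopSeq f-adj f-nb j<k eq
        (λ j≤a a< j≤b b< → distinct (ℕ.≤-trans 1≤j j≤a) a< (ℕ.≤-trans 1≤j j≤b) b<))))

-- Edge counts and the existence of cycles

mapCycle : ∀ {m n} {Γ : SGraph n} {f : Fin m → Fin n} → Injective _≡_ _≡_ f → Cycle (induced Γ f) → Cycle Γ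
mapCycle {f = f} f-inj C = record { len = len C ; vtx = λ i → f (vtx C i) ; inj = λ eq → inj C (f-inj eq) ; adj = adj C }

induced-signed : ∀ {m n} {Γ : SGraph n} (f : Fin m → Fin n) → IsSignedGraph Γ → IsSignedGraph (induced Γ f)
induced-signed f (s , i) = (λ u v → s (f u) (f v)) , λ u → i (f u)

sum-remove : ∀ {n} (i : Fin (suc n)) (f : Fin (suc n) → ℕ) → sumℕ f ≡ f i + sumℕ (λ j → f (punchIn i j))
sum-remove zero f = refl
sum-remove {suc n} (suc i) f = trans (cong (f zero +_) (sum-remove i (λ j → f (suc j))))
  (solve 3 (λ a b c → a :+ (b :+ c) := b :+ (a :+ c)) refl (f zero) (f (suc i)) _)
  where open ℕ-Solver

half-≤ : ∀ {a b} → a + a ≤ b + b → a ≤ b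
half-≤ {a} {b} le with a ℕ.≤? b
... | yes p = p
... | no np = ⊥-elim (ℕ.<⇒≱ (ℕ.+-mono-< (ℕ.≰⇒> np) (ℕ.≰⇒> np)) le)

half-≡ : ∀ {a b} → a + a ≡ b + b → a ≡ b
half-≡ eq = ℕ.≤-antisym (half-≤ (ℕ.≤-reflexive eq)) (half-≤ (ℕ.≤-reflexive (sym eq)))

numEdges-remove : ∀ {n} (Γ : SGraph (suc n)) → IsSignedGraph Γ → ∀ v → numEdges Γ ≡ deg Γ v + numEdges (induced Γ (punchIn v))
numEdges-remove {n} Γ sg v = half-≡ (begin
  numEdges Γ + numEdges Γ ≡⟨ sym (handshake Γ sg) ⟩
  sumℕ (deg Γ) ≡⟨ sum-remove v (deg Γ) ⟩
  deg Γ v + sumℕ (λ i → deg Γ (punchIn v i)) ≡⟨ cong (deg Γ v +_) (sum-cong split) ⟩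
  deg Γ v + sumℕ (λ i → ⟦ is-just (Γ v (punchIn v i)) ⟧ + deg Γ′ i) ≡⟨ cong (deg Γ v +_) (sum-+ (λ i → ⟦ is-just (Γ v (punchIn v i)) ⟧) (deg Γ′)) ⟩
  deg Γ v + (sumℕ (λ i → ⟦ is-just (Γ v (punchIn v i)) ⟧) + sumℕ (deg Γ′))
    ≡⟨ cong₂ (λ a b → deg Γ v + (a + b)) (sym deg-v) (handshake Γ′ (induced-signed (punchIn v) sg)) ⟩
  deg Γ v + (deg Γ v + (numEdges Γ′ + numEdges Γ′)) ≡⟨ solve 2 (λ d e → d :+ (d :+ (e :+ e)) := (d :+ e) :+ (d :+ e)) refl (deg Γ v) (numEdges Γ′) ⟩
  (deg Γ v + numEdges Γ′) + (deg Γ v + numEdges Γ′) ∎)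
  where
  open ≡-Reasoning
  open ℕ-Solver using (solve; _:+_; _:=_)
  Γ′ = induced Γ (punchIn v)
  deg-as-sum : ∀ w → deg Γ w ≡ ⟦ is-just (Γ w v) ⟧ + sumℕ (λ j → ⟦ is-just (Γ w (punchIn v j)) ⟧)
  deg-as-sum w = trans (count≡sum (λ j → is-just (Γ w j))) (sum-remove v (λ j → ⟦ is-just (Γ w j) ⟧))
  split : ∀ i → deg Γ (punchIn v i) ≡ ⟦ is-just (Γ v (punchIn v i)) ⟧ + deg Γ′ i
  split i = trans (deg-as-sum (punchIn v i)) (cong₂ _+_ (cong (λ e → ⟦ is-just e ⟧) (proj₁ sg (punchIn v i) v))
    (sym (count≡sum (λ j → is-just (Γ′ i j)))))
  deg-v : deg Γ v ≡ sumℕ (λ i → ⟦ is-just (Γ v (punchIn v i)) ⟧)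
  deg-v = trans (deg-as-sum v) (cong (λ e → ⟦ is-just e ⟧ + sumℕ (λ i → ⟦ is-just (Γ v (punchIn v i)) ⟧)) (proj₂ sg v))

-- Deleting a vertex of degree at most 1 removes at most one edge and so preserves `n ≤ numEdges Γ`.
-- When no such vertex is left, all degrees are at least 2 and a non-backtracking walk closes up.
n≤E⇒cycle : ∀ {n} (Γ : SGraph n) → IsSignedGraph Γ → Fin n → n ≤ numEdges Γ → Cycle Γ
n≤E⇒cycle {suc n} Γ sg _ = go n Γ sg
  where
  go : ∀ n (Γ : SGraph (suc n)) → IsSignedGraph Γ → suc n ≤ numEdges Γ → Cycle Γ
  go zero Γ sg ()
  go (suc n) Γ sg le = decide (any? (λ v → deg Γ v ℕ.≤? 1))
    where
    decide : Dec (∃ λ v → deg Γ v ≤ 1) → Cycle Γ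
    decide (yes (v , d≤1)) = mapCycle {Γ = Γ} (punchIn-injective v _ _) (go n (induced Γ (punchIn v)) (induced-signed (punchIn v) sg)
      (ℕ.≤-pred (ℕ.≤-trans le (ℕ.≤-trans (ℕ.≤-reflexive (numEdges-remove Γ sg v)) (ℕ.+-monoˡ-≤ _ d≤1)))))
    decide (no none) = Walks.min-deg-cycle Γ sg (λ v → ℕ.≰⇒> (λ le → none (v , le))) zero

module _ {n} (Γ : SGraph n) (sg : IsSignedGraph Γ) (conn : Connected Γ) where
  open Basic Γ sg
  open Explore Γ sg

  connected⇒n≤1+E : Fin n → n ≤ suc (numEdges Γ)
  connected⇒n≤1+E a = final (go (count (λ j → not (⁅ a ⁆ j))) ⁅ a ⁆ (ins-self _) ℕ.≤-refl)
    where
    -- The sum of `θ Z` is twice the number of edges with an end outside `Z`. Each insertion lowers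
    -- it by at least 2, once at `v` and once at `y`, so it bounds twice the number of missing
    -- vertices.
    θ : VSet → Fin n → ℕ
    θ Z v = if Z v then r Z v else deg Γ v
    θ-in : ∀ Z {v} → T (Z v) → θ Z v ≡ r Z v
    θ-in Z {v} p with Z v
    ... | true = refl
    θ-out : ∀ Z {v} → ¬ T (Z v) → θ Z v ≡ deg Γ v
    θ-out Z {v} np with Z v
    ... | false = refl
    ... | true = ⊥-elim (np tt)
    not-intro : ∀ {b} → ¬ T b → T (not b)
    not-intro {false} _ = tt
    not-intro {true} h = h tt
    not-elim : ∀ {b} → T (not b) → ¬ T b
    not-elim {false} _ ()
    missing : VSet → ℕ
    missing Z = count (λ j → not (Z j))
    go : ∀ m Z {a} → T (Z a) → missing Z ≤ m → missing Z + missing Z ≤ sumℕ (θ Z)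
    go m Z {a} a∈ le with any? (λ j → T? (not (Z j)))
    ... | no full = subst (λ t → t + t ≤ sumℕ (θ Z)) (sym (count-0 {P = λ j → not (Z j)} (λ j p → full (j , p)))) z≤n
    ... | yes (b , b∉) with boundary Z (conn a b) a∈ (not-elim b∉)
    ...   | v , y , v∈ , y∉ , vy = more m le
      where
      Z′ = ins y Z
      fewer : missing Z ≤ suc (missing Z′)
      fewer = subst (_≤ suc (missing Z′)) (sym (count-∖ (λ j → not (Z j)) (not-intro y∉)))
        (s≤s (count-mono {P = (λ j → not (Z j)) ∖ y} {λ j → not (Z′ j)} λ j p →
          let (q , j≢y) = ∖-elim (λ j → not (Z j)) p in not-intro (λ z → sort j≢y q (ins-elim Z z))))
        where
        sort : ∀ {j} → j ≢ y → T (not (Z j)) → j ≡ y ⊎ T (Z j) → ⊥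
        sort j≢y q (inj₁ eq) = j≢y eq
        sort j≢y q (inj₂ z) = not-elim q z
      fewer′ : missing Z′ < missing Z
      fewer′ = subst (suc (missing Z′) ≤_) (sym (count-∖ (λ j → not (Z j)) (not-intro y∉)))
        (s≤s (count-mono {P = λ j → not (Z′ j)} {(λ j → not (Z j)) ∖ y} λ j p →
          ∖-intro (λ j → not (Z j)) (not-intro (λ z → not-elim p (ins-old Z z))) (λ { refl → not-elim p (ins-self Z) })))
      θ-mono : ∀ j → θ Z′ j ≤ θ Z j
      θ-mono j with T? (Z j) | T? (Z′ j)
      ... | yes p | _ = ℕ.≤-trans (ℕ.≤-reflexive (θ-in Z′ (ins-old Z p))) (ℕ.≤-trans (r-ins≤ Z j) (ℕ.≤-reflexive (sym (θ-in Z p))))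
      ... | no np | no nq = ℕ.≤-reflexive (trans (θ-out Z′ nq) (sym (θ-out Z np)))
      ... | no np | yes q with ins-elim Z q
      ...   | inj₂ p = ⊥-elim (np p)
      ...   | inj₁ refl = ℕ.≤-trans (ℕ.≤-reflexive (θ-in Z′ q)) (ℕ.≤-trans (ℕ.<⇒≤ (r<deg Z′ (adj-sym vy) (ins-old Z v∈))) (ℕ.≤-reflexive (sym (θ-out Z np))))
      θ-v : θ Z′ v < θ Z v
      θ-v = subst (_< θ Z v) (sym (θ-in Z′ (ins-old Z v∈))) (subst (r Z′ v <_) (sym (θ-in Z v∈)) (r-ins< Z v vy y∉))
      θ-y : θ Z′ y < θ Z y
      θ-y = subst (_< θ Z y) (sym (θ-in Z′ (ins-self Z))) (subst (r Z′ y <_) (sym (θ-out Z y∉)) (r<deg Z′ (adj-sym vy) (ins-old Z v∈)))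
      more : ∀ m → missing Z ≤ m → missing Z + missing Z ≤ sumℕ (θ Z)
      more zero le = ⊥-elim (ℕ.n≮0 (ℕ.≤-trans fewer′ le))
      more (suc m) le = ℕ.≤-trans (ℕ.+-mono-≤ fewer fewer) (ℕ.≤-trans (ℕ.≤-reflexive (cong suc (ℕ.+-suc _ _)))
        (ℕ.≤-trans (s≤s (s≤s (go m Z′ (ins-self Z) (ℕ.≤-pred (ℕ.≤-trans fewer′ le)))))
          (sum-mono-at₂ (adj-irrefl vy) θ-mono θ-v θ-y)))
    final : missing ⁅ a ⁆ + missing ⁅ a ⁆ ≤ sumℕ (θ ⁅ a ⁆) → n ≤ suc (numEdges Γ)
    final le = ℕ.≤-trans n≤ (s≤s (half-≤ (ℕ.≤-trans le (ℕ.≤-trans (sum-mono θ≤deg) (ℕ.≤-reflexive (handshake Γ sg))))))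
      where
      θ≤deg : ∀ j → θ ⁅ a ⁆ j ≤ deg Γ j
      θ≤deg j with T? (⁅ a ⁆ j)
      ... | yes p = ℕ.≤-trans (ℕ.≤-reflexive (θ-in ⁅ a ⁆ p)) (count-mono {P = outside ⁅ a ⁆ j} (λ i q → proj₁ (outside-elim ⁅ a ⁆ q)))
      ... | no np = ℕ.≤-reflexive (θ-out ⁅ a ⁆ np)
      n≤ : n ≤ suc (missing ⁅ a ⁆)
      n≤ = subst (_≤ suc (missing ⁅ a ⁆)) total (ℕ.≤-trans (ℕ.≤-reflexive (count-∖ (λ (j : Fin n) → true) {a} tt))
        (s≤s (count-mono {P = (λ j → true) ∖ a} {λ j → not (⁅ a ⁆ j)} λ j p →
          not-intro (λ z → sort (proj₂ (∖-elim (λ _ → true) {a} p)) (ins-elim (λ _ → false) z)))))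
        where
        sort : ∀ {j} → j ≢ a → j ≡ a ⊎ T false → ⊥
        sort ne (inj₁ eq) = ne eq
        total : count {n} (λ _ → true) ≡ n
        total = trans (count≡sum {n} (λ _ → true)) (trans (sum-const n 1) (ℕ.*-identityʳ n))

-- Removing a pendant cycle

subspace-combination : ∀ {n} {P : (Fin n → ℚ) → Set} → Subspace P → ∀ {k} (vs : Fin (suc k) → Fin n → ℚ) → (∀ i → P (vs i)) →
  ∀ (c : Fin (suc k) → ℚ) → ∃ λ X → P X × (∀ j → X j ≡ ∑ (λ i → c i *ℚ vs i j))
-- A scalar multiple is obtained from the closure as `c x = x + (c − 1) x`.
subspace-combination S {zero} vs p c = _ , closed S (c zero +ℚ - 1ℚ) (p zero) (p zero) , λ j →
  trans (solve 2 (λ x c → x :+ (c :+ (:- con 1ℚ)) :* x := c :* x) refl (vs zero j) (c zero)) (sym (ℚ.+-identityʳ _))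
  where open ℚ-Solver
subspace-combination S {suc k} vs p c =
  let (X , pX , eq) = subspace-combination S (λ i → vs (suc i)) (λ i → p (suc i)) (λ i → c (suc i)) in
  _ , closed S (c zero) pX (p zero) , λ j → trans (cong (_+ℚ c zero *ℚ vs zero j) (eq j)) (ℚ.+-comm _ (c zero *ℚ vs zero j))

-- Restriction to the image of `f` is injective on `P`, by the hypothesis on vectors that vanish
-- there. Since this speaks of members of `P` only, a relation between restrictions is first lifted
-- to a combination inside `P`.
dim-restrict : ∀ {m n} {P : (Fin n → ℚ) → Set} {Q : (Fin m → ℚ) → Set} (f : Fin m → Fin n) → Subspace P →
  (∀ x → P x → Q (λ i → x (f i))) → (∀ x → P x → (∀ i → x (f i) ≡ 0ℚ) → ∀ j → x j ≡ 0ℚ) → ∀ {k} → DimAtLeast P k → DimAtLeast Q k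
dim-restrict f S h h0 {zero} D = dim-0
dim-restrict {P = P} f S h h0 {suc k} (basis vs ind p) = basis (λ i j → vs i (f j)) ind′ (λ i → h _ (p i))
  where
  ind′ : LinIndep (λ i j → vs i (f j))
  ind′ c eq = ind c (vanish (subspace-combination S vs p c))
    where
    vanish : (∃ λ X → P X × (∀ j → X j ≡ ∑ (λ i → c i *ℚ vs i j))) → ∀ j → ∑ (λ i → c i *ℚ vs i j) ≡ 0ℚ
    vanish (X , pX , X≡) j = trans (sym (X≡ j)) (h0 X pX (λ i → trans (X≡ (f i)) (eq i)) j)

-- `Form1` with the number of cycles as a parameter, because the induction that removes cycles
-- changes it. `toForm1` obtains the inequality between leaves and cycles from the injection `leaf`.
record TreeWithCycles {n} (k : ℕ) (Γ : SGraph n) : Set where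
  field
    m         : ℕ
    f         : Fin m → Fin n
    C         : Fin k → Cycle Γ
    leaf      : Fin k → Fin m
    f-inj     : Injective _≡_ _≡_ f
    tree      : IsTree (induced Γ f)
    nullity   : η≡ (induced Γ f) (pendant (induced Γ f) ∸ 1)
    leaf-inj  : Injective _≡_ _≡_ leaf
    leaf-deg  : ∀ a → deg (induced Γ f) (leaf a) ≡ 1
    disjoint  : ∀ a b → a ≢ b → ∀ i j → vtx (C a) i ≢ vtx (C b) j
    on-leaf   : ∀ a → OnCycle (C a) (f (leaf a))
    only-leaf : ∀ a i → OnCycle (C a) (f i) → i ≡ leaf a
    C-nullity : ∀ a → cycleNullity≡ (C a) 2
    cover     : ∀ u → (∃ λ i → f i ≡ u) ⊎ (∃ λ a → OnCycle (C a) u)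
    edges     : ∀ u v → Adj Γ u v → (∃ λ i → ∃ λ j → f i ≡ u × f j ≡ v) ⊎ (∃ λ a → CycleEdge (C a) u v)

toForm1 : ∀ {n} {Γ : SGraph n} → TreeWithCycles (cyc Γ) Γ → Form1 Γ
toForm1 {Γ = Γ} F = m , f , C , leaf , f-inj , tree , nullity ,
  injection≤count {P = λ v → deg (induced Γ f) v ≡ᵇ 1} {leaf} leaf-inj (λ a → ℕ.≡⇒≡ᵇ _ 1 (leaf-deg a)) ,
  leaf-inj , leaf-deg , disjoint , on-leaf , only-leaf , C-nullity , cover , edges
  where open TreeWithCycles F

module RemovePendant {n} (Γ : SGraph n) (sg : IsSignedGraph Γ) (conn : Connected Γ) (D : Cycle Γ)
  (P : Structure.Pendant Γ sg conn D) where

  open Basic Γ sg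
  open Explore Γ sg
  open Cycles Γ sg
  open Structure Γ sg conn
  open Pendant P

  -- The vertices to be deleted. The vertex `w` stays behind and becomes a leaf of the smaller
  -- graph.
  Body : Fin n → Set
  Body v = OnCycle D v × v ≢ w

  body-edge : ∀ {v j} → Body v → Adj Γ v j → CycleEdge D v j
  body-edge (v∈ , v≢w) vj = deg2-edge D v∈ (deg-rest v∈ v≢w) vj

  body-nbr : ∀ {v j} → Body v → Adj Γ v j → OnCycle D j
  body-nbr b vj = proj₂ (CycleEdge-on D (body-edge b vj))

  off-cycle-nbr : ∀ i j → Adj Γ (vtx D (next i)) j → j ≢ vtx D i → j ≢ vtx D (next (next i)) → j ≡ u
  off-cycle-nbr i j a ne ne′ with vtx D (next i) ≟ w
  ... | no ≢w = ⊥-elim (no-edge (body-edge ((next i , refl) , ≢w) a))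
    where
    no-edge : ¬ CycleEdge D (vtx D (next i)) j
    no-edge ce with cycleEdge-nbr D ce
    ... | inj₁ eq = ne eq
    ... | inj₂ eq = ne′ eq
  ... | yes refl with w-nbr a
  ...   | inj₁ j≡u = j≡u
  ...   | inj₂ ce with cycleEdge-nbr D ce
  ...     | inj₁ eq = ⊥-elim (ne eq)
  ...     | inj₂ eq = ⊥-elim (ne′ eq)

  -- Pairing a kernel vector x of Γ with a kernel vector y of D with y w ≠ 0 leaves only the term at u.
  kernel-u : ∀ {x} → Ker (adjMat Γ) x → x u ≡ 0ℚ
  kernel-u {x} kx = go (kernel-10 D (proj₁ null) (proj₁ w∈))
    where
    go : (∃ λ z → Tri D z × z (next (proj₁ w∈)) ≡ 0ℚ × z (proj₁ w∈) ≡ 1ℚ) → x u ≡ 0ℚ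
    go (z , tri , _ , zw) = *-≢0 (A≢0 (adj-sym wu)) (trans (sym x-row-u) pairing)
      where
      open ≡-Reasoning
      y = ext D z
      y-w : y w ≡ 1ℚ
      y-w = trans (cong y (sym (proj₂ w∈))) (trans (ext-vtx D z (proj₁ w∈)) zw)
      row-on : ∀ {j} → OnCycle D j → row j y ≡ 0ℚ
      row-on {j} (i , refl) = subst (λ t → row (vtx D t) y ≡ 0ℚ) (next-prev i)
        (Tri⇒row D (ext-Tri D tri) (prev i) (λ j a ne ne′ → trans (cong y (off-cycle-nbr (prev i) j a ne ne′)) (ext-off D z u∉)))
      row-off : ∀ {j} → ¬ OnCycle D j → j ≢ u → row j y ≡ 0ℚ
      row-off {j} j∉ j≢u = row-0 y λ i ji → ext-off D z (λ i∈ → no-nbr i ji i∈)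
        where
        no-nbr : ∀ i → Adj Γ j i → ¬ OnCycle D i
        no-nbr i ji i∈ with i ≟ w
        ... | no i≢w = j∉ (body-nbr (i∈ , i≢w) (adj-sym ji))
        ... | yes refl with w-nbr (adj-sym ji)
        ...   | inj₁ eq = j≢u eq
        ...   | inj₂ ce = j∉ (proj₂ (CycleEdge-on D ce))
      row-j : ∀ j → j ≢ u → x j *ℚ row j y ≡ 0ℚ
      row-j j j≢u with onCycle? D j
      ... | yes j∈ = trans (cong (x j *ℚ_) (row-on j∈)) (ℚ.*-zeroʳ (x j))
      ... | no j∉ = trans (cong (x j *ℚ_) (row-off j∉ j≢u)) (ℚ.*-zeroʳ (x j))
      x-row-u : ∑ (λ j → x j *ℚ row j y) ≡ adjMat Γ u w *ℚ x u
      x-row-u = begin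
        ∑ (λ j → x j *ℚ row j y) ≡⟨ ∑-single (λ j → x j *ℚ row j y) u row-j ⟩
        x u *ℚ row u y ≡⟨ cong (x u *ℚ_) (row-single y (λ j uj j≢w → ext-off D z (λ j∈ → u∉ (body-nbr (j∈ , j≢w) (adj-sym uj))))) ⟩
        x u *ℚ (adjMat Γ u w *ℚ y w) ≡⟨ cong (λ t → x u *ℚ (adjMat Γ u w *ℚ t)) y-w ⟩
        x u *ℚ (adjMat Γ u w *ℚ 1ℚ) ≡⟨ cong (x u *ℚ_) (ℚ.*-identityʳ (adjMat Γ u w)) ⟩
        x u *ℚ adjMat Γ u w ≡⟨ ℚ.*-comm (x u) (adjMat Γ u w) ⟩
        adjMat Γ u w *ℚ x u ∎
      pairing : ∑ (λ j → x j *ℚ row j y) ≡ 0ℚ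
      pairing = begin
        ∑ (λ j → x j *ℚ row j y) ≡⟨ ∑-cong (λ j → sym (∑-*ˡ (x j) (λ i → adjMat Γ j i *ℚ y i))) ⟩
        ∑ (λ j → ∑ (λ i → x j *ℚ (adjMat Γ j i *ℚ y i))) ≡⟨ ∑-swap (λ j i → x j *ℚ (adjMat Γ j i *ℚ y i)) ⟩
        ∑ (λ i → ∑ (λ j → x j *ℚ (adjMat Γ j i *ℚ y i))) ≡⟨ ∑-cong (λ i → trans (∑-cong (swap i)) (∑-*ˡ (y i) (λ j → adjMat Γ i j *ℚ x j))) ⟩
        ∑ (λ i → y i *ℚ row i x) ≡⟨ ∑-0 (λ i → trans (cong (y i *ℚ_) (rows kx i)) (ℚ.*-zeroʳ (y i))) ⟩
        0ℚ ∎
        where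
        swap : ∀ i j → x j *ℚ (adjMat Γ j i *ℚ y i) ≡ y i *ℚ (adjMat Γ i j *ℚ x j)
        swap i j = trans (cong (λ a → x j *ℚ (a *ℚ y i)) (A-sym j i))
          (solve 3 (λ x a y → x :* (a :* y) := y :* (a :* x)) refl (x j) (adjMat Γ i j) (y i))
          where open ℚ-Solver

  abstract
    body? : ∀ v → Dec (Body v)
    body? v with onCycle? D v | v ≟ w
    ... | no v∉ | _ = no (λ b → v∉ (proj₁ b))
    ... | yes _ | yes v≡w = no (λ b → proj₂ b v≡w)
    ... | yes v∈ | no v≢w = yes (v∈ , v≢w)

  keep : VSet
  keep v = not (does (body? v))

  keep-intro : ∀ {v} → ¬ Body v → T (keep v)
  keep-intro {v} nb with body? v
  ... | yes b = nb b
  ... | no _ = tt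

  keep-elim : ∀ {v} → T (keep v) → ¬ Body v
  keep-elim {v} p b with body? v
  ... | no nb = nb b

  abstract
    kept : Enumeration keep
    kept = enumerate keep

  open Enumeration kept public renaming (size to n′; elt to f; elt-inj to f-inj)

  Γ′ : SGraph n′
  Γ′ = induced Γ f

  sg′ : IsSignedGraph Γ′
  sg′ = induced-signed f sg

  module B′ = Basic Γ′ sg′

  f-kept : ∀ i → ¬ Body (f i)
  f-kept i = keep-elim (elt-T i)

  index : ∀ {v} → ¬ Body v → ∃ λ i → f i ≡ v
  index nb = elt-index (keep-intro nb)

  w′ u′ : Fin n′
  w′ = proj₁ (index {w} (λ b → proj₂ b refl))
  u′ = proj₁ (index {u} (λ b → u∉ (proj₁ b)))

  f-w′ : f w′ ≡ w
  f-w′ = proj₂ (index {w} (λ b → proj₂ b refl))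

  f-u′ : f u′ ≡ u
  f-u′ = proj₂ (index {u} (λ b → u∉ (proj₁ b)))

  f-on : ∀ i → OnCycle D (f i) → i ≡ w′
  f-on i i∈ with f i ≟ w
  ... | yes eq = f-inj (trans eq (sym f-w′))
  ... | no ne = ⊥-elim (f-kept i (i∈ , ne))

  kept-nbr : ∀ {i j} → i ≢ w′ → Adj Γ (f i) j → ¬ Body j
  kept-nbr {i} i≢ a b = i≢ (f-on i (body-nbr b (adj-sym a)))

  w′-nbr : ∀ {j} → Adj Γ′ w′ j → j ≡ u′
  w′-nbr {j} a with w-nbr (subst (λ t → Adj Γ t (f j)) f-w′ a)
  ... | inj₁ eq = f-inj (trans eq (sym f-u′))
  ... | inj₂ ce = ⊥-elim (B′.adj-irrefl a (sym (f-on j (proj₂ (CycleEdge-on D ce)))))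

  w′u′ : Adj Γ′ w′ u′
  w′u′ = subst (λ s → Adj Γ s (f u′)) (sym f-w′) (subst (Adj Γ w) (sym f-u′) wu)

  deg-w′ : deg Γ′ w′ ≡ 1
  deg-w′ = ℕ.≤-antisym (B′.deg≤ (u′ ∷ []) (λ j a → here (w′-nbr a))) (B′.deg≥1 w′u′)

  deg-kept : ∀ i → i ≢ w′ → deg Γ′ i ≡ deg Γ (f i)
  deg-kept i i≢ = trans (count≡sum (λ j → is-just (Γ′ i j))) (trans
    (sum-image f f-inj (λ v → ⟦ is-just (Γ (f i) v) ⟧) off) (sym (count≡sum (λ v → is-just (Γ (f i) v)))))
    where
    off : ∀ v → (∀ j → f j ≢ v) → ⟦ is-just (Γ (f i) v) ⟧ ≡ 0
    off v h with is-just (Γ (f i) v) in eq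
    ... | false = refl
    ... | true = ⊥-elim (let (j , e) = index (kept-nbr i≢ (subst T (sym eq) tt)) in h j e)

  body⇔off : ∀ {v} → (∀ j → f j ≢ v) → Body v
  body⇔off {v} h with body? v
  ... | yes b = b
  ... | no nb = ⊥-elim (let (j , e) = index nb in h j e)

  -- The vertex `w` drops from degree 3 to degree 1 and so contributes one less; the deleted
  -- vertices had degree 2 and contributed 0.
  excess-remove : excess Γ ≡ suc (excess Γ′)
  excess-remove = begin
    excess Γ ≡⟨ sum-cong split ⟩
    sumℕ (λ v → δ w v + g v) ≡⟨ sum-+ (δ w) g ⟩
    sumℕ (δ w) + sumℕ g ≡⟨ cong₂ _+_ (sum-δ w) (sym (sum-image f f-inj g off)) ⟩
    suc (sumℕ (λ i → g (f i))) ≡⟨ cong suc (sum-cong at) ⟩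
    suc (excess Γ′) ∎
    where
    open ≡-Reasoning
    g : Fin n → ℕ
    g v = (deg Γ v ∸ 2) ∸ δ w v
    split : ∀ v → deg Γ v ∸ 2 ≡ δ w v + g v
    split v with v ≟ w
    ... | yes refl rewrite deg-w = refl
    ... | no _ = refl
    off : ∀ v → (∀ j → f j ≢ v) → g v ≡ 0
    off v h with body⇔off h
    ... | v∈ , v≢w rewrite deg-rest v∈ v≢w = ℕ.0∸n≡0 (δ w v)
    at : ∀ i → g (f i) ≡ deg Γ′ i ∸ 2
    at i with i ≟ w′
    ... | yes refl = trans (cong g f-w′) (trans (cong₂ (λ d e → (d ∸ 2) ∸ e) deg-w (δ-refl w)) (sym (cong (_∸ 2) deg-w′)))
    ... | no i≢ = cong₂ (λ d e → (d ∸ 2) ∸ e) (sym (deg-kept i i≢)) (δ-≢ {a = w} {f i} (λ eq → i≢ (f-inj (trans eq (sym f-w′)))))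

  removed : ℕ
  removed = count (λ v → does (body? v))

  n-split : n ≡ n′ + removed
  n-split = begin
    n ≡⟨ sym (ℕ.*-identityʳ n) ⟩
    n * 1 ≡⟨ sym (sum-const n 1) ⟩
    sumℕ {n} (λ _ → 1) ≡⟨ sum-cong (λ v → one (does (body? v))) ⟩
    sumℕ (λ v → ⟦ keep v ⟧ + ⟦ does (body? v) ⟧) ≡⟨ sum-+ (λ v → ⟦ keep v ⟧) _ ⟩
    sumℕ (λ v → ⟦ keep v ⟧) + sumℕ (λ v → ⟦ does (body? v) ⟧)
      ≡⟨ cong₂ _+_ (trans (sym (count≡sum keep)) (sym size≡)) (sym (count≡sum (λ v → does (body? v)))) ⟩
    n′ + removed ∎
    where
    open ≡-Reasoning
    one : ∀ b → 1 ≡ ⟦ not b ⟧ + ⟦ b ⟧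
    one true = refl
    one false = refl

  removed>0 : 1 ≤ removed
  removed>0 = injection≤count {P = λ v → does (body? v)} {λ (_ : Fin 1) → q} (λ { {zero} {zero} _ → refl }) (λ _ → qT)
    where
    q = vtx D (next (proj₁ w∈))
    q-body : Body q
    q-body = (next (proj₁ w∈) , refl) , λ eq → next≢ (proj₁ w∈) (inj D (trans eq (sym (proj₂ w∈))))
    qT : T (does (body? q))
    qT with body? q
    ... | yes _ = tt
    ... | no nb = ⊥-elim (nb q-body)

  n′<n : n′ < n
  n′<n = subst (suc n′ ≤_) (sym n-split) (subst (_≤ n′ + removed) (ℕ.+-comm n′ 1) (ℕ.+-monoʳ-≤ n′ removed>0))

  -- `D` has one edge more than it has deleted vertices. In terms of degrees, `w` loses 2 and every
  -- deleted vertex takes away 2 of its own, in all twice `removed + 1`.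
  numEdges-split : numEdges Γ ≡ suc (numEdges Γ′ + removed)
  numEdges-split = half-≡ (begin
    E + E ≡⟨ sym (handshake Γ sg) ⟩
    sumℕ (deg Γ) ≡⟨ sum-cong split ⟩
    sumℕ (λ v → (δ w v + δ w v) + ((b v + b v) + g v)) ≡⟨ sum-+ (λ v → δ w v + δ w v) _ ⟩
    sumℕ (λ v → δ w v + δ w v) + sumℕ (λ v → (b v + b v) + g v) ≡⟨ cong₂ _+_ (double (δ w)) (trans (sum-+ (λ v → b v + b v) g) (cong (_+ sumℕ g) (double b))) ⟩
    (sumℕ (δ w) + sumℕ (δ w)) + ((sumℕ b + sumℕ b) + sumℕ g)
      ≡⟨ cong₂ (λ s t → (s + s) + ((t + t) + sumℕ g)) (sum-δ w) (sym (count≡sum (λ v → does (body? v)))) ⟩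
    2 + ((removed + removed) + sumℕ g) ≡⟨ cong (λ t → 2 + ((removed + removed) + t)) (trans (sym (sum-image f f-inj g off)) (trans (sum-cong at) (handshake Γ′ sg′))) ⟩
    2 + ((removed + removed) + (E′ + E′))
      ≡⟨ solve 2 (λ r e → con 2 :+ ((r :+ r) :+ (e :+ e)) := (con 1 :+ (e :+ r)) :+ (con 1 :+ (e :+ r))) refl removed E′ ⟩
    suc (E′ + removed) + suc (E′ + removed) ∎)
    where
    open ≡-Reasoning
    open ℕ-Solver using (solve; _:+_; _:=_; con)
    E = numEdges Γ
    E′ = numEdges Γ′
    b g : Fin n → ℕ
    b v = ⟦ does (body? v) ⟧
    g v = if does (body? v) then 0 else deg Γ v ∸ (δ w v + δ w v)
    double : (h : Fin n → ℕ) → sumℕ (λ v → h v + h v) ≡ sumℕ h + sumℕ h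
    double h = sum-+ h h
    split : ∀ v → deg Γ v ≡ (δ w v + δ w v) + ((b v + b v) + g v)
    split v with body? v
    ... | yes (v∈ , v≢w) rewrite deg-rest v∈ v≢w | δ-≢ {a = w} v≢w = refl
    ... | no nb with v ≟ w
    ...   | yes refl rewrite deg-w = refl
    ...   | no _ = refl
    off : ∀ v → (∀ j → f j ≢ v) → g v ≡ 0
    off v h with body? v
    ... | yes _ = refl
    ... | no nb = ⊥-elim (nb (body⇔off h))
    at : ∀ i → g (f i) ≡ deg Γ′ i
    at i = trans g-f (at′ (i ≟ w′))
      where
      g-f : g (f i) ≡ deg Γ (f i) ∸ (δ w (f i) + δ w (f i))
      g-f with body? (f i)
      ... | yes bd = ⊥-elim (f-kept i bd)
      ... | no _ = refl
      at′ : Dec (i ≡ w′) → deg Γ (f i) ∸ (δ w (f i) + δ w (f i)) ≡ deg Γ′ i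
      at′ (yes refl) = trans (cong (λ v → deg Γ v ∸ (δ w v + δ w v)) f-w′)
        (trans (cong₂ (λ d e → d ∸ (e + e)) deg-w (δ-refl w)) (sym deg-w′))
      at′ (no i≢) = cong₂ (λ d e → d ∸ (e + e)) (sym (deg-kept i i≢)) (δ-≢ {a = w} {f i} (λ eq → i≢ (f-inj (trans eq (sym f-w′)))))

  cyclomatic-step : ∀ {k} → n′ + k ≡ numEdges Γ′ + 1 → n + suc k ≡ numEdges Γ + 1
  cyclomatic-step {k} eq = begin
    n + suc k ≡⟨ cong (_+ suc k) n-split ⟩
    n′ + removed + suc k ≡⟨ solve 3 (λ a b c → a :+ b :+ (con 1 :+ c) := (a :+ c) :+ (con 1 :+ b)) refl n′ removed k ⟩
    (n′ + k) + suc removed ≡⟨ cong (_+ suc removed) eq ⟩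
    (numEdges Γ′ + 1) + suc removed
      ≡⟨ solve 2 (λ a b → (a :+ con 1) :+ (con 1 :+ b) := (con 1 :+ (a :+ b)) :+ con 1) refl (numEdges Γ′) removed ⟩
    suc (numEdges Γ′ + removed) + 1 ≡⟨ cong (_+ 1) (sym numEdges-split) ⟩
    numEdges Γ + 1 ∎
    where
    open ≡-Reasoning
    open ℕ-Solver using (solve; _:+_; _:=_; con)

  conn′ : Connected Γ′
  conn′ a b = walk (conn (f a) (f b)) (at (f-kept a) refl) (at (f-kept b) refl)
    where
    -- Collapsing the cycle to w turns walks of Γ into walks of Γ′.
    Collapse : Fin n → Fin n′ → Set
    Collapse v i = (¬ Body v × f i ≡ v) ⊎ (Body v × i ≡ w′)
    at : ∀ {v i} → ¬ Body v → f i ≡ v → Collapse v i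
    at nb eq = inj₁ (nb , eq)
    total : ∀ v → ∃ λ i → Collapse v i
    total v with body? v
    ... | yes b = w′ , inj₂ (b , refl)
    ... | no nb = proj₁ (index nb) , inj₁ (nb , proj₂ (index nb))
    unique : ∀ {v i j} → Collapse v i → Collapse v j → i ≡ j
    unique (inj₁ (_ , p)) (inj₁ (_ , q)) = f-inj (trans p (sym q))
    unique (inj₂ (_ , p)) (inj₂ (_ , q)) = trans p (sym q)
    unique (inj₁ (nb , _)) (inj₂ (b , _)) = ⊥-elim (nb b)
    unique (inj₂ (b , _)) (inj₁ (nb , _)) = ⊥-elim (nb b)
    to-w : ∀ {v i} → OnCycle D v → Collapse v i → i ≡ w′
    to-w v∈ (inj₂ (_ , p)) = p
    to-w v∈ (inj₁ (nb , refl)) = f-on _ v∈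
    move : ∀ {v x i j} → Adj Γ v x → Collapse v i → Collapse x j → i ≡ j ⊎ Adj Γ′ i j
    move vx (inj₁ (_ , refl)) (inj₁ (_ , refl)) = inj₂ vx
    move vx (inj₂ (b , p)) c = inj₁ (trans p (sym (to-w (body-nbr b vx) c)))
    move vx c (inj₂ (b , p)) = inj₁ (trans (to-w (body-nbr b (adj-sym vx)) c) (sym p))
    walk : ∀ {v x i j} → Reach Γ v x → Collapse v i → Collapse x j → Reach Γ′ i j
    walk here ci cj with unique ci cj
    ... | refl = here
    walk (step {w = y} vy ry) ci cj with move vy ci (proj₂ (total y))
    ... | inj₁ refl = walk ry (proj₂ (total y)) cj
    ... | inj₂ a = step a (walk ry (proj₂ (total y)) cj)

  -- One dimension is spent on vanishing at `q`, a neighbour of `w` on `D`, and `excess` drops by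
  -- one as well. A kernel vector restricts to one of `Γ′`, since `kernel-u` settles the equation at
  -- the new leaf. It is determined by its restriction, because zeros at `w` and `q` spread over
  -- `D`.
  dim-remove : KerDimAtLeast (adjMat Γ) (suc (excess Γ)) → KerDimAtLeast (adjMat Γ′) (suc (excess Γ′))
  dim-remove dim = toKer (adjMat Γ′) (subst (DimAtLeast (Ker (adjMat Γ′))) excess-remove
    (dim-restrict f (∩0-subspace q (Ker-subspace (adjMat Γ))) restrict faithful
      (dim-drop (Ker-subspace (adjMat Γ)) (fromKer (adjMat Γ) dim) q)))
    where
    i₀ = proj₁ w∈
    q = vtx D (next i₀)
    restrict : ∀ x → Ker (adjMat Γ) x × x q ≡ 0ℚ → Ker (adjMat Γ′) (λ i → x (f i))
    restrict x (kx , _) = ker λ i → at i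
      where
      at : ∀ i → rowOf (adjMat Γ′) (λ j → x (f j)) i ≡ 0ℚ
      at i with i ≟ w′
      ... | yes refl = B′.row-0 (λ j → x (f j)) (λ j a → trans (cong x (trans (cong f (w′-nbr a)) f-u′)) (kernel-u kx))
      ... | no i≢ = trans (∑-image f f-inj (λ v → adjMat Γ (f i) v *ℚ x v) off) (rows kx (f i))
        where
        off : ∀ v → (∀ j → f j ≢ v) → adjMat Γ (f i) v *ℚ x v ≡ 0ℚ
        off v h = trans (cong (_*ℚ x v) (A-nonadj (λ a → kept-nbr i≢ a (body⇔off h)))) (ℚ.*-zeroˡ (x v))
    faithful : ∀ x → Ker (adjMat Γ) x × x q ≡ 0ℚ → (∀ i → x (f i) ≡ 0ℚ) → ∀ j → x j ≡ 0ℚ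
    faithful x (kx , xq) z j with body? j
    ... | no nb = let (i , eq) = index nb in trans (cong x (sym eq)) (z i)
    ... | yes ((i , refl) , _) = Tri-force D (kernel⇒Tri-restrict D kx (λ i j a ne ne′ → trans (cong x (off-cycle-nbr i j a ne ne′)) (kernel-u kx)))
      i₀ (trans (cong x (trans (proj₂ w∈) (sym f-w′))) (z w′)) xq i

  -- As a leaf of `Γ′`, the vertex `w′` lies on no cycle. It therefore belongs to the tree and is
  -- none of the earlier attachment leaves, so that `D` can be attached there.
  attach : ∀ {k} → TreeWithCycles k Γ′ → TreeWithCycles (suc k) Γ
  attach {k} F = record
    { m = m ; f = g ; C = C₊ ; leaf = leaf₊ ; f-inj = λ eq → f-inj′ (f-inj eq) ; tree = tree ; nullity = nullity
    ; leaf-inj = leaf-inj₊ ; leaf-deg = leaf-deg₊ ; disjoint = disjoint₊ ; on-leaf = on-leaf₊ ; only-leaf = only-leaf₊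
    ; C-nullity = λ { zero → null ; (suc a) → C-nullity a } ; cover = cover₊ ; edges = edges₊ }
    where
    open TreeWithCycles F renaming (f to f′; f-inj to f-inj′)
    module C′ = Cycles Γ′ sg′
    g : Fin m → Fin n
    g i = f (f′ i)
    w′-off : ∀ a → ¬ OnCycle (C a) w′
    w′-off a c = ℕ.1+n≰n (subst (2 ≤_) deg-w′ (C′.onCycle⇒deg≥2 (C a) c))
    tree-w : ∃ λ i → f′ i ≡ w′
    tree-w with cover w′
    ... | inj₁ i = i
    ... | inj₂ (a , c) = ⊥-elim (w′-off a c)
    i-w = proj₁ tree-w
    tree-edge : ∃ λ j → f′ j ≡ u′ × Adj Γ′ (f′ i-w) (f′ j)
    tree-edge with edges w′ u′ w′u′
    ... | inj₁ (i , j , p , q) = j , q , subst (λ t → Adj Γ′ t (f′ j)) (sym (proj₂ tree-w)) (subst (Adj Γ′ w′) (sym q) w′u′)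
    ... | inj₂ (a , ce) = ⊥-elim (w′-off a (proj₁ (C′.CycleEdge-on (C a) ce)))
    C₊ : Fin (suc k) → Cycle Γ
    C₊ zero = D
    C₊ (suc a) = mapCycle {Γ = Γ} f-inj (C a)
    leaf₊ : Fin (suc k) → Fin m
    leaf₊ zero = i-w
    leaf₊ (suc a) = leaf a
    w≢leaf : ∀ a → i-w ≢ leaf a
    w≢leaf a eq = w′-off a (subst (OnCycle (C a)) (trans (cong f′ (sym eq)) (proj₂ tree-w)) (on-leaf a))
    leaf-inj₊ : Injective _≡_ _≡_ leaf₊
    leaf-inj₊ {zero} {zero} _ = refl
    leaf-inj₊ {zero} {suc b} eq = ⊥-elim (w≢leaf b eq)
    leaf-inj₊ {suc a} {zero} eq = ⊥-elim (w≢leaf a (sym eq))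
    leaf-inj₊ {suc a} {suc b} eq = cong suc (leaf-inj eq)
    module BT = Basic (induced Γ g) (induced-signed g sg)
    leaf-deg₊ : ∀ a → deg (induced Γ g) (leaf₊ a) ≡ 1
    leaf-deg₊ (suc a) = leaf-deg a
    leaf-deg₊ zero = ℕ.≤-antisym (BT.deg≤ (proj₁ tree-edge ∷ []) (λ j a → here (f-inj′ (trans (w′-nbr (subst (λ t → Adj Γ′ t (f′ j)) (proj₂ tree-w) a)) (sym (proj₁ (proj₂ tree-edge)))))))
      (BT.deg≥1 (proj₂ (proj₂ tree-edge)))
    D-disjoint : ∀ a i j → vtx D i ≢ f (vtx (C a) j)
    D-disjoint a i j eq = w′-off a (j , f-on (vtx (C a) j) (i , eq))
    disjoint₊ : ∀ a b → a ≢ b → ∀ i j → vtx (C₊ a) i ≢ vtx (C₊ b) j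
    disjoint₊ zero zero ne = ⊥-elim (ne refl)
    disjoint₊ zero (suc b) _ i j eq = D-disjoint b i j eq
    disjoint₊ (suc a) zero _ i j eq = D-disjoint a j i (sym eq)
    disjoint₊ (suc a) (suc b) ne i j eq = disjoint a b (λ e → ne (cong suc e)) i j (f-inj eq)
    on-leaf₊ : ∀ a → OnCycle (C₊ a) (g (leaf₊ a))
    on-leaf₊ zero = proj₁ w∈ , trans (proj₂ w∈) (sym (trans (cong f (proj₂ tree-w)) f-w′))
    on-leaf₊ (suc a) = proj₁ (on-leaf a) , cong f (proj₂ (on-leaf a))
    only-leaf₊ : ∀ a i → OnCycle (C₊ a) (g i) → i ≡ leaf₊ a
    only-leaf₊ zero i c = f-inj′ (trans (f-on (f′ i) c) (sym (proj₂ tree-w)))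
    only-leaf₊ (suc a) i (j , eq) = only-leaf a i (j , f-inj eq)
    cover₊ : ∀ v → (∃ λ i → g i ≡ v) ⊎ (∃ λ a → OnCycle (C₊ a) v)
    cover₊ v with body? v
    ... | yes (v∈ , _) = inj₂ (zero , v∈)
    ... | no nb with index nb
    ...   | i , refl with cover i
    ...     | inj₁ (j , eq) = inj₁ (j , cong f eq)
    ...     | inj₂ (a , j , eq) = inj₂ (suc a , j , cong f eq)
    edges₊ : ∀ x y → Adj Γ x y → (∃ λ i → ∃ λ j → g i ≡ x × g j ≡ y) ⊎ (∃ λ a → CycleEdge (C₊ a) x y)
    edges₊ x y xy with body? x | body? y
    ... | yes b | _ = inj₂ (zero , body-edge b xy)
    ... | no _ | yes b = inj₂ (zero , CycleEdge-sym D (body-edge b (adj-sym xy)))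
    ... | no nb | no nb′ with index nb | index nb′
    ...   | i , refl | j , refl with edges i j xy
    ...     | inj₁ (i′ , j′ , p , q) = inj₁ (i′ , j′ , cong f p , cong f q)
    ...     | inj₂ (a , t , inj₁ (p , q)) = inj₂ (suc a , t , inj₁ (cong f p , cong f q))
    ...     | inj₂ (a , t , inj₂ (p , q)) = inj₂ (suc a , t , inj₂ (cong f p , cong f q))

-- Removing a pendant cycle creates the leaf `w′`, so the hypotheses reproduce themselves. The
-- equation `n + k ≡ numEdges Γ + 1` replaces `k ≡ cyc Γ` because it passes through the removal
-- without truncated subtraction.
leaf⇒treeWithCycles : ∀ {n} (Γ : SGraph n) → IsSignedGraph Γ → Connected Γ → ∀ {v} → deg Γ v ≡ 1 →
  KerDimAtLeast (adjMat Γ) (suc (excess Γ)) → ∃ λ k → n + k ≡ numEdges Γ + 1 × TreeWithCycles k Γ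
leaf⇒treeWithCycles {n} = <-rec Goal induct n
  where
  Goal : ℕ → Set
  Goal n = (Γ : SGraph n) → IsSignedGraph Γ → Connected Γ → ∀ {v} → deg Γ v ≡ 1 →
    KerDimAtLeast (adjMat Γ) (suc (excess Γ)) → ∃ λ k → n + k ≡ numEdges Γ + 1 × TreeWithCycles k Γ
  induct : ∀ n → (∀ {m} → m < n → Goal m) → Goal n
  induct n rec Γ sg conn {v} d1 dim = decide (n ℕ.≤? numEdges Γ)
    where
    open Structure Γ sg conn
    decide : Dec (n ≤ numEdges Γ) → ∃ λ k → n + k ≡ numEdges Γ + 1 × TreeWithCycles k Γ
    decide (yes n≤E) = step-down (rec R.n′<n R.Γ′ R.sg′ R.conn′ R.deg-w′ (R.dim-remove dim))
      where
      D = n≤E⇒cycle Γ sg v n≤E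
      module R = RemovePendant Γ sg conn D (leaf⇒pendant d1 dim D)
      step-down : (∃ λ k → R.n′ + k ≡ numEdges R.Γ′ + 1 × TreeWithCycles k R.Γ′) → ∃ λ k → n + k ≡ numEdges Γ + 1 × TreeWithCycles k Γ
      step-down (k , eq , F) = suc k , R.cyclomatic-step eq , R.attach F
    decide (no n≰E) = 0 , trans (ℕ.+-identityʳ n) n≡ , record
      { m = n ; f = id ; C = λ () ; leaf = λ () ; f-inj = id ; tree = conn , acyclic
      ; nullity = subst (η≡ Γ) (sym p∸1) (dim , Explore.leaf⇒nullity≤ Γ sg conn d1)
      ; leaf-inj = λ { {()} } ; leaf-deg = λ () ; disjoint = λ () ; on-leaf = λ () ; only-leaf = λ () ; C-nullity = λ ()
      ; cover = λ u → inj₁ (u , refl) ; edges = λ u v _ → inj₁ (u , v , refl , refl) }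
      where
      n≡ : n ≡ numEdges Γ + 1
      n≡ = trans (ℕ.≤-antisym (connected⇒n≤1+E Γ sg conn v) (ℕ.≰⇒> n≰E)) (ℕ.+-comm 1 (numEdges Γ))
      -- A cycle would be pendant; the bound for connected graphs, applied after its removal, would
      -- then give `n ≤ numEdges Γ`.
      acyclic : ¬ Cycle Γ
      acyclic D = n≰E (ℕ.≤-trans (ℕ.≤-reflexive R.n-split) (ℕ.≤-trans (ℕ.+-monoˡ-≤ R.removed (connected⇒n≤1+E R.Γ′ R.sg′ R.conn′ R.w′))
        (ℕ.≤-reflexive (sym R.numEdges-split))))
        where module R = RemovePendant Γ sg conn D (leaf⇒pendant d1 dim D)
      some-nbr : ∃ λ j → Adj Γ v j × j ∉ []
      some-nbr = Basic.deg-∃∉ Γ sg [] (ℕ.≤-reflexive (sym d1))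
      p≡ : pendant Γ ≡ 2 + excess Γ
      p≡ = ℕ.+-cancelˡ-≡ (numEdges Γ + numEdges Γ) _ _ (trans
        (excess-handshake Γ sg (Basic.connected⇒deg≥1 Γ sg conn (proj₁ (proj₂ some-nbr))))
        (trans (cong (λ t → t * 2 + excess Γ) n≡)
          (solve 2 (λ e x → (e :+ con 1) :* con 2 :+ x := (e :+ e) :+ (con 2 :+ x)) refl (numEdges Γ) (excess Γ))))
        where open ℕ-Solver using (solve; _:+_; _:*_; _:=_; con)
      p∸1 : pendant Γ ∸ 1 ≡ suc (excess Γ)
      p∸1 = cong (_∸ 1) p≡

-- Here `Γ` itself may have no leaf; the removal of `D` produces one.
pendant⇒Form1 : ∀ {n} (Γ : SGraph n) (sg : IsSignedGraph Γ) (conn : Connected Γ) →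
  KerDimAtLeast (adjMat Γ) (suc (excess Γ)) → (D : Cycle Γ) → Structure.Pendant Γ sg conn D → Form1 Γ
pendant⇒Form1 {n} Γ sg conn dim D P = finish (leaf⇒treeWithCycles R.Γ′ R.sg′ R.conn′ R.deg-w′ (R.dim-remove dim))
  where
  module R = RemovePendant Γ sg conn D P
  finish : (∃ λ k → R.n′ + k ≡ numEdges R.Γ′ + 1 × TreeWithCycles k R.Γ′) → Form1 Γ
  finish (k , eq , F) = toForm1 (subst (λ k → TreeWithCycles k Γ) (sym (cyc≡ Γ (R.cyclomatic-step eq))) (R.attach F))

leaf⇒Form1 : ∀ {n} (Γ : SGraph n) (sg : IsSignedGraph Γ) (conn : Connected Γ) → ∀ {v} → deg Γ v ≡ 1 →
  KerDimAtLeast (adjMat Γ) (suc (excess Γ)) → Form1 Γ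
leaf⇒Form1 Γ sg conn d1 dim = finish (leaf⇒treeWithCycles Γ sg conn d1 dim)
  where
  finish : (∃ λ k → _ + k ≡ numEdges Γ + 1 × TreeWithCycles k Γ) → Form1 Γ
  finish (k , eq , F) = toForm1 (subst (λ k → TreeWithCycles k Γ) (sym (cyc≡ Γ eq)) F)

-- Paths

suc-∸ : ∀ {k i} → i < k → suc (k ∸ suc i) ≡ k ∸ i
suc-∸ {suc k} {i} (s≤s i≤k) = sym (ℕ.+-∸-assoc 1 i≤k)

module Paths {n} (Γ : SGraph n) (sg : IsSignedGraph Γ) where

  open Basic Γ sg
  open Explore Γ sg
  open Cycles Γ sg

  record NPath (u v : Fin n) (p : ℕ → Fin n) (a : ℕ) : Set where
    field
      1≤len : 1 ≤ a
      start : p 0 ≡ u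
      end   : p a ≡ v
      walk  : ∀ {i} → i < a → Adj Γ (p i) (p (suc i))
      inj-≤ : ∀ {i j} → i ≤ a → j ≤ a → p i ≡ p j → i ≡ j

    ends-≢ : u ≢ v
    ends-≢ eq = ℕ.<⇒≢ 1≤len (inj-≤ z≤n ℕ.≤-refl (trans start (trans eq (sym end))))

  open NPath public

  toPath : ∀ {u v p a} → NPath u v p a → Path Γ u v
  toPath {p = p} {a} P = record
    { plen = a ; ppos = 1≤len P ; pvtx = λ i → p (toℕ i)
    ; pinj = λ {i} {j} eq → toℕ-injective (inj-≤ P (ℕ.≤-pred (toℕ<n i)) (ℕ.≤-pred (toℕ<n j)) eq)
    ; pstart = start P ; pend = trans (cong p (toℕ-fromℕ a)) (end P)
    ; padj = λ i → subst (λ t → Adj Γ (p t) (p (suc (toℕ i)))) (sym (toℕ-inject₁ i)) (walk P (toℕ<n i)) }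

  toPath-edge : ∀ {u v p a} (P : NPath u v p a) {i} → i < a → PathEdge (toPath P) (p i) (p (suc i))
  toPath-edge {p = p} P i< = fromℕ< i< , inj₁ (cong p (trans (toℕ-inject₁ _) (toℕ-fromℕ< i<)) , cong (λ t → p (suc t)) (toℕ-fromℕ< i<))

  PathEdge-sym : ∀ {u v} (P : Path Γ u v) {a b} → PathEdge P a b → PathEdge P b a
  PathEdge-sym P (i , inj₁ e) = i , inj₂ e
  PathEdge-sym P (i , inj₂ e) = i , inj₁ e

  toPath-on : ∀ {u v p a} (P : NPath u v p a) {i} → i ≤ a → OnPath (toPath P) (p i)
  toPath-on {p = p} P i≤ = fromℕ< (s≤s i≤) , cong p (toℕ-fromℕ< (s≤s i≤))

  path-step : ∀ {u v p a} → NPath u v p a → ∀ {i} → suc i < a →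
    Adj Γ (p (suc i)) (p i) × Adj Γ (p (suc i)) (p (2 + i)) × p i ≢ p (2 + i)
  path-step P {i} si< = adj-sym (walk P (ℕ.<-trans ℕ.≤-refl si<)) , walk P si< ,
    λ eq → ℕ.m+1+n≢n 1 (sym (inj-≤ P (ℕ.≤-trans (ℕ.n≤1+n i) (ℕ.<⇒≤ si<)) si< eq))

  interior-nbr : ∀ {u v p a} → NPath u v p a → ∀ {i j} → 1 ≤ i → i < a → deg Γ (p i) ≡ 2 → Adj Γ (p i) j → ∃ λ t → t ≤ a × p t ≡ j
  interior-nbr P {suc i} _ si< d2 a with path-step P si<
  ... | x , y , ne with deg2-nbr d2 x y ne a
  ...   | inj₁ refl = i , ℕ.≤-trans (ℕ.n≤1+n i) (ℕ.<⇒≤ si<) , refl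
  ...   | inj₂ refl = 2 + i , si< , refl

  interior-edge : ∀ {u v p a} (P : NPath u v p a) → ∀ {i j} → 1 ≤ i → i < a → deg Γ (p i) ≡ 2 → Adj Γ (p i) j → PathEdge (toPath P) (p i) j
  interior-edge P {suc i} _ si< d2 a with path-step P si<
  ... | x , y , ne with deg2-nbr d2 x y ne a
  ...   | inj₁ refl = PathEdge-sym (toPath P) (toPath-edge P (ℕ.<-trans ℕ.≤-refl si<))
  ...   | inj₂ refl = toPath-edge P si<

  -- A cycle through an interior vertex of degree 2 uses both edges there, so it follows the path to
  -- its end.
  propagate : ∀ (D : Cycle Γ) {u v p a} → NPath u v p a → (∀ {i} → 1 ≤ i → i < a → deg Γ (p i) ≡ 2) →
    ∀ {i} → 1 ≤ i → i ≤ a → OnCycle D (p i) → OnCycle D v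
  propagate D {v = v} {p} {a} P d2 {i} 1≤i i≤a c = go (a ∸ i) 1≤i (ℕ.m+[n∸m]≡n i≤a) c
    where
    go : ∀ r {i} → 1 ≤ i → i + r ≡ a → OnCycle D (p i) → OnCycle D v
    go zero {i} 1≤i eq c = subst (OnCycle D) (trans (cong p (trans (sym (ℕ.+-identityʳ i)) eq)) (end P)) c
    go (suc r) {i} 1≤i eq c = go r {suc i} (s≤s z≤n) (trans (sym (ℕ.+-suc i r)) eq)
      (proj₂ (CycleEdge-on D (deg2-edge D c (d2 1≤i i<a) (walk P i<a))))
      where
      i<a : i < a
      i<a = subst (suc i ≤_) (trans (sym (ℕ.+-suc i r)) eq) (s≤s (ℕ.m≤m+n i r))

  Disjoint : (u v : Fin n) (p : ℕ → Fin n) (a : ℕ) (q : ℕ → Fin n) (b : ℕ) → Set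
  Disjoint u v p a q b = ∀ {i j} → i ≤ a → j ≤ b → p i ≡ q j → p i ≡ u ⊎ p i ≡ v

  record Glued (p : ℕ → Fin n) (a : ℕ) (q : ℕ → Fin n) (b : ℕ) : Set where
    field
      C      : Cycle Γ
      on-p   : ∀ {i} → i ≤ a → OnCycle C (p i)
      on-q   : ∀ {i} → i ≤ b → OnCycle C (q i)
      off    : ∀ {v} → OnCycle C v → (∃ λ i → i ≤ a × p i ≡ v) ⊎ (∃ λ j → 1 ≤ j × j < b × q j ≡ v)
      edge-p : ∀ {i} → i < a → CycleEdge C (p i) (p (suc i))
      edge-q : ∀ {i} → i < b → CycleEdge C (q i) (q (suc i))

  module _ {u v p a q b} (P : NPath u v p a) (Q : NPath u v q b) (disj : Disjoint u v p a q b) (long : ¬ (a ≡ 1 × b ≡ 1)) where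
    private
      l = a + b

      h : ℕ → Fin n
      h i with i ℕ.≤? a
      ... | yes _ = p i
      ... | no _ = q (l ∸ i)

      h-p : ∀ {i} → i ≤ a → h i ≡ p i
      h-p {i} i≤ with i ℕ.≤? a
      ... | yes _ = refl
      ... | no i≰ = ⊥-elim (i≰ i≤)

      h-q′ : ∀ {i} → a < i → h i ≡ q (l ∸ i)
      h-q′ {i} a<i with i ℕ.≤? a
      ... | yes i≤ = ⊥-elim (ℕ.<⇒≱ a<i i≤)
      ... | no _ = refl

      l∸a : l ∸ a ≡ b
      l∸a = ℕ.m+n∸m≡n a b

      -- The value at a is described by both pieces, since the paths share their end.
      h-q : ∀ {i} → a ≤ i → h i ≡ q (l ∸ i)
      h-q {i} a≤i with ℕ.m≤n⇒m<n∨m≡n a≤i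
      ... | inj₁ a<i = h-q′ a<i
      ... | inj₂ refl = trans (h-p ℕ.≤-refl) (trans (end P) (trans (sym (end Q)) (cong q (sym l∸a))))

      low : ∀ {i} → a < i → i < l → 1 ≤ l ∸ i × l ∸ i < b
      low {i} a<i i<l = ℕ.m<n⇒0<n∸m i<l , subst (l ∸ i <_) l∸a (ℕ.∸-monoʳ-< a<i (ℕ.<⇒≤ i<l))

      no-mix : ∀ {i j} → i ≤ a → 1 ≤ j → j < b → p i ≢ q j
      no-mix {i} {j} i≤ 1≤j j<b eq with disj i≤ (ℕ.<⇒≤ j<b) eq
      ... | inj₁ p≡u = ℕ.<⇒≢ 1≤j (inj-≤ Q z≤n (ℕ.<⇒≤ j<b) (trans (start Q) (trans (sym p≡u) eq)))
      ... | inj₂ p≡v = ℕ.<⇒≢ j<b (inj-≤ Q (ℕ.<⇒≤ j<b) ℕ.≤-refl (trans (sym eq) (trans p≡v (sym (end Q)))))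

      h-inj : ∀ {i j} → i < l → j < l → h i ≡ h j → i ≡ j
      h-inj {i} {j} i< j< eq with i ℕ.≤? a | j ℕ.≤? a
      ... | yes i≤ | yes j≤ = inj-≤ P i≤ j≤ eq
      ... | yes i≤ | no j≰ = ⊥-elim (no-mix i≤ (proj₁ (low (ℕ.≰⇒> j≰) j<)) (proj₂ (low (ℕ.≰⇒> j≰) j<)) eq)
      ... | no i≰ | yes j≤ = ⊥-elim (no-mix j≤ (proj₁ (low (ℕ.≰⇒> i≰) i<)) (proj₂ (low (ℕ.≰⇒> i≰) i<)) (sym eq))
      ... | no i≰ | no j≰ = ℕ.∸-cancelˡ-≡ (ℕ.<⇒≤ i<) (ℕ.<⇒≤ j<)
        (inj-≤ Q (ℕ.<⇒≤ (proj₂ (low (ℕ.≰⇒> i≰) i<))) (ℕ.<⇒≤ (proj₂ (low (ℕ.≰⇒> j≰) j<))) eq)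

      h-walk : ∀ i → i < l → Adj Γ (h i) (h (suc i))
      h-walk i i<l with ℕ.<-≤-connex i a
      ... | inj₁ i<a = subst (λ s → Adj Γ s (h (suc i))) (sym (h-p (ℕ.<⇒≤ i<a))) (subst (Adj Γ (p i)) (sym (h-p i<a)) (walk P i<a))
      ... | inj₂ a≤i = subst (λ s → Adj Γ s (h (suc i))) (sym (h-q a≤i)) (subst (Adj Γ (q (l ∸ i))) (sym (h-q (ℕ.m≤n⇒m≤1+n a≤i)))
        (adj-sym (subst (λ t → Adj Γ (q (l ∸ suc i)) (q t)) (suc-∸ i<l) (walk Q (subst (_≤ b) (sym (suc-∸ i<l)) (subst (l ∸ i ≤_) l∸a (ℕ.∸-monoʳ-≤ l a≤i)))))))

      h-closes : h l ≡ h 0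
      h-closes = trans (h-q (ℕ.m≤m+n a b)) (trans (cong q (ℕ.n∸n≡0 l)) (trans (start Q) (trans (sym (start P)) (sym (h-p z≤n)))))

      3≤sum : ∀ {a b} → 1 ≤ a → 1 ≤ b → ¬ (a ≡ 1 × b ≡ 1) → ∃ λ m → a + b ≡ 3 + m
      3≤sum {suc zero} {suc zero} _ _ ¬11 = ⊥-elim (¬11 (refl , refl))
      3≤sum {suc zero} {suc (suc b)} _ _ _ = b , refl
      3≤sum {suc (suc a)} {suc b} _ _ _ = a + b , cong (λ t → 2 + t) (ℕ.+-suc a b)

      m = proj₁ (3≤sum (1≤len P) (1≤len Q) long)

      l≡ : l ≡ 3 + m
      l≡ = proj₂ (3≤sum (1≤len P) (1≤len Q) long)

      seq : CycSeq h (3 + m)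
      seq = record
        { inj-< = λ {i} {j} i< j< → h-inj (subst (i <_) (sym l≡) i<) (subst (j <_) (sym l≡) j<)
        ; walk = λ i i< → h-walk i (subst (i <_) (sym l≡) i<) ; closes = subst (λ t → h t ≡ h 0) l≡ h-closes }

      D = seqCycle seq

      on-h : ∀ {i} → i < l → OnCycle D (h i)
      on-h {i} i< = seqCycle-on seq (subst (i <_) l≡ i<)

      a<l : a < l
      a<l = subst (_≤ a + b) (ℕ.+-comm a 1) (ℕ.+-monoʳ-≤ a (1≤len Q))

      on-p′ : ∀ {i} → i ≤ a → OnCycle D (p i)
      on-p′ i≤ = subst (OnCycle D) (h-p i≤) (on-h (ℕ.≤-<-trans i≤ a<l))

      back-q : ∀ {j} → j ≤ b → l ∸ (l ∸ j) ≡ j × a ≤ l ∸ j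
      back-q {j} j≤ = ℕ.m∸[m∸n]≡n (ℕ.≤-trans j≤ (ℕ.m≤n+m b a)) , subst (_≤ l ∸ j) (ℕ.m+n∸n≡m a b) (ℕ.∸-monoʳ-≤ l j≤)

      h-back : ∀ {j} → j ≤ b → h (l ∸ j) ≡ q j
      h-back j≤ = trans (h-q (proj₂ (back-q j≤))) (cong q (proj₁ (back-q j≤)))

      on-q′ : ∀ {j} → j ≤ b → OnCycle D (q j)
      on-q′ {zero} _ = subst (OnCycle D) (trans (start P) (sym (start Q))) (on-p′ z≤n)
      on-q′ {suc j} j≤ = subst (OnCycle D) (h-back j≤) (on-h (ℕ.∸-monoʳ-< (s≤s z≤n) (ℕ.≤-trans j≤ (ℕ.m≤n+m b a))))

      off′ : ∀ {v} → OnCycle D v → (∃ λ i → i ≤ a × p i ≡ v) ⊎ (∃ λ j → 1 ≤ j × j < b × q j ≡ v)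
      off′ (i , refl) = sort (toℕ i) (subst (toℕ i <_) (sym l≡) (toℕ<n i))
        where
        sort : ∀ i → i < l → (∃ λ t → t ≤ a × p t ≡ h i) ⊎ (∃ λ j → 1 ≤ j × j < b × q j ≡ h i)
        sort i i< with i ℕ.≤? a
        ... | yes i≤ = inj₁ (i , i≤ , refl)
        ... | no i≰ = inj₂ (l ∸ i , proj₁ (low (ℕ.≰⇒> i≰) i<) , proj₂ (low (ℕ.≰⇒> i≰) i<) , refl)

      edge-h : ∀ {i} → i < l → CycleEdge D (h i) (h (suc i))
      edge-h {i} i< = seqCycle-edge seq (subst (i <_) l≡ i<)

    glue : Glued p a q b
    glue = record
      { C = D ; on-p = on-p′ ; on-q = on-q′ ; off = off′
      ; edge-p = λ {i} i<a → subst (λ s → CycleEdge D s (p (suc i))) (h-p (ℕ.<⇒≤ i<a))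
          (subst (CycleEdge D (h i)) (h-p i<a) (edge-h (ℕ.<-trans i<a a<l)))
      ; edge-q = λ {j} j<b → CycleEdge-sym D (subst (λ s → CycleEdge D s (q j)) (h-back j<b)
          (subst (CycleEdge D (h (l ∸ suc j))) (trans (cong h (suc-∸ (ℕ.<-≤-trans j<b (ℕ.m≤n+m b a)))) (h-back (ℕ.<⇒≤ j<b)))
            (edge-h (ℕ.∸-monoʳ-< (s≤s z≤n) (ℕ.≤-trans j<b (ℕ.m≤n+m b a)))))) }

-- Graphs without leaves

module NoLeaf {n} (Γ : SGraph n) (sg : IsSignedGraph Γ) (conn : Connected Γ) (2≤deg : ∀ v → 2 ≤ deg Γ v)
  (dim : KerDimAtLeast (adjMat Γ) (suc (excess Γ))) where

  open Basic Γ sg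
  open Explore Γ sg
  open Cycles Γ sg
  open Structure Γ sg conn
  open Walks Γ sg 2≤deg
  open Paths Γ sg

  path-ear : ∀ {u v p a Z} → NPath u v p a → T (Z u) → T (Z v) → (∀ {i} → 1 ≤ i → i < a → ¬ T (Z (p i))) → IsEar Z p a
  path-ear {Z = Z} P zu zv int = record
    { start∈ = subst (λ t → T (Z t)) (sym (start P)) zu ; end∈ = subst (λ t → T (Z t)) (sym (end P)) zv
    ; walk = λ i → walk P ; interior = int ; inj-int = λ _ i< _ j< → inj-≤ P (ℕ.<⇒≤ i<) (ℕ.<⇒≤ j<)
    ; no-back = λ i si< → proj₂ (proj₂ (path-step P si<)) }

  Branch : Fin n → Set
  Branch v = 3 ≤ deg Γ v

  deg2⇒¬branch : ∀ {v} → deg Γ v ≡ 2 → ¬ Branch v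
  deg2⇒¬branch d2 b = ℕ.1+n≰n (subst (3 ≤_) d2 b)

  -- A property of the whole graph, obtained while one cycle is analysed. For any other cycle it
  -- excludes the outcome `pendant-away`, so that every cycle falls under `shaped` and has nullity
  -- 2.
  NoDisjointPair : Set
  NoDisjointPair = ∀ (D E : Cycle Γ) {d e} → OnCycle D d → Branch d → OnCycle E e → Branch e → (∀ {x} → OnCycle E x → ¬ OnCycle D x) → ⊥

  data Outcome (C : Cycle Γ) : Set where
    pendant-away : (E : Cycle Γ) → Pendant E → (∀ {d} → OnCycle E d → ¬ OnCycle C d) → Outcome C
    shaped       : cycleNullity≡ C 2 → IsInfinityGraph Γ ⊎ IsThetaGraph Γ → NoDisjointPair → Outcome C

  -- A first step out of `u` along neither edge of `C`. A chord is preferred if there is one;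
  -- otherwise the absence of chords at `u` is recorded. For a θ-graph this decides which path
  -- contains an edge between `u` and `v`.
  record Start (C : Cycle Γ) (O : Orientation C) (u : Fin n) : Set where
    open Orientation O
    field
      y     : Fin n
      uy    : Adj Γ u y
      y≢1   : y ≢ seq 1
      y≢l   : y ≢ seq (2 + len C)
      chord : OnCycle C y ⊎ (∀ {j} → OnCycle C j → Adj Γ u j → j ≡ seq 1 ⊎ j ≡ seq (2 + len C))

  module Analysis (C : Cycle Γ) (O : Orientation C) {u} (c0 : Orientation.seq O 0 ≡ u) (branch-u : Branch u) (TC : TightOn C)
    (st : Start C O u) where

    open Orientation O renaming (seq to c)
    open PSeq pseq renaming (inj-< to c-inj; walk to c-walk; period to c-period)
    open Start st
    module TC = TightOn TC

    private
      m = len C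
      L = 3 + m
      f = stroll u y

      f-adj : ∀ i → Adj Γ (f i) (f (suc i))
      f-adj = stroll-adj u y uy

      u∈ : OnCycle C u
      u∈ = subst (OnCycle C) c0 (on 0)

      cL : c L ≡ u
      cL = trans (c-period 0) c0

    module Hit (k : ℕ) (1≤k : 1 ≤ k) (avoids : ∀ {i} → 1 ≤ i → i < k → ¬ OnCycle C (f i))
      (distinct : ∀ {i j} → 1 ≤ i → i < k → 1 ≤ j → j < k → f i ≡ f j → i ≡ j) where

      -- The loop avoids `C` altogether, so it is a cycle disjoint from a tight set.
      self-hit : ∀ {j} → 1 ≤ j → j < k → f k ≡ f j → Outcome C
      self-hit {j} 1≤j j<k eq = build (loopSeq f-adj (stroll-no-back u y) j<k eq
          (λ j≤a a< j≤b b< → distinct (ℕ.≤-trans 1≤j j≤a) a< (ℕ.≤-trans 1≤j j≤b) b<))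
        where
        build : (∃ λ m → j + (3 + m) ≡ k × CycSeq (λ i → f (j + i)) (3 + m)) → Outcome C
        build (m , e , s) = pendant-away E (reach-pendant E TC.Z TC.tight (λ d∈ z → away d∈ (TC.⇒on z)) (TC.on⇒ u∈)
            (conn u (vtx E zero)) (zero , refl)) away
          where
          E = seqCycle s
          away : ∀ {d} → OnCycle E d → ¬ OnCycle C d
          away (i , refl) d∈ = avoids (ℕ.≤-trans 1≤j (ℕ.m≤m+n j (toℕ i))) (subst (j + toℕ i <_) e (ℕ.+-monoʳ-< j (toℕ<n i))) d∈

      module Closed (end∈ : OnCycle C (f k)) where

        earQ : IsEar TC.Z f k
        earQ = record
          { start∈ = TC.on⇒ u∈ ; end∈ = TC.on⇒ end∈ ; walk = λ i _ → f-adj i ; interior = λ 1≤i i< z → avoids 1≤i i< (TC.⇒on z)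
          ; inj-int = distinct ; no-back = λ i _ → stroll-no-back u y i }

        degQ : ∀ {i} → 1 ≤ i → i < k → deg Γ (f i) ≡ 2
        degQ = ear-deg TC.tight earQ

        Covered : Fin n → Set
        Covered v = OnCycle C v ⊎ ∃ λ i → 1 ≤ i × i < k × f i ≡ v

        f-covered : ∀ {i} → i ≤ k → Covered (f i)
        f-covered {zero} _ = inj₁ u∈
        f-covered {suc i} i≤ with ℕ.m≤n⇒m<n∨m≡n i≤
        ... | inj₁ i< = inj₂ (suc i , s≤s z≤n , i< , refl)
        ... | inj₂ refl = inj₁ end∈

        f-nbr-covered : ∀ {i j} → 1 ≤ i → i < k → Adj Γ (f i) j → Covered j
        f-nbr-covered {suc i} {j} 1≤i i< a with deg2-nbr (degQ 1≤i i<) (adj-sym (f-adj i)) (f-adj (suc i)) (stroll-no-back u y i) a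
        ... | inj₁ refl = f-covered (ℕ.≤-trans (ℕ.n≤1+n i) (ℕ.<⇒≤ i<))
        ... | inj₂ refl = f-covered i<

        module _ (cover-all : ∀ v → Covered v) (degC : ∀ {v} → OnCycle C v → v ≢ u → v ≢ f k → deg Γ v ≡ 2) (2≤x : 2 ≤ excess Γ) where

          -- Two conditions kill the ear, so a third kernel vector lives on C alone.
          nullity-C : cycleNullity≡ C 2
          nullity-C = use (kernel-vanishing-at₂ (adjMat Γ) {excess Γ ∸ 2}
              (subst (KerDimAtLeast (adjMat Γ)) (cong suc (sym (ℕ.m+[n∸m]≡n 2≤x))) dim) u y)
            where
            use : (∃ λ x → Ker (adjMat Γ) x × x u ≡ 0ℚ × x y ≡ 0ℚ × ∃ λ q → x q ≢ 0ℚ) → cycleNullity≡ C 2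
            use (x , kx , xu , xy , q , xq) = on-cycle (cover-all q)
              where
              along : ∀ i → i < k → x (f i) ≡ 0ℚ × x (f (suc i)) ≡ 0ℚ
              along zero _ = xu , xy
              along (suc i) si< = let (xi , xsi) = along i (ℕ.<-trans ℕ.≤-refl si<) in xsi , next-zero xi
                where
                next-zero : x (f i) ≡ 0ℚ → x (f (2 + i)) ≡ 0ℚ
                next-zero xi = *-≢0 (A≢0 (f-adj (suc i))) (trans (sym (row-single x others)) (rows kx (f (suc i))))
                  where
                  others : ∀ j → Adj Γ (f (suc i)) j → j ≢ f (2 + i) → x j ≡ 0ℚ
                  others j a ne with deg2-nbr (degQ (s≤s z≤n) si<) (adj-sym (f-adj i)) (f-adj (suc i)) (stroll-no-back u y i) a
                  ... | inj₁ refl = xi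
                  ... | inj₂ eq = ⊥-elim (ne eq)
              x-end : x (f k) ≡ 0ℚ
              x-end = at-end 1≤k (λ i → along i)
                where
                at-end : ∀ {k} → 1 ≤ k → (∀ i → i < k → x (f i) ≡ 0ℚ × x (f (suc i)) ≡ 0ℚ) → x (f k) ≡ 0ℚ
                at-end {suc k} _ h = proj₂ (h k ℕ.≤-refl)
              off : ∀ i j → Adj Γ (vtx C (next i)) j → j ≢ vtx C i → j ≢ vtx C (next (next i)) → x j ≡ 0ℚ
              off i j a ne ne′ with cover-all j
              ... | inj₂ (t , 1≤t , t< , refl) = proj₁ (along t t<)
              ... | inj₁ j∈ with j ≟ u | j ≟ f k
              ...   | yes refl | _ = xu
              ...   | no _ | yes refl = x-end
              ...   | no j≢u | no j≢e with cycleEdge-nbr C (CycleEdge-sym C (deg2-edge C j∈ (degC j∈ j≢u j≢e) (adj-sym a)))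
              ...     | inj₁ eq = ⊥-elim (ne eq)
              ...     | inj₂ eq = ⊥-elim (ne′ eq)
              on-cycle : Covered q → cycleNullity≡ C 2
              on-cycle (inj₂ (t , 1≤t , t< , refl)) = ⊥-elim (xq (proj₁ (along t t<)))
              on-cycle (inj₁ (i , refl)) = nonzero⇒nullity2 C (kernel⇒Tri-restrict C kx off) {i} xq

      module Infinity (m′ : ℕ) (k≡ : k ≡ 3 + m′) (s : CycSeq f (3 + m′)) (fk : f k ≡ u) where
        open Closed (subst (OnCycle C) (sym fk) u∈)

        E : Cycle Γ
        E = seqCycle s

        private
          u∈E : OnCycle E u
          u∈E = seqCycle-on s (s≤s z≤n)
          TE : TightOn E
          TE = tightOn E u∈E branch-u dim
          module TE = TightOn TE

        E-elim : ∀ {v} → OnCycle E v → ∃ λ i → i < k × f i ≡ v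
        E-elim (i , eq) = toℕ i , subst (toℕ i <_) (sym k≡) (toℕ<n i) , eq

        E-on : ∀ {i} → i < k → OnCycle E (f i)
        E-on {i} i< = seqCycle-on s (subst (i <_) k≡ i<)

        common : ∀ v → OnCycle C v → OnCycle E v → v ≡ u
        common v v∈ e with E-elim e
        ... | zero , _ , eq = sym eq
        ... | suc i , i< , refl = ⊥-elim (avoids (s≤s z≤n) i< v∈)

        -- Seen from the other cycle `E`, the cycle `C` is a closed ear at `u`, which gives its
        -- remaining vertices degree 2.
        earC : IsEar TE.Z c L
        earC = record
          { start∈ = subst (λ t → T (TE.Z t)) (sym c0) (TE.on⇒ u∈E) ; end∈ = subst (λ t → T (TE.Z t)) (sym cL) (TE.on⇒ u∈E)
          ; walk = λ i _ → c-walk i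
          ; interior = λ {i} 1≤i i< z → ℕ.<⇒≢ 1≤i (c-inj (s≤s z≤n) i< (trans c0 (sym (common (c i) (on i) (TE.⇒on z)))))
          ; inj-int = λ _ i< _ j< → c-inj i< j< ; no-back = λ i _ → seq-no-back pseq i }

        degC : ∀ {v} → OnCycle C v → v ≢ u → deg Γ v ≡ 2
        degC v∈ v≢u with cover v∈
        ... | zero , _ , eq = ⊥-elim (v≢u (trans (sym eq) c0))
        ... | suc i , i< , refl = ear-deg TE.tight earC (s≤s z≤n) i<

        u-nbr : ∀ {j} → Adj Γ u j → Covered j
        u-nbr {j} a with j ≟ y
        ... | yes refl = f-covered 1≤k
        ... | no j≢y with ear-start-nbr TC.tight {suc m′} (subst (IsEar TC.Z f) k≡ earQ) a j≢y
        ...   | inj₁ z = inj₁ (TC.⇒on z)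
        ...   | inj₂ (i , 1≤i , i< , refl) = inj₂ (i , 1≤i , subst (i <_) (sym k≡) i< , refl)

        cover-all : ∀ v → Covered v
        cover-all = closed⇒all conn Covered (inj₁ u∈) step-covered
          where
          step-covered : ∀ a b → Covered a → Adj Γ a b → Covered b
          step-covered a b (inj₂ (i , 1≤i , i< , refl)) ab = f-nbr-covered 1≤i i< ab
          step-covered a b (inj₁ a∈) ab with a ≟ u
          ... | yes refl = u-nbr ab
          ... | no a≢u = inj₁ (proj₂ (CycleEdge-on C (deg2-edge C a∈ (degC a∈ a≢u) ab)))

        branch≡u : ∀ {v} → Branch v → v ≡ u
        branch≡u {v} b with cover-all v
        ... | inj₂ (i , 1≤i , i< , refl) = ⊥-elim (deg2⇒¬branch (degQ 1≤i i<) b)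
        ... | inj₁ v∈ with v ≟ u
        ...   | yes eq = eq
        ...   | no v≢u = ⊥-elim (deg2⇒¬branch (degC v∈ v≢u) b)

        -- `u` has two neighbours on `C` and two on `E`, and degree 4 contributes 2.
        2≤excess : 2 ≤ excess Γ
        2≤excess = ℕ.≤-trans (ℕ.∸-monoˡ-≤ 2 4≤deg) (sum-lookup≤ (λ v → deg Γ v ∸ 2) u)
          where
          last = f (2 + m′)
          last<k : 2 + m′ < k
          last<k = subst (3 + m′ ≤_) (sym k≡) ℕ.≤-refl
          int-≢ : ∀ {i v} → 1 ≤ i → i < k → OnCycle C v → v ≢ f i
          int-≢ 1≤i i< v∈ refl = avoids 1≤i i< v∈
          1<k : 1 < k
          1<k = subst (2 ≤_) (sym k≡) (s≤s (s≤s z≤n))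
          4≤deg : 4 ≤ deg Γ u
          4≤deg = length≤count {P = λ j → is-just (Γ u j)}
            (((λ eq → 1≢l (c-inj (s≤s (s≤s z≤n)) ℕ.≤-refl eq)) ∷ int-≢ ℕ.≤-refl 1<k (on 1) ∷ int-≢ (s≤s z≤n) last<k (on 1) ∷ []) ∷
             (int-≢ ℕ.≤-refl 1<k (on (2 + m)) ∷ int-≢ (s≤s z≤n) last<k (on (2 + m)) ∷ []) ∷
             ((λ eq → 1≢l (distinct ℕ.≤-refl 1<k (s≤s z≤n) last<k eq)) ∷ []) ∷ [] ∷ [])
            (subst (λ t → Adj Γ t (c 1)) c0 (c-walk 0) ∷ adj-sym (subst (Adj Γ (c (2 + m))) cL (c-walk (2 + m))) ∷ uy ∷
             adj-sym (subst (Adj Γ last) (trans (cong f (sym k≡)) fk) (f-adj (2 + m′))) ∷ [])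
            where
            1≢l : ∀ {m} → 1 ≢ 2 + m
            1≢l ()

        infinity : Outcome C
        infinity = shaped (nullity-C cover-all (λ v∈ v≢u _ → degC v∈ v≢u) 2≤excess)
          (inj₁ (C , E , u , u∈ , u∈E , common , covers , edges))
          (λ D E′ d∈ bd e∈ be disj → disj (subst (OnCycle E′) (branch≡u be) e∈) (subst (OnCycle D) (branch≡u bd) d∈))
          where
          covers : ∀ v → OnCycle C v ⊎ OnCycle E v
          covers v with cover-all v
          ... | inj₁ v∈ = inj₁ v∈
          ... | inj₂ (i , _ , i< , refl) = inj₂ (E-on i<)
          half-edge : ∀ {a b} → Adj Γ a b → a ≢ u → CycleEdge C a b ⊎ CycleEdge E a b
          half-edge {a} ab a≢u with cover-all a
          ... | inj₁ a∈ = inj₁ (deg2-edge C a∈ (degC a∈ a≢u) ab)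
          ... | inj₂ (i , 1≤i , i< , refl) = inj₂ (deg2-edge E (E-on i<) (degQ 1≤i i<) ab)
          edges : ∀ a b → Adj Γ a b → CycleEdge C a b ⊎ CycleEdge E a b
          edges a b ab with a ≟ u
          ... | no a≢u = half-edge ab a≢u
          ... | yes refl with half-edge (adj-sym ab) (λ eq → adj-irrefl ab (sym eq))
          ...   | inj₁ e = inj₁ (CycleEdge-sym C e)
          ...   | inj₂ e = inj₂ (CycleEdge-sym E e)

      module Theta (t : ℕ) (1≤t : 1 ≤ t) (t<L : t < L) (fk : f k ≡ c t) where
        open Closed (subst (OnCycle C) (sym fk) (on t))

        private
          v = c t
          -- The walk `c` backwards from `c L = u`; up to index `t′` it is the second arc of `C`
          -- between `u` and `v`.
          c′ : ℕ → Fin n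
          c′ i = c (L ∸ i)
          t′ = L ∸ t

          c-inj₁ : ∀ {i j} → 1 ≤ i → i ≤ L → 1 ≤ j → j ≤ L → c i ≡ c j → i ≡ j
          c-inj₁ {suc i} {suc j} _ i≤ _ j≤ eq = cong suc (PSeq.inj-< (shift₁ pseq) i≤ j≤ eq)

          1≤t′ : 1 ≤ t′
          1≤t′ = ℕ.m<n⇒0<n∸m t<L

          t′≤L : t′ ≤ L
          t′≤L = ℕ.m∸n≤m L t

          L∸t′ : L ∸ t′ ≡ t
          L∸t′ = ℕ.m∸[m∸n]≡n (ℕ.<⇒≤ t<L)

          t≤L∸ : ∀ {i} → i ≤ t′ → t ≤ L ∸ i
          t≤L∸ {i} i≤ = subst (_≤ L ∸ i) L∸t′ (ℕ.∸-monoʳ-≤ L i≤)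

          u≢v : u ≢ v
          u≢v eq = ℕ.<⇒≢ 1≤t (c-inj (s≤s z≤n) t<L (trans c0 eq))

          Q-inj : ∀ {i j} → i ≤ k → j ≤ k → f i ≡ f j → i ≡ j
          Q-inj {i} {j} i≤ j≤ eq with ℕ.m≤n⇒m<n∨m≡n i≤ | ℕ.m≤n⇒m<n∨m≡n j≤
          Q-inj {zero} {zero} _ _ _ | _ | _ = refl
          Q-inj {zero} {suc j} _ _ eq | _ | inj₁ j< = ⊥-elim (avoids (s≤s z≤n) j< (subst (OnCycle C) eq u∈))
          Q-inj {zero} {suc j} _ _ eq | _ | inj₂ refl = ⊥-elim (u≢v (trans eq fk))
          Q-inj {suc i} {zero} _ _ eq | inj₁ i< | _ = ⊥-elim (avoids (s≤s z≤n) i< (subst (OnCycle C) (sym eq) u∈))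
          Q-inj {suc i} {zero} _ _ eq | inj₂ refl | _ = ⊥-elim (u≢v (trans (sym eq) fk))
          Q-inj {suc i} {suc j} _ _ eq | inj₁ i< | inj₁ j< = distinct (s≤s z≤n) i< (s≤s z≤n) j< eq
          Q-inj {suc i} {suc j} _ _ eq | inj₁ i< | inj₂ refl = ⊥-elim (avoids (s≤s z≤n) i< (subst (OnCycle C) (sym (trans eq fk)) (on t)))
          Q-inj {suc i} {suc j} _ _ eq | inj₂ refl | inj₁ j< = ⊥-elim (avoids (s≤s z≤n) j< (subst (OnCycle C) (sym (trans (sym eq) fk)) (on t)))
          Q-inj {suc i} {suc j} _ _ eq | inj₂ refl | inj₂ e = sym e

          Q : NPath u v f k
          Q = record { 1≤len = 1≤k ; start = refl ; end = fk ; walk = λ {i} _ → f-adj i ; inj-≤ = Q-inj }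

          A₁ : NPath u v c t
          A₁ = record { 1≤len = 1≤t ; start = c0 ; end = refl ; walk = λ {i} _ → c-walk i
            ; inj-≤ = λ i≤ j≤ → c-inj (ℕ.≤-<-trans i≤ t<L) (ℕ.≤-<-trans j≤ t<L) }

          A₂ : NPath u v c′ t′
          A₂ = record { 1≤len = 1≤t′ ; start = cL ; end = cong c L∸t′
            ; walk = λ {i} i< → adj-sym (subst (λ s → Adj Γ (c (L ∸ suc i)) (c s)) (suc-∸ (ℕ.<-≤-trans i< t′≤L)) (c-walk (L ∸ suc i)))
            ; inj-≤ = λ {i} {j} i≤ j≤ eq → ℕ.∸-cancelˡ-≡ (ℕ.≤-trans i≤ t′≤L) (ℕ.≤-trans j≤ t′≤L)
                (c-inj₁ (ℕ.≤-trans 1≤t (t≤L∸ i≤)) (ℕ.m∸n≤m L i) (ℕ.≤-trans 1≤t (t≤L∸ j≤)) (ℕ.m∸n≤m L j) eq) }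

          C-Q : ∀ {x j} → OnCycle C x → j ≤ k → x ≡ f j → x ≡ u ⊎ x ≡ v
          C-Q {x} {zero} x∈ _ eq = inj₁ eq
          C-Q {x} {suc j} x∈ j≤ eq with ℕ.m≤n⇒m<n∨m≡n j≤
          ... | inj₁ j< = ⊥-elim (avoids (s≤s z≤n) j< (subst (OnCycle C) eq x∈))
          ... | inj₂ refl = inj₂ (trans eq fk)

          disj₁ : Disjoint u v c t f k
          disj₁ {i} _ j≤ eq = C-Q (on i) j≤ eq

          disj₂ : Disjoint u v c′ t′ f k
          disj₂ {i} _ j≤ eq = C-Q (on (L ∸ i)) j≤ eq

          disj₁₂ : Disjoint u v c t c′ t′
          disj₁₂ {zero} _ _ _ = inj₁ c0
          disj₁₂ {suc i} {j} i≤ j≤ eq = inj₂ (cong c (ℕ.≤-antisym i≤ (ℕ.≤-trans (t≤L∸ j≤) (ℕ.≤-reflexive (sym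
            (c-inj₁ (s≤s z≤n) (ℕ.≤-trans i≤ (ℕ.<⇒≤ t<L)) (ℕ.≤-trans 1≤t (t≤L∸ j≤)) (ℕ.m∸n≤m L j) eq))))))

          y≡v : k ≡ 1 → y ≡ v
          y≡v refl = fk

          long₁ : ¬ (t ≡ 1 × k ≡ 1)
          long₁ (t1 , k1) = y≢1 (trans (y≡v k1) (cong c t1))

          long₂ : ¬ (t′ ≡ 1 × k ≡ 1)
          long₂ (t1 , k1) = y≢l (trans (y≡v k1) (cong c (trans (sym L∸t′) (cong (L ∸_) t1))))

          long₁₂ : ¬ (t ≡ 1 × t′ ≡ 1)
          long₁₂ (refl , ())

          G₁ : Glued c t f k
          G₁ = glue A₁ Q disj₁ long₁
          module G₁ = Glued G₁

          G₂ : Glued c′ t′ f k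
          G₂ = glue A₂ Q disj₂ long₂
          module G₂ = Glued G₂

          module Ears (G₁C G₂C : Cycle Γ) (T₁ : TightOn G₁C) (T₂ : TightOn G₂C)
            (u∈₁ : OnCycle G₁C u) (v∈₁ : OnCycle G₁C v) (u∈₂ : OnCycle G₂C u) (v∈₂ : OnCycle G₂C v)
            (off₁ : ∀ {x} → OnCycle G₁C x → (∃ λ i → i ≤ t × c i ≡ x) ⊎ (∃ λ j → 1 ≤ j × j < k × f j ≡ x))
            (off₂ : ∀ {x} → OnCycle G₂C x → (∃ λ i → i ≤ t′ × c′ i ≡ x) ⊎ (∃ λ j → 1 ≤ j × j < k × f j ≡ x)) where
            module T₁ = TightOn T₁
            module T₂ = TightOn T₂

            -- The ear `Q` of `C` controls the degrees in its own interior only. For the arcs of `C`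
            -- the roles are exchanged: each arc is an ear of the tight cycle formed by the other
            -- arc and `Q`.
            ear₂ : IsEar T₁.Z c′ t′
            ear₂ = path-ear A₂ (T₁.on⇒ u∈₁) (T₁.on⇒ v∈₁) int
              where
              int : ∀ {i} → 1 ≤ i → i < t′ → ¬ T (T₁.Z (c′ i))
              int {i} 1≤i i< z with off₁ (T₁.⇒on z)
              ... | inj₂ (j , 1≤j , j< , eq) = avoids 1≤j j< (subst (OnCycle C) (sym eq) (on (L ∸ i)))
              ... | inj₁ (j , j≤ , eq) with disj₁₂ j≤ (ℕ.<⇒≤ i<) eq
              ...   | inj₁ e = ℕ.<⇒≢ 1≤i (inj-≤ A₂ z≤n (ℕ.<⇒≤ i<) (trans cL (trans (sym e) eq)))
              ...   | inj₂ e = ℕ.<⇒≢ i< (inj-≤ A₂ (ℕ.<⇒≤ i<) ℕ.≤-refl (trans (sym eq) (trans e (sym (end A₂)))))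

            ear₁ : IsEar T₂.Z c t
            ear₁ = path-ear A₁ (T₂.on⇒ u∈₂) (T₂.on⇒ v∈₂) int
              where
              int : ∀ {i} → 1 ≤ i → i < t → ¬ T (T₂.Z (c i))
              int {i} 1≤i i< z with off₂ (T₂.⇒on z)
              ... | inj₂ (j , 1≤j , j< , eq) = avoids 1≤j j< (subst (OnCycle C) (sym eq) (on i))
              ... | inj₁ (j , j≤ , eq) with disj₁₂ (ℕ.<⇒≤ i<) j≤ (sym eq)
              ...   | inj₁ e = ℕ.<⇒≢ 1≤i (inj-≤ A₁ z≤n (ℕ.<⇒≤ i<) (trans c0 (sym e)))
              ...   | inj₂ e = ℕ.<⇒≢ i< (inj-≤ A₁ (ℕ.<⇒≤ i<) ℕ.≤-refl e)

            deg₁ : ∀ {i} → 1 ≤ i → i < t → deg Γ (c i) ≡ 2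
            deg₁ = ear-deg T₂.tight ear₁

            deg₂ : ∀ {i} → 1 ≤ i → i < t′ → deg Γ (c′ i) ≡ 2
            deg₂ = ear-deg T₁.tight ear₂

            T₁-covered : ∀ {x} → T (T₁.Z x) → Covered x
            T₁-covered z with off₁ (T₁.⇒on z)
            ... | inj₁ (i , _ , refl) = inj₁ (on i)
            ... | inj₂ h = inj₂ h

            T₂-covered : ∀ {x} → T (T₂.Z x) → Covered x
            T₂-covered z with off₂ (T₂.⇒on z)
            ... | inj₁ (i , _ , refl) = inj₁ (on (L ∸ i))
            ... | inj₂ h = inj₂ h

            -- `ear-start-nbr` and `ear-end-nbr` need an ear with an interior vertex. As `L` is at
            -- least 3, one of the two arcs has one.
            data Long : Set where
              long-t  : ∀ {s} → t ≡ 2 + s → Long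
              long-t′ : ∀ {s} → t′ ≡ 2 + s → Long

            which : Long
            which = pick t t′ refl refl
              where
              pick : ∀ a b → t ≡ a → t′ ≡ b → Long
              pick zero _ e _ = ⊥-elim (ℕ.n≮0 (subst (1 ≤_) e 1≤t))
              pick (suc (suc s)) _ e _ = long-t e
              pick (suc zero) zero _ e = ⊥-elim (ℕ.n≮0 (subst (1 ≤_) e 1≤t′))
              pick (suc zero) (suc zero) e e′ = ⊥-elim (long₁₂ (e , e′))
              pick (suc zero) (suc (suc s)) _ e = long-t′ e

            u-nbr : ∀ {j} → Adj Γ u j → Covered j
            u-nbr {j} a with which
            ... | long-t {s} e with j ≟ c 1
            ...   | yes refl = inj₁ (on 1)
            ...   | no ne with ear-start-nbr T₂.tight {s} (subst (IsEar T₂.Z c) e ear₁) (subst (λ x → Adj Γ x j) (sym c0) a) ne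
            ...     | inj₁ z = T₂-covered z
            ...     | inj₂ (i , _ , _ , refl) = inj₁ (on i)
            u-nbr {j} a | long-t′ {s} e with j ≟ c′ 1
            ...   | yes refl = inj₁ (on (L ∸ 1))
            ...   | no ne with ear-start-nbr T₁.tight {s} (subst (IsEar T₁.Z c′) e ear₂) (subst (λ x → Adj Γ x j) (sym cL) a) ne
            ...     | inj₁ z = T₁-covered z
            ...     | inj₂ (i , _ , _ , refl) = inj₁ (on (L ∸ i))

            v-nbr : ∀ {j} → Adj Γ v j → Covered j
            v-nbr {j} a with which
            ... | long-t {s} e with j ≟ c (1 + s)
            ...   | yes refl = inj₁ (on (1 + s))
            ...   | no ne with ear-end-nbr T₂.tight (subst (IsEar T₂.Z c) e ear₁) (subst (λ x → Adj Γ (c x) j) e a) ne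
            ...     | inj₁ z = T₂-covered z
            ...     | inj₂ (i , _ , _ , refl) = inj₁ (on i)
            v-nbr {j} a | long-t′ {s} e with j ≟ c′ (1 + s)
            ...   | yes refl = inj₁ (on (L ∸ (1 + s)))
            ...   | no ne with ear-end-nbr T₁.tight (subst (IsEar T₁.Z c′) e ear₂) (subst (λ x → Adj Γ x j) (trans (sym (end A₂)) (cong c′ e)) a) ne
            ...     | inj₁ z = T₁-covered z
            ...     | inj₂ (i , _ , _ , refl) = inj₁ (on (L ∸ i))

            data Place (x : Fin n) : Set where
              at-u : x ≡ u → Place x
              at-v : x ≡ v → Place x
              in₁  : ∀ {i} → 1 ≤ i → i < t → x ≡ c i → Place x
              in₂  : ∀ {i} → 1 ≤ i → i < t′ → x ≡ c′ i → Place x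
              inQ  : ∀ {i} → 1 ≤ i → i < k → x ≡ f i → Place x

            place : ∀ {x} → Covered x → Place x
            place (inj₂ (i , 1≤i , i< , eq)) = inQ 1≤i i< (sym eq)
            place (inj₁ x∈) with cover x∈
            ... | zero , _ , eq = at-u (trans (sym eq) c0)
            ... | suc i , i<L , eq with ℕ.<-cmp (suc i) t
            ...   | tri< lt _ _ = in₁ (s≤s z≤n) lt (sym eq)
            ...   | tri≈ _ e _ = at-v (trans (sym eq) (cong c e))
            ...   | tri> _ _ gt = in₂ {i = L ∸ suc i} (ℕ.m<n⇒0<n∸m i<L) (ℕ.∸-monoʳ-< gt (ℕ.<⇒≤ i<L))
                (trans (sym eq) (cong c (sym (ℕ.m∸[m∸n]≡n (ℕ.<⇒≤ i<L)))))

            cover-all : ∀ x → Covered x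
            cover-all = closed⇒all conn Covered (inj₁ u∈) (λ a b p ab → go (place p) ab)
              where
              go : ∀ {a b} → Place a → Adj Γ a b → Covered b
              go (at-u refl) ab = u-nbr ab
              go (at-v refl) ab = v-nbr ab
              go (in₁ {i} 1≤i i< refl) ab with interior-nbr A₁ 1≤i i< (deg₁ 1≤i i<) ab
              ... | s , _ , refl = inj₁ (on s)
              go (in₂ {i} 1≤i i< refl) ab with interior-nbr A₂ 1≤i i< (deg₂ 1≤i i<) ab
              ... | s , _ , refl = inj₁ (on (L ∸ s))
              go (inQ 1≤i i< refl) ab = f-nbr-covered 1≤i i< ab

            degC : ∀ {x} → OnCycle C x → x ≢ u → x ≢ f k → deg Γ x ≡ 2
            degC x∈ x≢u x≢k with place (inj₁ x∈)
            ... | at-u e = ⊥-elim (x≢u e)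
            ... | at-v e = ⊥-elim (x≢k (trans e (sym fk)))
            ... | in₁ 1≤i i< refl = deg₁ 1≤i i<
            ... | in₂ 1≤i i< refl = deg₂ 1≤i i<
            ... | inQ 1≤i i< refl = degQ 1≤i i<

            -- The last vertices before `v` on the two arcs and on `Q` are three neighbours. They
            -- differ because `Q` and an arc cannot both be a single edge, by the choice of `y`.
            branch-v : Branch v
            branch-v = at t refl
              where
              k′ = k ∸ 1
              sk′ : suc k′ ≡ k
              sk′ = ℕ.m+[n∸m]≡n 1≤k
              back : Adj Γ v (f k′)
              back = adj-sym (subst (Adj Γ (f k′)) (trans (cong f sk′) fk) (f-adj k′))
              last-≢ : ∀ {x} → OnCycle C x → (k ≡ 1 → x ≢ u) → x ≢ f k′
              last-≢ {x} x∈ x≢u x≡ = case k′ refl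
                where
                case : ∀ j → k′ ≡ j → ⊥
                case zero kj = x≢u (trans (sym sk′) (cong suc kj)) (trans x≡ (cong f kj))
                case (suc j) kj = avoids (s≤s z≤n) (subst (_< k) kj (subst (k′ <_) sk′ ℕ.≤-refl)) (subst (OnCycle C) (trans x≡ (cong f kj)) x∈)
              at : ∀ s → t ≡ s → Branch v
              at zero e = ⊥-elim (ℕ.n≮0 (subst (1 ≤_) e 1≤t))
              at (suc s) e = deg≥3 (subst (λ x → Adj Γ (c x) (c s)) (sym e) (adj-sym (c-walk s))) (c-walk t) back
                (λ eq → seq-no-back pseq s (trans eq (cong (λ x → c (suc x)) e)))
                (last-≢ (on s) (λ k1 eq → long₁ (trans e (cong suc (sym (c-inj (s≤s z≤n) (ℕ.<-trans (subst (s <_) (sym e) ℕ.≤-refl) t<L) (trans c0 (sym eq))))) , k1)))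
                (last-≢ (on (suc t)) (λ k1 eq → long₂ (trans (cong (_∸ t) (sym (c-inj₁ (s≤s z≤n) t<L (s≤s z≤n) ℕ.≤-refl (trans eq (sym cL))))) (ℕ.m+n∸n≡m 1 t) , k1)))

            branch-place : ∀ {x} → Branch x → x ≡ u ⊎ x ≡ v
            branch-place {x} b with place (cover-all x)
            ... | at-u e = inj₁ e
            ... | at-v e = inj₂ e
            ... | in₁ 1≤i i< refl = ⊥-elim (deg2⇒¬branch (deg₁ 1≤i i<) b)
            ... | in₂ 1≤i i< refl = ⊥-elim (deg2⇒¬branch (deg₂ 1≤i i<) b)
            ... | inQ 1≤i i< refl = ⊥-elim (deg2⇒¬branch (degQ 1≤i i<) b)

            -- A neighbour of `u` on `X` lies on one of the three paths, and the vertices of degree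
            -- 2 carry `X` along it to `v`.
            u⇒v : ∀ (X : Cycle Γ) → OnCycle X u → OnCycle X v
            u⇒v X x∈ with around X x∈
            ... | i , _ , a , _ , _ with place (cover-all (vtx X i))
            ...   | at-u e = ⊥-elim (adj-irrefl a (sym e))
            ...   | at-v e = i , e
            ...   | in₁ 1≤i i< e = propagate X A₁ deg₁ 1≤i (ℕ.<⇒≤ i<) (i , e)
            ...   | in₂ 1≤i i< e = propagate X A₂ deg₂ 1≤i (ℕ.<⇒≤ i<) (i , e)
            ...   | inQ 1≤i i< e = propagate X Q degQ 1≤i (ℕ.<⇒≤ i<) (i , e)

            no-pair : NoDisjointPair
            no-pair D E d∈ bd e∈ be disj with branch-place bd | branch-place be
            ... | inj₁ refl | inj₁ refl = disj e∈ d∈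
            ... | inj₂ refl | inj₂ refl = disj e∈ d∈
            ... | inj₁ refl | inj₂ refl = disj e∈ (u⇒v D d∈)
            ... | inj₂ refl | inj₁ refl = disj (u⇒v E e∈) d∈

            P₁ P₂ P₃ : Path Γ u v
            P₁ = toPath A₁
            P₂ = toPath A₂
            P₃ = toPath Q

            Edge : Fin n → Fin n → Set
            Edge a b = PathEdge P₁ a b ⊎ PathEdge P₂ a b ⊎ PathEdge P₃ a b

            Edge-sym : ∀ {a b} → Edge a b → Edge b a
            Edge-sym (inj₁ e) = inj₁ (PathEdge-sym P₁ e)
            Edge-sym (inj₂ (inj₁ e)) = inj₂ (inj₁ (PathEdge-sym P₂ e))
            Edge-sym (inj₂ (inj₂ e)) = inj₂ (inj₂ (PathEdge-sym P₃ e))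

            -- No vertex of degree 2 assigns this edge to a path. If the walk started with a chord,
            -- it stopped at once and `Q` is that edge; otherwise there is no chord at `u`, and the
            -- edge belongs to `C`.
            uv-edge : Adj Γ u v → Edge u v
            uv-edge uv with chord
            ... | inj₁ y∈ = inj₂ (inj₂ (subst (PathEdge P₃ u) (trans (cong f (sym k≡1)) fk) (toPath-edge Q 1≤k)))
              where
              k≡1 : k ≡ 1
              k≡1 with ℕ.m≤n⇒m<n∨m≡n 1≤k
              ... | inj₂ e = sym e
              ... | inj₁ 1<k = ⊥-elim (avoids ℕ.≤-refl 1<k y∈)
            ... | inj₂ h with h (on t) uv
            ...   | inj₁ v≡ = inj₁ (subst (λ x → PathEdge P₁ x v) c0 (subst (PathEdge P₁ (c 0)) (sym v≡) (toPath-edge A₁ 1≤t)))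
            ...   | inj₂ v≡ = inj₂ (inj₁ (subst (λ x → PathEdge P₂ x v) cL (subst (PathEdge P₂ (c L)) (sym v≡) (toPath-edge A₂ 1≤t′))))

            edges : ∀ a b → Adj Γ a b → Edge a b
            edges a b ab = go (place (cover-all a)) (place (cover-all b))
              where
              go : Place a → Place b → Edge a b
              go (in₁ 1≤i i< refl) _ = inj₁ (interior-edge A₁ 1≤i i< (deg₁ 1≤i i<) ab)
              go (in₂ 1≤i i< refl) _ = inj₂ (inj₁ (interior-edge A₂ 1≤i i< (deg₂ 1≤i i<) ab))
              go (inQ 1≤i i< refl) _ = inj₂ (inj₂ (interior-edge Q 1≤i i< (degQ 1≤i i<) ab))
              go _ (in₁ 1≤i i< refl) = Edge-sym (inj₁ (interior-edge A₁ 1≤i i< (deg₁ 1≤i i<) (adj-sym ab)))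
              go _ (in₂ 1≤i i< refl) = Edge-sym (inj₂ (inj₁ (interior-edge A₂ 1≤i i< (deg₂ 1≤i i<) (adj-sym ab))))
              go _ (inQ 1≤i i< refl) = Edge-sym (inj₂ (inj₂ (interior-edge Q 1≤i i< (degQ 1≤i i<) (adj-sym ab))))
              go (at-u refl) (at-u refl) = ⊥-elim (adj-irrefl ab refl)
              go (at-v refl) (at-v refl) = ⊥-elim (adj-irrefl ab refl)
              go (at-u refl) (at-v refl) = uv-edge ab
              go (at-v refl) (at-u refl) = Edge-sym (uv-edge (adj-sym ab))

            on-paths : ∀ x → OnPath P₁ x ⊎ OnPath P₂ x ⊎ OnPath P₃ x
            on-paths x with place (cover-all x)
            ... | at-u refl = inj₁ (subst (OnPath P₁) c0 (toPath-on A₁ z≤n))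
            ... | at-v refl = inj₁ (toPath-on A₁ ℕ.≤-refl)
            ... | in₁ _ i< refl = inj₁ (toPath-on A₁ (ℕ.<⇒≤ i<))
            ... | in₂ _ i< refl = inj₂ (inj₁ (toPath-on A₂ (ℕ.<⇒≤ i<)))
            ... | inQ _ i< refl = inj₂ (inj₂ (toPath-on Q (ℕ.<⇒≤ i<)))

            2≤excess : 2 ≤ excess Γ
            2≤excess = ℕ.≤-trans (ℕ.+-mono-≤ (ℕ.∸-monoˡ-≤ 2 branch-u) (ℕ.∸-monoˡ-≤ 2 branch-v)) (sum-lookup₂≤ (λ x → deg Γ x ∸ 2) u≢v)

            bound : ∀ {a} (i : Fin (suc a)) → toℕ i ≤ a
            bound i = ℕ.≤-pred (toℕ<n i)

            theta-outcome : Outcome C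
            theta-outcome = shaped (nullity-C cover-all degC 2≤excess)
              (inj₂ (u , v , P₁ , P₂ , P₃ , (λ i j → disj₁₂ (bound i) (bound j)) , (λ i j → disj₁ (bound i) (bound j)) ,
                (λ i j → disj₂ (bound i) (bound j)) , long₁₂ , long₁ , long₂ , on-paths , edges)) no-pair

        theta : Outcome C
        theta = Ears.theta-outcome G₁.C G₂.C (tightOn G₁.C u∈₁ branch-u dim) (tightOn G₂.C u∈₂ branch-u dim) u∈₁
          (G₁.on-p ℕ.≤-refl) u∈₂ (subst (OnCycle G₂.C) (cong c L∸t′) (G₂.on-p ℕ.≤-refl)) G₁.off G₂.off
          where
          u∈₁ : OnCycle G₁.C u
          u∈₁ = subst (OnCycle G₁.C) c0 (G₁.on-p z≤n)
          u∈₂ : OnCycle G₂.C u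
          u∈₂ = subst (OnCycle G₂.C) cL (G₂.on-p z≤n)

    outcome : FirstHit (OnCycle C) f → Outcome C
    outcome h = from hit
      where
      open FirstHit h
      open Hit k 1≤k avoids distinct
      from : OnCycle C (f k) ⊎ (∃ λ j → 1 ≤ j × j < k × f k ≡ f j) → Outcome C
      from (inj₂ (j , 1≤j , j<k , eq)) = self-hit 1≤j j<k eq
      from (inj₁ e) with cover e
      ... | suc t , t< , eq = Theta.theta (suc t) (s≤s z≤n) t< (sym eq)
      ... | zero , _ , eq = round (loopSeq f-adj (stroll-no-back u y) 1≤k fk di)
        where
        fk : f k ≡ u
        fk = trans (sym eq) c0
        di : ∀ {a b} → 0 ≤ a → a < k → 0 ≤ b → b < k → f a ≡ f b → a ≡ b
        di {zero} {zero} _ _ _ _ _ = refl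
        di {zero} {suc b} _ _ _ b< q = ⊥-elim (avoids (s≤s z≤n) b< (subst (OnCycle C) q u∈))
        di {suc a} {zero} _ a< _ _ q = ⊥-elim (avoids (s≤s z≤n) a< (subst (OnCycle C) (sym q) u∈))
        di {suc a} {suc b} _ a< _ b< q = distinct (s≤s z≤n) a< (s≤s z≤n) b< q
        round : (∃ λ m → 3 + m ≡ k × CycSeq f (3 + m)) → Outcome C
        round (m′ , e , s) = Infinity.infinity m′ (sym e) s fk

  chooseStart : ∀ (C : Cycle Γ) (O : Orientation C) {u} → Branch u → Start C O u
  chooseStart C O {u} b with any? (λ j → adj? u j ×-dec onCycle? C j ×-dec ¬? (j ≟ Orientation.seq O 1) ×-dec ¬? (j ≟ Orientation.seq O (2 + len C)))
  ... | yes (j , uj , j∈ , j≢1 , j≢l) = record { y = j ; uy = uj ; y≢1 = j≢1 ; y≢l = j≢l ; chord = inj₁ j∈ }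
  ... | no none with deg-∃∉ (Orientation.seq O 1 ∷ Orientation.seq O (2 + len C) ∷ []) b
  ...   | j , uj , j∉ = record { y = j ; uy = uj ; y≢1 = λ e → j∉ (here e) ; y≢l = λ e → j∉ (there (here e)) ; chord = inj₂ only }
    where
    only : ∀ {j} → OnCycle C j → Adj Γ u j → j ≡ Orientation.seq O 1 ⊎ j ≡ Orientation.seq O (2 + len C)
    only {j} j∈ uj with j ≟ Orientation.seq O 1 | j ≟ Orientation.seq O (2 + len C)
    ... | yes e | _ = inj₁ e
    ... | no _ | yes e = inj₂ e
    ... | no ne | no ne′ = ⊥-elim (none (j , uj , j∈ , ne , ne′))

  analyse : ∀ (C : Cycle Γ) {u} → OnCycle C u → Branch u → Outcome C
  analyse C {u} u∈ b = Analysis.outcome C O (proj₂ (orientFrom C u∈)) b (tightOn C u∈ b dim) st (firstHit (onCycle? C) (stroll u (Start.y st)))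
    where
    O = proj₁ (orientFrom C u∈)
    st = chooseStart C O b

  -- A cycle whose vertices all have degree 2 is closed under adjacency, hence the whole graph,
  -- which leaves no place for `b`.
  branch-on : ∀ {b} → Branch b → (C : Cycle Γ) → ∃ λ u → OnCycle C u × Branch u
  branch-on {b} bb C with any? (λ i → 3 ℕ.≤? deg Γ (vtx C i))
  ... | yes (i , h) = vtx C i , (i , refl) , h
  ... | no none = ⊥-elim (none (proj₁ b∈ , subst Branch (sym (proj₂ b∈)) bb))
    where
    d2 : ∀ {v} → OnCycle C v → deg Γ v ≡ 2
    d2 (i , refl) = ℕ.≤-antisym (ℕ.≤-pred (ℕ.≰⇒> (λ h → none (i , h)))) (2≤deg _)
    b∈ : OnCycle C b
    b∈ = closed⇒all conn (OnCycle C) (zero , refl) (λ a x a∈ ax → proj₂ (CycleEdge-on C (deg2-edge C a∈ (d2 a∈) ax))) b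

  branch⇒forms : ∀ {b} → Branch b → Form1 Γ ⊎ Form2 Γ ⊎ Form3 Γ
  branch⇒forms {b} bb = let (u , u∈ , bu) = branch-on bb C in result (analyse C u∈ bu)
    where
    C = min-deg-cycle b
    all-null : NoDisjointPair → AllCyclesNullity2 Γ
    all-null np D = let (d , d∈ , bd) = branch-on bb D in null-of d∈ bd (analyse D d∈ bd)
      where
      null-of : ∀ {d} → OnCycle D d → Branch d → Outcome D → cycleNullity≡ D 2
      null-of d∈ bd (shaped nul _ _) = nul
      null-of d∈ bd (pendant-away E P disj) = ⊥-elim (np D E d∈ bd (Pendant.w∈ P) (ℕ.≤-reflexive (sym (Pendant.deg-w P))) disj)
    result : Outcome C → Form1 Γ ⊎ Form2 Γ ⊎ Form3 Γ
    result (pendant-away E P _) = inj₁ (pendant⇒Form1 Γ sg conn dim E P)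
    result (shaped _ (inj₁ s) np) = inj₂ (inj₁ (s , all-null np))
    result (shaped _ (inj₂ s) np) = inj₂ (inj₂ (s , all-null np))

  -- A connected 2-regular graph is a cycle, whose nullity is not 1.
  2-regular⇒⊥ : Fin n → (∀ v → deg Γ v ≡ 2) → ¬ KerDimAtLeast (adjMat Γ) (2 + excess Γ) → ⊥
  2-regular⇒⊥ a d2 ¬dim = use (dim-nonzero (fromKer (adjMat Γ) dim))
    where
    C = min-deg-cycle a
    on-C : ∀ v → OnCycle C v
    on-C = closed⇒all conn (OnCycle C) (zero , refl) (λ a x a∈ ax → proj₂ (CycleEdge-on C (deg2-edge C a∈ (d2 _) ax)))
    excess-0 : excess Γ ≡ 0
    excess-0 = trans (sum-cong (λ v → cong (_∸ 2) (d2 v))) (sum-0 {n})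
    not-off : ∀ i j → Adj Γ (vtx C (next i)) j → j ≢ vtx C i → j ≢ vtx C (next (next i)) → ⊥
    not-off i j a ne ne′ with cycleEdge-nbr C (deg2-edge C (next i , refl) (d2 _) a)
    ... | inj₁ e = ne e
    ... | inj₂ e = ne′ e
    lift : ∀ {z} → Tri C z → Ker (adjMat Γ) (ext C z)
    lift {z} t = ker λ v → at (on-C v)
      where
      at : ∀ {v} → OnCycle C v → row v (ext C z) ≡ 0ℚ
      at (i , refl) = subst (λ s → row (vtx C s) (ext C z) ≡ 0ℚ) (next-prev i) (Tri⇒row C (ext-Tri C t) (prev i) (λ j a ne ne′ → ⊥-elim (not-off (prev i) j a ne ne′)))
    two : (∃ λ z → Tri C z × z zero ≡ 0ℚ × z (next zero) ≡ 1ℚ) → (∃ λ z → Tri C z × z (next zero) ≡ 0ℚ × z zero ≡ 1ℚ) → ⊥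
    two (z , tz , z0 , z1) (y , ty , y1 , y0) = ¬dim (subst (λ e → KerDimAtLeast (adjMat Γ) (2 + e)) (sym excess-0)
      (toKer (adjMat Γ) (adjoin-all 2 {vs = λ ()} (λ _ _ ()) (λ ()) vecs coords (λ { zero → lift tz ; (suc zero) → lift ty })
        (λ { zero → unit z1 ; (suc zero) → unit y0 }) off (λ ()))))
      where
      vecs : Fin 2 → Fin n → ℚ
      vecs zero = ext C z
      vecs (suc zero) = ext C y
      coords : Fin 2 → Fin n
      coords zero = vtx C (next zero)
      coords (suc zero) = vtx C zero
      unit : ∀ {z i} → z i ≡ 1ℚ → ext C z (vtx C i) ≢ 0ℚ
      unit {z} {i} z1 e with trans (sym z1) (trans (sym (ext-vtx C z i)) e)
      ... | ()
      off : ∀ a b → a ≢ b → vecs a (coords b) ≡ 0ℚ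
      off zero zero ne = ⊥-elim (ne refl)
      off zero (suc zero) _ = trans (ext-vtx C z zero) z0
      off (suc zero) zero _ = trans (ext-vtx C y (next zero)) y1
      off (suc zero) (suc zero) ne = ⊥-elim (ne refl)
    use : (∃ λ x → Ker (adjMat Γ) x × ∃ λ q → x q ≢ 0ℚ) → ⊥
    use (x , kx , q , xq) = let (i , e) = on-C q in finish (nonzero⇒nullity2 C (kernel⇒Tri-restrict C kx (λ i j a ne ne′ → ⊥-elim (not-off i j a ne ne′)))
        {i} (λ x0 → xq (trans (cong x (sym e)) x0)))
      where
      finish : cycleNullity≡ C 2 → ⊥
      finish (D , _) = two (kernel-01 C D zero) (kernel-10 C D zero)

-- Nullity of trees with cycles and of ∞-graphs

1ℚ≢0ℚ : 1ℚ ≢ 0ℚ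
1ℚ≢0ℚ ()

abstract
  unit : ∀ {n} → Fin n → Fin n → ℚ
  unit a j = if does (j ≟ a) then 1ℚ else 0ℚ

  unit-≡ : ∀ {n} {a j : Fin n} → j ≡ a → unit a j ≡ 1ℚ
  unit-≡ {a = a} {j} eq with j ≟ a
  ... | yes _ = refl
  ... | no ne = ⊥-elim (ne eq)

  unit-≢ : ∀ {n} {a j : Fin n} → j ≢ a → unit a j ≡ 0ℚ
  unit-≢ {a = a} {j} ne with j ≟ a
  ... | yes eq = ⊥-elim (ne eq)
  ... | no _ = refl

rowOf-unit : ∀ {n} (A : Fin n → Fin n → ℚ) a i → rowOf A (unit a) i ≡ A i a
rowOf-unit A a i = trans (∑-single (λ j → A i j *ℚ unit a j) a (λ j ne → trans (cong (A i j *ℚ_) (unit-≢ ne)) (ℚ.*-zeroʳ (A i j))))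
  (trans (cong (A i a *ℚ_) (unit-≡ refl)) (ℚ.*-identityʳ (A i a)))

module Attached {n} (Γ : SGraph n) (sg : IsSignedGraph Γ) (C : Cycle Γ) (i₀ : Fin (3 + len C))
  (only-edges : ∀ {v j} → Adj Γ v j → OnCycle C j → j ≢ vtx C i₀ → CycleEdge C v j) where

  open Basic Γ sg
  open Cycles Γ sg

  private
    A = adjMat Γ
    w = vtx C i₀
    q = vtx C (next i₀)

  row-on : ∀ {z v} → Tri C z → OnCycle C v → row v (ext C z) ≡ 0ℚ
  row-on {z} t (i , refl) = subst (λ s → row (vtx C s) (ext C z) ≡ 0ℚ) (next-prev i) (Tri⇒row C (ext-Tri C t) (prev i) off)
    where
    edge : ∀ {j} → Adj Γ (vtx C (next (prev i))) j → OnCycle C j → CycleEdge C (vtx C (next (prev i))) j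
    edge {j} a j∈ with j ≟ w
    ... | no j≢w = only-edges a j∈ j≢w
    ... | yes refl = CycleEdge-sym C (only-edges (adj-sym a) (next (prev i) , refl) (adj-irrefl a))
    off : ∀ j → Adj Γ (vtx C (next (prev i))) j → j ≢ vtx C (prev i) → j ≢ vtx C (next (next (prev i))) → ext C z j ≡ 0ℚ
    off j a ne ne′ = ext-off C z λ j∈ → contra (cycleEdge-nbr C (edge a j∈))
      where
      contra : j ≡ vtx C (prev i) ⊎ j ≡ vtx C (next (next (prev i))) → ⊥
      contra (inj₁ e) = ne e
      contra (inj₂ e) = ne′ e

  row-off : ∀ {z v} → ¬ OnCycle C v → row v (ext C z) ≡ A v w *ℚ z i₀
  row-off {z} {v} v∉ = trans (row-single (ext C z) others) (cong (A v w *ℚ_) (ext-vtx C z i₀))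
    where
    others : ∀ j → Adj Γ v j → j ≢ w → ext C z j ≡ 0ℚ
    others j vj j≢w = ext-off C z (λ j∈ → v∉ (proj₁ (CycleEdge-on C (only-edges vj j∈ j≢w))))

  -- `Z` is the kernel vector of the cycle with values 0 at `w` and 1 at `q`; `W` is the one with
  -- values 1 and 0, minus the unit vector at `w`. A vector that vanishes on the rest of `C` is
  -- continued into `C` by adding `W` times its value at `w`: the rows of `W` cancel the entries
  -- towards `w` inside `C` and disturb no other equation.
  record Vectors : Set where
    field
      Z W   : Fin n → ℚ
      Z-ker : Ker A Z
      Z-q   : Z q ≡ 1ℚ
      Z-w   : Z w ≡ 0ℚ
      Z-off : ∀ {v} → ¬ OnCycle C v → Z v ≡ 0ℚ
      W-w   : W w ≡ 0ℚ
      W-q   : W q ≡ 0ℚ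
      W-off : ∀ {v} → ¬ OnCycle C v → W v ≡ 0ℚ
      row-W-body : ∀ {v} → OnCycle C v → v ≢ w → row v W ≡ - A v w
      row-W-else : ∀ {v} → ¬ OnCycle C v ⊎ v ≡ w → row v W ≡ 0ℚ

  vectors : cycleNullity≡ C 2 → Vectors
  vectors (D , _) = build (kernel-01 C D i₀) (kernel-10 C D i₀)
    where
    build : (∃ λ z → Tri C z × z i₀ ≡ 0ℚ × z (next i₀) ≡ 1ℚ) → (∃ λ z → Tri C z × z (next i₀) ≡ 0ℚ × z i₀ ≡ 1ℚ) → Vectors
    build (z , tz , z0 , z1) (y , ty , y1 , y0) = record
      { Z = ext C z ; W = W₀
      ; Z-ker = ker λ v → Z-row v (onCycle? C v)
      ; Z-q = trans (ext-vtx C z (next i₀)) z1 ; Z-w = trans (ext-vtx C z i₀) z0 ; Z-off = ext-off C z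
      ; W-w = trans (cong₂ (λ a b → a +ℚ (- 1ℚ) *ℚ b) (trans (ext-vtx C y i₀) y0) (unit-≡ refl)) refl
      ; W-q = trans (cong₂ (λ a b → a +ℚ (- 1ℚ) *ℚ b) (trans (ext-vtx C y (next i₀)) y1) (unit-≢ (λ e → next≢ i₀ (inj C e)))) refl
      ; W-off = λ v∉ → trans (cong₂ (λ a b → a +ℚ (- 1ℚ) *ℚ b) (ext-off C y v∉) (unit-≢ (λ { refl → v∉ (i₀ , refl) }))) refl
      ; row-W-body = λ {v} v∈ _ → trans (W-row v) (trans (cong (_+ℚ (- 1ℚ) *ℚ A v w) (row-on ty v∈))
          (solve 1 (λ a → con 0ℚ :+ (:- con 1ℚ) :* a := :- a) refl (A v w)))
      ; row-W-else = λ {v} h → trans (W-row v) (else v h) }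
      where
      open ℚ-Solver
      W₀ : Fin n → ℚ
      W₀ v = ext C y v +ℚ (- 1ℚ) *ℚ unit w v
      Z-row : ∀ v → Dec (OnCycle C v) → row v (ext C z) ≡ 0ℚ
      Z-row v (yes v∈) = row-on tz v∈
      Z-row v (no v∉) = trans (row-off {z} v∉) (trans (cong (A v w *ℚ_) z0) (ℚ.*-zeroʳ (A v w)))
      W-row : ∀ v → row v W₀ ≡ row v (ext C y) +ℚ (- 1ℚ) *ℚ A v w
      W-row v = trans (rowOf-+* A (ext C y) (- 1ℚ) (unit w) v) (cong (λ t → row v (ext C y) +ℚ (- 1ℚ) *ℚ t) (rowOf-unit A w v))
      else : ∀ v → ¬ OnCycle C v ⊎ v ≡ w → row v (ext C y) +ℚ (- 1ℚ) *ℚ A v w ≡ 0ℚ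
      else v (inj₁ v∉) = trans (cong (_+ℚ (- 1ℚ) *ℚ A v w) (trans (row-off {y} v∉) (cong (A v w *ℚ_) y0)))
        (solve 1 (λ a → a :* con 1ℚ :+ (:- con 1ℚ) :* a := con 0ℚ) refl (A v w))
      else v (inj₂ refl) = trans (cong₂ (λ a b → a +ℚ (- 1ℚ) *ℚ b) (row-on ty (i₀ , refl)) (A-nonadj (λ a → adj-irrefl a refl))) refl

module Converse {n} (Γ : SGraph n) (sg : IsSignedGraph Γ) (conn : Connected Γ) (1≤c : 1 ≤ cyc Γ) where

  open Basic Γ sg
  open Cycles Γ sg
  open Structure Γ sg conn

  private A = adjMat Γ

  -- The upper bound comes from any cycle through a branch vertex, so for each form it remains to
  -- exhibit enough independent kernel vectors.
  exact : (C : Cycle Γ) → ∀ {u} → OnCycle C u → 3 ≤ deg Γ u → ∀ {d} → suc (excess Γ) ≤ d → DimAtLeast (Ker A) d →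
    η≡ Γ (2 * cyc Γ + pendant Γ ∸ 1)
  exact C u∈ b le D = subst (η≡ Γ) (sym (2cyc+pendant∸1 Γ sg (connected⇒deg≥1 conn (adj C zero)) 1≤c))
    (toKer A (dim-≤ (Ker-subspace A) le D) , cycle⇒nullity≤ C u∈ b)

  module FromTree (F : TreeWithCycles (cyc Γ) Γ) where
    open TreeWithCycles F

    private
      k = cyc Γ
      tree-graph = induced Γ f
      module BT = Basic tree-graph (induced-signed f sg)

      w : Fin k → Fin n
      w a = f (leaf a)

      same-cycle : ∀ {a b v} → OnCycle (C a) v → OnCycle (C b) v → a ≡ b
      same-cycle {a} {b} (i , p) (j , q) with a ≟ b
      ... | yes e = e
      ... | no ne = ⊥-elim (disjoint a b ne i j (trans p (sym q)))

      only-edges : ∀ a {v j} → Adj Γ v j → OnCycle (C a) j → j ≢ w a → CycleEdge (C a) v j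
      only-edges a {v} {j} vj j∈ j≢w with edges v j vj
      ... | inj₁ (_ , j′ , _ , refl) = ⊥-elim (j≢w (cong f (only-leaf a j′ j∈)))
      ... | inj₂ (b , ce) with same-cycle j∈ (proj₂ (CycleEdge-on (C b) ce))
      ...   | refl = ce

      i₀ : ∀ a → Fin (3 + len (C a))
      i₀ a = proj₁ (on-leaf a)

      module At (a : Fin k) = Attached Γ sg (C a) (i₀ a) (λ vj j∈ ne → only-edges a vj j∈ (λ e → ne (trans e (sym (proj₂ (on-leaf a))))))

      q : Fin k → Fin n
      q a = vtx (C a) (next (i₀ a))

      q∉tree : ∀ a i → f i ≢ q a
      q∉tree a i e with only-leaf a i (next (i₀ a) , sym e)
      ... | refl = next≢ (i₀ a) (inj (C a) (trans (sym e) (sym (proj₂ (on-leaf a)))))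

      leaf-nbr : ∀ a → ∃ λ j → Adj tree-graph (leaf a) j × j ∉ []
      leaf-nbr a = BT.deg-∃∉ [] (ℕ.≤-reflexive (sym (leaf-deg a)))

      branch : ∀ a → 3 ≤ deg Γ (w a)
      branch a with around (C a) (on-leaf a) | leaf-nbr a
      ... | i , _ , x , y , ne | j , z , _ = deg≥3 x y z ne (off (i , refl)) (off (next (next i) , refl))
        where
        off : ∀ {v} → OnCycle (C a) v → v ≢ f j
        off v∈ refl = BT.adj-irrefl z (sym (only-leaf a j v∈))

    -- A leaf of Γ is a leaf of the tree other than the attachment leaves.
    pendants : pendant Γ + k ≤ pendant tree-graph
    pendants = subst (λ p → p + k ≤ pendant tree-graph) size≡
      (injection≤count {P = λ v → deg tree-graph v ≡ᵇ 1} {h} h-inj (λ i → choose-T (splitAt size i)))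
      where
      open Enumeration (enumerate (λ v → deg Γ v ≡ᵇ 1))
      d1 : ∀ i → deg Γ (elt i) ≡ 1
      d1 i = ℕ.≡ᵇ⇒≡ _ 1 (elt-T i)
      not-on : ∀ i a → ¬ OnCycle (C a) (elt i)
      not-on i a c = ℕ.1+n≰n (subst (2 ≤_) (d1 i) (onCycle⇒deg≥2 (C a) c))
      idx : ∀ i → ∃ λ j → f j ≡ elt i
      idx i with cover (elt i)
      ... | inj₁ p = p
      ... | inj₂ (a , c) = ⊥-elim (not-on i a c)
      idx-deg : ∀ i → deg tree-graph (proj₁ (idx i)) ≡ 1
      idx-deg i with deg-∃∉ {elt i} [] (ℕ.≤-reflexive (sym (d1 i)))
      ... | x , ix , _ with edges (elt i) x ix
      ...   | inj₂ (a , ce) = ⊥-elim (not-on i a (proj₁ (CycleEdge-on (C a) ce)))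
      ...   | inj₁ (s , t , fs , ft) = ℕ.≤-antisym (BT.deg≤ (t ∷ []) uniq) (BT.deg≥1 {proj₁ (idx i)} {t} (subst (λ v → Adj Γ v (f t)) (sym (proj₂ (idx i))) (subst (Adj Γ (elt i)) (sym ft) ix)))
        where
        uniq : ∀ j → Adj tree-graph (proj₁ (idx i)) j → j ∈ (t ∷ [])
        uniq j a with f j ≟ x
        ... | yes e = here (f-inj (trans e (sym ft)))
        ... | no ne = ⊥-elim (ℕ.1+n≰n (subst (2 ≤_) (d1 i) (deg≥2 (subst (λ v → Adj Γ v (f j)) (proj₂ (idx i)) a) ix ne)))
      choose : Fin size ⊎ Fin k → Fin m
      choose = [ (λ i → proj₁ (idx i)) , leaf ]′
      choose-T : ∀ s → T (deg tree-graph (choose s) ≡ᵇ 1)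
      choose-T (inj₁ i) = ℕ.≡⇒≡ᵇ _ 1 (idx-deg i)
      choose-T (inj₂ a) = ℕ.≡⇒≡ᵇ _ 1 (leaf-deg a)
      idx≢leaf : ∀ i a → proj₁ (idx i) ≢ leaf a
      idx≢leaf i a e = not-on i a (subst (OnCycle (C a)) (trans (cong f (sym e)) (proj₂ (idx i))) (on-leaf a))
      choose-inj : ∀ s t → choose s ≡ choose t → s ≡ t
      choose-inj (inj₁ i) (inj₁ j) e = cong inj₁ (elt-inj (trans (sym (proj₂ (idx i))) (trans (cong f e) (proj₂ (idx j)))))
      choose-inj (inj₁ i) (inj₂ a) e = ⊥-elim (idx≢leaf i a e)
      choose-inj (inj₂ a) (inj₁ i) e = ⊥-elim (idx≢leaf i a (sym e))
      choose-inj (inj₂ a) (inj₂ b) e = cong inj₂ (leaf-inj e)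
      h : Fin (size + k) → Fin m
      h i = choose (splitAt size i)
      h-inj : Injective _≡_ _≡_ h
      h-inj {i} {j} e = trans (sym (join-splitAt size k i)) (trans (cong (join size k) (choose-inj (splitAt size i) (splitAt size j) e)) (join-splitAt size k j))

    module _ (V : ∀ a → At.Vectors a) where
      private
        module V (a : Fin k) = At.Vectors a (V a)

        inTree? : ∀ v → Dec (∃ λ i → f i ≡ v)
        inTree? v = any? (λ i → f i ≟ v)

        E : (Fin m → ℚ) → Fin n → ℚ
        E t v with inTree? v
        ... | yes (i , _) = t i
        ... | no _ = 0ℚ

        E-f : ∀ t i → E t (f i) ≡ t i
        E-f t i with inTree? (f i)
        ... | yes (j , e) = cong t (f-inj e)
        ... | no ne = ⊥-elim (ne (i , refl))

        E-off : ∀ t {v} → (∀ i → f i ≢ v) → E t v ≡ 0ℚ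
        E-off t {v} h with inTree? v
        ... | yes (i , e) = ⊥-elim (h i e)
        ... | no _ = refl

        S : (Fin m → ℚ) → Fin n → ℚ
        S t v = ∑ (λ a → t (leaf a) *ℚ V.W a v)

        X : (Fin m → ℚ) → Fin n → ℚ
        X t v = E t v +ℚ 1ℚ *ℚ S t v

        W-f : ∀ a i → V.W a (f i) ≡ 0ℚ
        W-f a i with onCycle? (C a) (f i)
        ... | no off = V.W-off a off
        ... | yes on with only-leaf a i on
        ...   | refl = trans (cong (V.W a) (sym (proj₂ (on-leaf a)))) (V.W-w a)

        X-f : ∀ t i → X t (f i) ≡ t i
        X-f t i = trans (cong₂ (λ a b → a +ℚ 1ℚ *ℚ b) (E-f t i) (∑-0 (λ a → trans (cong (t (leaf a) *ℚ_) (W-f a i)) (ℚ.*-zeroʳ (t (leaf a))))))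
          (solve 1 (λ a → a :+ con 1ℚ :* con 0ℚ := a) refl (t i))
          where open ℚ-Solver

        q∉ : ∀ a b → a ≢ b → ¬ OnCycle (C a) (q b)
        q∉ a b ne c = ne (same-cycle c (next (i₀ b) , refl))

        X-q : ∀ t b → X t (q b) ≡ 0ℚ
        X-q t b = trans (cong₂ (λ a b → a +ℚ 1ℚ *ℚ b) (E-off t (q∉tree b)) (∑-0 (λ a → trans (cong (t (leaf a) *ℚ_) (W-q a)) (ℚ.*-zeroʳ (t (leaf a)))))) refl
          where
          W-q : ∀ a → V.W a (q b) ≡ 0ℚ
          W-q a with a ≟ b
          ... | yes refl = V.W-q a
          ... | no ne = V.W-off a (q∉ a b ne)

        row-S : ∀ t v → row v (S t) ≡ ∑ (λ a → t (leaf a) *ℚ row v (V.W a))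
        row-S t v = begin
          ∑ (λ j → A v j *ℚ ∑ (λ a → t (leaf a) *ℚ V.W a j)) ≡⟨ ∑-cong (λ j → sym (∑-*ˡ (A v j) (λ a → t (leaf a) *ℚ V.W a j))) ⟩
          ∑ (λ j → ∑ (λ a → A v j *ℚ (t (leaf a) *ℚ V.W a j))) ≡⟨ ∑-swap (λ j a → A v j *ℚ (t (leaf a) *ℚ V.W a j)) ⟩
          ∑ (λ a → ∑ (λ j → A v j *ℚ (t (leaf a) *ℚ V.W a j)))
            ≡⟨ ∑-cong (λ a → trans (∑-cong (λ j → solve 3 (λ x y z → x :* (y :* z) := y :* (x :* z)) refl (A v j) (t (leaf a)) (V.W a j)))
                 (∑-*ˡ (t (leaf a)) (λ j → A v j *ℚ V.W a j))) ⟩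
          ∑ (λ a → t (leaf a) *ℚ row v (V.W a)) ∎
          where
          open ≡-Reasoning
          open ℚ-Solver

        row-E-f : ∀ t → Ker (adjMat tree-graph) t → ∀ i → row (f i) (E t) ≡ 0ℚ
        row-E-f t kt i = trans (sym (∑-image f f-inj (λ v → A (f i) v *ℚ E t v) (λ v h → trans (cong (A (f i) v *ℚ_) (E-off t h)) (ℚ.*-zeroʳ (A (f i) v)))))
          (trans (∑-cong (λ j → cong (A (f i) (f j) *ℚ_) (E-f t j))) (rows kt i))

        -- At tree vertices the rows of every `W` vanish and the tree equation is left. At the other
        -- vertices of cycle `a`, `E t` contributes only through the leaf, and the multiple of `W`
        -- cancels this.
        X-ker : ∀ t → Ker (adjMat tree-graph) t → Ker A (X t)
        X-ker t kt = ker λ v → trans (rowOf-+* A (E t) 1ℚ (S t) v) (at v (inTree? v))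
          where
          open ℚ-Solver
          at : ∀ v → Dec (∃ λ i → f i ≡ v) → row v (E t) +ℚ 1ℚ *ℚ row v (S t) ≡ 0ℚ
          at v (yes (i , refl)) = trans (cong₂ (λ a b → a +ℚ 1ℚ *ℚ b) (row-E-f t kt i) (trans (row-S t (f i)) (∑-0 zero-term))) refl
            where
            zero-term : ∀ a → t (leaf a) *ℚ row (f i) (V.W a) ≡ 0ℚ
            zero-term a = trans (cong (t (leaf a) *ℚ_) (V.row-W-else a side)) (ℚ.*-zeroʳ (t (leaf a)))
              where
              side : ¬ OnCycle (C a) (f i) ⊎ f i ≡ vtx (C a) (i₀ a)
              side with onCycle? (C a) (f i)
              ... | no off = inj₁ off
              ... | yes on = inj₂ (trans (cong f (only-leaf a i on)) (sym (proj₂ (on-leaf a))))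
          at v (no not-tree) with cover v
          ... | inj₁ p = ⊥-elim (not-tree p)
          ... | inj₂ (a , v∈) = trans (cong₂ (λ x y → x +ℚ 1ℚ *ℚ y) row-E (trans (row-S t v) row-sum))
                (solve 2 (λ x y → x :* y :+ con 1ℚ :* (y :* (:- x)) := con 0ℚ) refl (A v (w a)) (t (leaf a)))
            where
            v≢w : v ≢ w a
            v≢w e = not-tree (leaf a , sym e)
            row-E : row v (E t) ≡ A v (w a) *ℚ t (leaf a)
            row-E = trans (row-single (E t) others) (cong (A v (w a) *ℚ_) (E-f t (leaf a)))
              where
              others : ∀ j → Adj Γ v j → j ≢ w a → E t j ≡ 0ℚ
              others j vj j≢w = E-off t λ i fi≡j → not-both i fi≡j (CycleEdge-on (C a) (only-edges a (adj-sym vj) v∈ v≢w))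
                where
                not-both : ∀ i → f i ≡ j → OnCycle (C a) j × OnCycle (C a) v → ⊥
                not-both i refl (j∈ , _) = j≢w (cong f (only-leaf a i j∈))
            w≡ : vtx (C a) (i₀ a) ≡ w a
            w≡ = proj₂ (on-leaf a)
            row-sum : ∑ (λ b → t (leaf b) *ℚ row v (V.W b)) ≡ t (leaf a) *ℚ (- A v (w a))
            row-sum = trans (∑-single (λ b → t (leaf b) *ℚ row v (V.W b)) a
                (λ b b≢a → trans (cong (t (leaf b) *ℚ_) (V.row-W-else b (inj₁ (λ v∈b → b≢a (same-cycle v∈b v∈))))) (ℚ.*-zeroʳ (t (leaf b)))))
              (cong (t (leaf a) *ℚ_) (trans (V.row-W-body a v∈ (λ e → v≢w (trans e w≡))) (cong (λ x → - A v x) w≡)))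

      -- The vectors `X` restrict to an independent family on the tree and vanish at every `q a`,
      -- where the vectors `Z` of the cycles are diagonal.
      dimension : DimAtLeast (Ker A) (k + (pendant tree-graph ∸ 1))
      dimension = build nullity
        where
        build : η≡ tree-graph (pendant tree-graph ∸ 1) → DimAtLeast (Ker A) (k + (pendant tree-graph ∸ 1))
        build ((vs , ind , p) , _) = adjoin-all {P = Ker A} k {vs = λ i → X (vs i)} ind′ (λ i → X-ker (vs i) (ker (p i)))
            V.Z q V.Z-ker (λ a e → 1ℚ≢0ℚ (trans (sym (V.Z-q a)) e)) (λ a b ne → V.Z-off a (q∉ a b ne)) (λ i a → X-q (vs i) a)
          where
          ind′ : LinIndep (λ i → X (vs i))
          ind′ c eq = ind c (λ j → trans (∑-cong (λ i → cong (c i *ℚ_) (sym (X-f (vs i) j)))) (eq (f j)))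

    form1 : η≡ Γ (2 * cyc Γ + pendant Γ ∸ 1)
    form1 = exact (C a) (on-leaf a) (branch a) le (dimension (λ a → At.vectors a (C-nullity a)))
      where
      a : Fin k
      a = fromℕ< 1≤c
      le : suc (excess Γ) ≤ k + (pendant tree-graph ∸ 1)
      le = ℕ.≤-trans (ℕ.≤-reflexive (sym (2cyc+pendant∸1 Γ sg (connected⇒deg≥1 conn (adj (C a) zero)) 1≤c)))
        (ℕ.≤-trans (ℕ.≤-reflexive (cong (_∸ 1) (solve 2 (λ k p → con 2 :* k :+ p := k :+ (p :+ k)) refl k (pendant Γ))))
          (ℕ.≤-trans (ℕ.≤-reflexive (ℕ.+-∸-assoc k (ℕ.≤-trans 1≤c (ℕ.m≤n+m k (pendant Γ))))) (ℕ.+-monoʳ-≤ k (ℕ.∸-monoˡ-≤ 1 pendants))))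
        where open ℕ-Solver using (solve; _:+_; _:*_; _:=_; con)

  module FromInfinity (C₁ C₂ : Cycle Γ) (w : Fin n) (w∈₁ : OnCycle C₁ w) (w∈₂ : OnCycle C₂ w)
    (common : ∀ u → OnCycle C₁ u → OnCycle C₂ u → u ≡ w) (covers : ∀ u → OnCycle C₁ u ⊎ OnCycle C₂ u)
    (edges : ∀ u v → Adj Γ u v → CycleEdge C₁ u v ⊎ CycleEdge C₂ u v) where

    private
      only₁ : ∀ {v j} → Adj Γ v j → OnCycle C₁ j → j ≢ w → CycleEdge C₁ v j
      only₁ {v} {j} vj j∈ j≢w with edges v j vj
      ... | inj₁ e = e
      ... | inj₂ e = ⊥-elim (j≢w (common j j∈ (proj₂ (CycleEdge-on C₂ e))))

      only₂ : ∀ {v j} → Adj Γ v j → OnCycle C₂ j → j ≢ w → CycleEdge C₂ v j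
      only₂ {v} {j} vj j∈ j≢w with edges v j vj
      ... | inj₂ e = e
      ... | inj₁ e = ⊥-elim (j≢w (common j (proj₂ (CycleEdge-on C₁ e)) j∈))

      module At₁ = Attached Γ sg C₁ (proj₁ w∈₁) (λ vj j∈ ne → only₁ vj j∈ (λ e → ne (trans e (sym (proj₂ w∈₁)))))
      module At₂ = Attached Γ sg C₂ (proj₁ w∈₂) (λ vj j∈ ne → only₂ vj j∈ (λ e → ne (trans e (sym (proj₂ w∈₂)))))

      q₁ = vtx C₁ (next (proj₁ w∈₁))
      q₂ = vtx C₂ (next (proj₁ w∈₂))

      q₁≢w : q₁ ≢ w
      q₁≢w e = next≢ (proj₁ w∈₁) (inj C₁ (trans e (sym (proj₂ w∈₁))))

      q₂≢w : q₂ ≢ w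
      q₂≢w e = next≢ (proj₁ w∈₂) (inj C₂ (trans e (sym (proj₂ w∈₂))))

      q₁∉ : ¬ OnCycle C₂ q₁
      q₁∉ c = q₁≢w (common q₁ (next (proj₁ w∈₁) , refl) c)

      q₂∉ : ¬ OnCycle C₁ q₂
      q₂∉ c = q₂≢w (common q₂ c (next (proj₁ w∈₂) , refl))

      branch : 3 ≤ deg Γ w
      branch with around C₁ w∈₁ | around C₂ w∈₂
      ... | i , _ , x , y , ne | j , _ , z , _ , _ = deg≥3 x y z ne (off (i , refl)) (off (next (next i) , refl))
        where
        off : ∀ {v} → OnCycle C₁ v → v ≢ vtx C₂ j
        off v∈ refl = adj-irrefl z (sym (common _ v∈ (j , refl)))

      nbrs : (C : Cycle Γ) → ∀ {v} → OnCycle C v → List (Fin n)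
      nbrs C c = vtx C (proj₁ (around C c)) ∷ vtx C (next (next (proj₁ (around C c)))) ∷ []

      in-nbrs : (C : Cycle Γ) → ∀ {v j} (c : OnCycle C v) → CycleEdge C v j → j ≡ vtx C (proj₁ (around C c)) ⊎ j ≡ vtx C (next (next (proj₁ (around C c))))
      in-nbrs C {v} {j} c ce = cycleEdge-nbr C (subst (λ t → CycleEdge C t j) (sym (proj₁ (proj₂ (around C c)))) ce)

      deg≤2 : (C : Cycle Γ) → ∀ {v} → OnCycle C v → (∀ {j} → Adj Γ v j → CycleEdge C v j) → deg Γ v ≤ 2
      deg≤2 C c h = deg≤ (nbrs C c) λ j a → sort (in-nbrs C c (h a))
        where
        sort : ∀ {j a b} → j ≡ a ⊎ j ≡ b → j ∈ (a ∷ b ∷ [])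
        sort (inj₁ e) = here e
        sort (inj₂ e) = there (here e)

      excess≤2 : excess Γ ≤ 2
      excess≤2 = subst (excess Γ ≤_) (trans (sum-+ (δ w) (δ w)) (cong₂ _+_ (sum-δ w) (sum-δ w))) (sum-mono point)
        where
        deg-w≤4 : deg Γ w ≤ 4
        deg-w≤4 = deg≤ (vtx C₁ (proj₁ a₁) ∷ vtx C₁ (next (next (proj₁ a₁))) ∷ vtx C₂ (proj₁ a₂) ∷ vtx C₂ (next (next (proj₁ a₂))) ∷ []) λ j a → sort (edges w j a)
          where
          a₁ = around C₁ w∈₁
          a₂ = around C₂ w∈₂
          sort : ∀ {j} → CycleEdge C₁ w j ⊎ CycleEdge C₂ w j → j ∈ (vtx C₁ (proj₁ a₁) ∷ vtx C₁ (next (next (proj₁ a₁))) ∷ vtx C₂ (proj₁ a₂) ∷ vtx C₂ (next (next (proj₁ a₂))) ∷ [])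
          sort (inj₁ e) with in-nbrs C₁ w∈₁ e
          ... | inj₁ p = here p
          ... | inj₂ p = there (here p)
          sort (inj₂ e) with in-nbrs C₂ w∈₂ e
          ... | inj₁ p = there (there (here p))
          ... | inj₂ p = there (there (there (here p)))
        rest : ∀ {v} → v ≢ w → deg Γ v ≤ 2
        rest {v} v≢w with covers v
        ... | inj₁ v∈ = deg≤2 C₁ v∈ (λ a → CycleEdge-sym C₁ (only₁ (adj-sym a) v∈ v≢w))
        ... | inj₂ v∈ = deg≤2 C₂ v∈ (λ a → CycleEdge-sym C₂ (only₂ (adj-sym a) v∈ v≢w))
        point : ∀ v → deg Γ v ∸ 2 ≤ δ w v + δ w v
        point v with v ≟ w
        ... | yes refl = ℕ.∸-monoˡ-≤ 2 deg-w≤4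
        ... | no v≢w = ℕ.∸-monoˡ-≤ 2 (rest v≢w)

      module _ (V₁ : At₁.Vectors) (V₂ : At₂.Vectors) where
        module V₁ = At₁.Vectors V₁
        module V₂ = At₂.Vectors V₂

        -- The value 1 at `w`, continued into both cycles.
        G : Fin n → ℚ
        G v = (unit w v +ℚ 1ℚ *ℚ V₁.W v) +ℚ 1ℚ *ℚ V₂.W v

        G-at : ∀ {v a b c} → unit w v ≡ a → V₁.W v ≡ b → V₂.W v ≡ c → G v ≡ (a +ℚ 1ℚ *ℚ b) +ℚ 1ℚ *ℚ c
        G-at refl refl refl = refl

        row-G : ∀ v {b c} → row v V₁.W ≡ b → row v V₂.W ≡ c → row v G ≡ (A v w +ℚ 1ℚ *ℚ b) +ℚ 1ℚ *ℚ c
        row-G v refl refl = trans (rowOf-+* A (λ v → unit w v +ℚ 1ℚ *ℚ V₁.W v) 1ℚ V₂.W v)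
          (cong (_+ℚ 1ℚ *ℚ row v V₂.W) (trans (rowOf-+* A (unit w) 1ℚ V₁.W v) (cong (_+ℚ 1ℚ *ℚ row v V₁.W) (rowOf-unit A w v))))

        G-ker : Ker A G
        G-ker = ker at
          where
          open ℚ-Solver
          w≡₁ = proj₂ w∈₁
          w≡₂ = proj₂ w∈₂
          at : ∀ v → row v G ≡ 0ℚ
          at v with v ≟ w
          ... | yes refl = trans (row-G w (V₁.row-W-else (inj₂ (sym w≡₁))) (V₂.row-W-else (inj₂ (sym w≡₂))))
            (cong (λ a → (a +ℚ 1ℚ *ℚ 0ℚ) +ℚ 1ℚ *ℚ 0ℚ) (A-nonadj (λ a → adj-irrefl a refl)))
          ... | no v≢w with covers v
          ...   | inj₁ v∈ = trans (row-G v (trans (V₁.row-W-body v∈ (λ e → v≢w (trans e w≡₁))) (cong (λ x → - A v x) w≡₁))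
                  (V₂.row-W-else (inj₁ (λ v∈₂ → v≢w (common v v∈ v∈₂)))))
                (solve 1 (λ a → (a :+ con 1ℚ :* (:- a)) :+ con 1ℚ :* con 0ℚ := con 0ℚ) refl (A v w))
          ...   | inj₂ v∈ = trans (row-G v (V₁.row-W-else (inj₁ (λ v∈₁ → v≢w (common v v∈₁ v∈))))
                  (trans (V₂.row-W-body v∈ (λ e → v≢w (trans e w≡₂))) (cong (λ x → - A v x) w≡₂)))
                (solve 1 (λ a → (a :+ con 1ℚ :* con 0ℚ) :+ con 1ℚ :* (:- a) := con 0ℚ) refl (A v w))

        dimension : DimAtLeast (Ker A) 3
        dimension = adjoin-all {P = Ker A} 3 {vs = λ ()} (λ _ _ ()) (λ ()) vecs coords
          (λ { zero → G-ker ; (suc zero) → V₁.Z-ker ; (suc (suc zero)) → V₂.Z-ker }) nonzero off (λ ())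
          where
          vecs : Fin 3 → Fin n → ℚ
          vecs zero = G
          vecs (suc zero) = V₁.Z
          vecs (suc (suc zero)) = V₂.Z
          coords : Fin 3 → Fin n
          coords zero = w
          coords (suc zero) = q₁
          coords (suc (suc zero)) = q₂
          at-w₁ : ∀ {x : Fin n → ℚ} {c} → x (vtx C₁ (proj₁ w∈₁)) ≡ c → x w ≡ c
          at-w₁ {x} e = trans (cong x (sym (proj₂ w∈₁))) e
          at-w₂ : ∀ {x : Fin n → ℚ} {c} → x (vtx C₂ (proj₁ w∈₂)) ≡ c → x w ≡ c
          at-w₂ {x} e = trans (cong x (sym (proj₂ w∈₂))) e
          nonzero : ∀ a → vecs a (coords a) ≢ 0ℚ
          nonzero zero e = 1ℚ≢0ℚ (trans (sym (G-at {w} (unit-≡ refl) (at-w₁ {V₁.W} V₁.W-w) (at-w₂ {V₂.W} V₂.W-w))) e)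
          nonzero (suc zero) e = 1ℚ≢0ℚ (trans (sym V₁.Z-q) e)
          nonzero (suc (suc zero)) e = 1ℚ≢0ℚ (trans (sym V₂.Z-q) e)
          off : ∀ a b → a ≢ b → vecs a (coords b) ≡ 0ℚ
          off zero zero ne = ⊥-elim (ne refl)
          off zero (suc zero) _ = G-at {q₁} (unit-≢ q₁≢w) V₁.W-q (V₂.W-off q₁∉)
          off zero (suc (suc zero)) _ = G-at {q₂} (unit-≢ q₂≢w) (V₁.W-off q₂∉) V₂.W-q
          off (suc zero) zero _ = at-w₁ {V₁.Z} V₁.Z-w
          off (suc zero) (suc zero) ne = ⊥-elim (ne refl)
          off (suc zero) (suc (suc zero)) _ = V₁.Z-off q₂∉
          off (suc (suc zero)) zero _ = at-w₂ {V₂.Z} V₂.Z-w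
          off (suc (suc zero)) (suc zero) _ = V₂.Z-off q₁∉
          off (suc (suc zero)) (suc (suc zero)) ne = ⊥-elim (ne refl)

    form2 : AllCyclesNullity2 Γ → η≡ Γ (2 * cyc Γ + pendant Γ ∸ 1)
    form2 null = exact C₁ w∈₁ branch (s≤s excess≤2) (dimension (At₁.vectors (null C₁)) (At₂.vectors (null C₂)))

-- Nullity of θ-graphs

x+x≡0 : ∀ {a} → a +ℚ a ≡ 0ℚ → a ≡ 0ℚ
x+x≡0 {a} e = *-≢0 {1ℚ +ℚ 1ℚ} (λ ()) (trans (solve 1 (λ a → (con 1ℚ :+ con 1ℚ) :* a := a :+ a) refl a) e)
  where open ℚ-Solver

module FromTheta {n} (Γ : SGraph n) (sg : IsSignedGraph Γ) (conn : Connected Γ) (1≤c : 1 ≤ cyc Γ) {u v : Fin n}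
  (l : Fin 3 → ℕ) (p : Fin 3 → ℕ → Fin n) (N : ∀ a → Paths.NPath Γ sg u v (p a) (l a))
  (disj : ∀ {a b} → a ≢ b → Paths.Disjoint Γ sg u v (p a) (l a) (p b) (l b))
  (long : ∀ {a b} → a ≢ b → ¬ (l a ≡ 1 × l b ≡ 1))
  (covers : ∀ x → ∃ λ a → ∃ λ i → i ≤ l a × p a i ≡ x)
  (edges : ∀ x y → Adj Γ x y → ∃ λ a → ∃ λ i → i < l a × ((p a i ≡ x × p a (suc i) ≡ y) ⊎ (p a i ≡ y × p a (suc i) ≡ x)))
  (null : AllCyclesNullity2 Γ) where

  open Basic Γ sg
  open Cycles Γ sg
  open Paths Γ sg
  open Converse Γ sg conn 1≤c using (exact)

  private
    A = adjMat Γ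

    1≤l : ∀ a → 1 ≤ l a
    1≤l a = 1≤len (N a)

    l′ : Fin 3 → ℕ
    l′ a = l a ∸ 1

    sl′ : ∀ a → suc (l′ a) ≡ l a
    sl′ a = ℕ.m+[n∸m]≡n (1≤l a)

    l′<l : ∀ a → l′ a < l a
    l′<l a = subst (l′ a <_) (sl′ a) ℕ.≤-refl

    first last : Fin 3 → Fin n
    first a = p a 1
    last a = p a (l′ a)

    u-first : ∀ a → Adj Γ u (first a)
    u-first a = subst (λ t → Adj Γ t (first a)) (start (N a)) (walk (N a) (1≤l a))

    v-last : ∀ a → Adj Γ v (last a)
    v-last a = adj-sym (subst (Adj Γ (last a)) (trans (cong (p a) (sl′ a)) (end (N a))) (walk (N a) (l′<l a)))

    is-u : ∀ a {i} → i ≤ l a → p a i ≡ u → i ≡ 0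
    is-u a i≤ e = inj-≤ (N a) i≤ z≤n (trans e (sym (start (N a))))

    is-v : ∀ a {i} → i ≤ l a → p a i ≡ v → i ≡ l a
    is-v a i≤ e = inj-≤ (N a) i≤ ℕ.≤-refl (trans e (sym (end (N a))))

    interior-path : ∀ {a b i j} → 1 ≤ i → i < l a → j ≤ l b → p a i ≡ p b j → a ≡ b
    interior-path {a} {b} {i} 1≤i i< j≤ e with a ≟ b
    ... | yes eq = eq
    ... | no a≢b with disj a≢b (ℕ.<⇒≤ i<) j≤ e
    ...   | inj₁ e′ = ⊥-elim (ℕ.<⇒≢ 1≤i (sym (is-u a (ℕ.<⇒≤ i<) e′)))
    ...   | inj₂ e′ = ⊥-elim (ℕ.<⇒≢ i< (is-v a (ℕ.<⇒≤ i<) e′))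

    nbr-int : ∀ a {i y} → suc i < l a → Adj Γ (p a (suc i)) y → y ≡ p a i ⊎ y ≡ p a (2 + i)
    nbr-int a {i} {y} si< ay with edges _ _ ay
    ... | b , t , t< , inj₁ (e , e′) with interior-path {a} {b} (s≤s z≤n) si< (ℕ.<⇒≤ t<) (sym e)
    ...   | refl = inj₂ (trans (sym e′) (cong (λ s → p a (suc s)) (inj-≤ (N a) (ℕ.<⇒≤ t<) (ℕ.<⇒≤ si<) e)))
    nbr-int a {i} {y} si< ay | b , t , t< , inj₂ (e , e′) with interior-path {a} {b} (s≤s z≤n) si< t< (sym e′)
    ...   | refl = inj₁ (trans (sym e) (cong (p a) (ℕ.suc-injective (inj-≤ (N a) t< (ℕ.<⇒≤ si<) e′))))

    nbr-u : ∀ {y} → Adj Γ u y → ∃ λ a → y ≡ first a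
    nbr-u uy with edges _ _ uy
    ... | a , t , t< , inj₁ (e , e′) = a , trans (sym e′) (cong (λ s → p a (suc s)) (is-u a (ℕ.<⇒≤ t<) e))
    ... | a , t , t< , inj₂ (e , e′) = ⊥-elim (ℕ.1+n≢0 (is-u a t< e′))

    nbr-v : ∀ {y} → Adj Γ v y → ∃ λ a → y ≡ last a
    nbr-v vy with edges _ _ vy
    ... | a , t , t< , inj₁ (e , e′) = ⊥-elim (ℕ.<⇒≢ t< (is-v a (ℕ.<⇒≤ t<) e))
    ... | a , t , t< , inj₂ (e , e′) = a , trans (sym e) (cong (λ s → p a (s ∸ 1)) (is-v a t< e′))

    first-≢ : ∀ {a b} → a ≢ b → first a ≢ first b
    first-≢ {a} {b} a≢b e with disj a≢b (1≤l a) (1≤l b) e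
    ... | inj₁ e′ = ℕ.1+n≢0 (is-u a (1≤l a) e′)
    ... | inj₂ e′ = long a≢b (sym (is-v a (1≤l a) e′) , sym (is-v b (1≤l b) (trans (sym e) e′)))

    last-≢ : ∀ {a b} → a ≢ b → last a ≢ last b
    last-≢ {a} {b} a≢b e with disj a≢b (ℕ.<⇒≤ (l′<l a)) (ℕ.<⇒≤ (l′<l b)) e
    ... | inj₂ e′ = ℕ.<⇒≢ (l′<l a) (is-v a (ℕ.<⇒≤ (l′<l a)) e′)
    ... | inj₁ e′ = long a≢b (one a e′ , one b (trans (sym e) e′))
      where
      one : ∀ a → last a ≡ u → l a ≡ 1
      one a e = trans (sym (sl′ a)) (cong suc (is-u a (ℕ.<⇒≤ (l′<l a)) e))

    module G {a b : Fin 3} (a≢b : a ≢ b) = Glued (glue (N a) (N b) (disj a≢b) (long a≢b))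

    PathKer : Fin 3 → (Fin n → ℚ) → Set
    PathKer a x = ∀ {i} → suc i < l a → A (p a (suc i)) (p a i) *ℚ x (p a i) +ℚ A (p a (suc i)) (p a (2 + i)) *ℚ x (p a (2 + i)) ≡ 0ℚ

    at-u at-v : Fin 3 → (Fin n → ℚ) → ℚ
    at-u a x = A u (first a) *ℚ x (first a)
    at-v a x = A v (last a) *ℚ x (last a)

    -- A kernel vector of the cycle formed by the paths `a` and `b`, extended by zero. Its equations
    -- are sorted by paths and ends because each path belongs to two of the cycles, so that vectors
    -- of different cycles can be compared along it.
    record PairKer {a b : Fin 3} (a≢b : a ≢ b) (x : Fin n → ℚ) : Set where
      field
        ker-a : PathKer a x
        ker-b : PathKer b x
        eq-u  : at-u a x +ℚ at-u b x ≡ 0ℚ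
        eq-v  : at-v a x +ℚ at-v b x ≡ 0ℚ
        off   : ∀ {y} → ¬ OnCycle (G.C a≢b) y → x y ≡ 0ℚ

    pair-vector : ∀ {a b} (a≢b : a ≢ b) {s t} → CycleEdge (G.C a≢b) s t → ∃ λ x → PairKer a≢b x × x s ≡ 0ℚ × x t ≡ 1ℚ
    pair-vector {a} {b} a≢b st = build (edge-vector C (proj₁ (null C)) st)
      where
      open G a≢b using (C; edge-p; edge-q)
      build : (∃ λ x → Tri C (λ i → x (vtx C i)) × (∀ {u} → ¬ OnCycle C u → x u ≡ 0ℚ) × x _ ≡ 0ℚ × x _ ≡ 1ℚ) → ∃ λ x → PairKer a≢b x × x _ ≡ 0ℚ × x _ ≡ 1ℚ
      build (x , t , off , x0 , x1) = x , record
        { ker-a = λ si< → cycle-eq C {x} t (CycleEdge-sym C (edge-p (ℕ.<-trans ℕ.≤-refl si<))) (edge-p si<) (proj₂ (proj₂ (path-step (N a) si<)))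
        ; ker-b = λ si< → cycle-eq C {x} t (CycleEdge-sym C (edge-q (ℕ.<-trans ℕ.≤-refl si<))) (edge-q si<) (proj₂ (proj₂ (path-step (N b) si<)))
        ; eq-u = cycle-eq C {x} t (subst (λ s → CycleEdge C s (first a)) (start (N a)) (edge-p (1≤l a)))
            (subst (λ s → CycleEdge C s (first b)) (start (N b)) (edge-q (1≤l b))) (first-≢ a≢b)
        ; eq-v = cycle-eq C {x} t (CycleEdge-sym C (subst (CycleEdge C (last a)) (trans (cong (p a) (sl′ a)) (end (N a))) (edge-p (l′<l a))))
            (CycleEdge-sym C (subst (CycleEdge C (last b)) (trans (cong (p b) (sl′ b)) (end (N b))) (edge-q (l′<l b)))) (last-≢ a≢b)
        ; off = off } , x0 , x1

    edge₁ : ∀ {a b} (a≢b : a ≢ b) → CycleEdge (G.C a≢b) u (first a)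
    edge₁ {a} a≢b = subst (λ s → CycleEdge (G.C a≢b) s (first a)) (start (N a)) (G.edge-p a≢b (1≤l a))

    -- The equation at an interior vertex passes zeros on, so a solution along a path is fixed by
    -- its values at `u` and at the vertex next to it.
    path-zero : ∀ {a x} → PathKer a x → x u ≡ 0ℚ → x (first a) ≡ 0ℚ → ∀ {i} → i ≤ l a → x (p a i) ≡ 0ℚ
    path-zero {a} {x} k xu x1 {i} i≤ = proj₁ (go i i≤)
      where
      go : ∀ i → i ≤ l a → x (p a i) ≡ 0ℚ × (suc i ≤ l a → x (p a (suc i)) ≡ 0ℚ)
      go zero _ = trans (cong x (start (N a))) xu , λ _ → x1
      go (suc i) si≤ = proj₂ (go i (ℕ.<⇒≤ si≤)) si≤ , λ ssi≤ → *-≢0 (A≢0 (walk (N a) ssi≤))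
        (trans (sym (ℚ.+-identityˡ _)) (trans (cong (_+ℚ A (p a (suc i)) (p a (2 + i)) *ℚ x (p a (2 + i)))
          (sym (trans (cong (A (p a (suc i)) (p a i) *ℚ_) (proj₁ (go i (ℕ.<⇒≤ si≤)))) (ℚ.*-zeroʳ (A (p a (suc i)) (p a i)))))) (k ssi≤)))

    PathKer-+ : ∀ {a x y} c → PathKer a x → PathKer a y → PathKer a (λ j → x j +ℚ c *ℚ y j)
    PathKer-+ {a} {x} {y} c kx ky {i} si< = trans
      (solve 7 (λ α β x₀ y₀ x₂ y₂ c → α :* (x₀ :+ c :* y₀) :+ β :* (x₂ :+ c :* y₂) := (α :* x₀ :+ β :* x₂) :+ c :* (α :* y₀ :+ β :* y₂)) refl
        (A (p a (suc i)) (p a i)) (A (p a (suc i)) (p a (2 + i))) (x (p a i)) (y (p a i)) (x (p a (2 + i))) (y (p a (2 + i))) c)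
      (trans (cong₂ (λ s t → s +ℚ c *ℚ t) (kx si<) (ky si<)) (trans (ℚ.+-identityˡ _) (ℚ.*-zeroʳ c)))
      where open ℚ-Solver

    combine : ∀ {a x y} c → PathKer a x → PathKer a y → x u +ℚ c *ℚ y u ≡ 0ℚ → x (first a) +ℚ c *ℚ y (first a) ≡ 0ℚ →
      ∀ {i} → i ≤ l a → x (p a i) +ℚ c *ℚ y (p a i) ≡ 0ℚ
    combine {a} {x} {y} c kx ky = path-zero {a} {λ j → x j +ℚ c *ℚ y j} (PathKer-+ {a} {x} {y} c kx ky)

    agree : ∀ {a x y} → PathKer a x → PathKer a y → x u ≡ y u → x (first a) ≡ y (first a) → ∀ {i} → i ≤ l a → x (p a i) ≡ y (p a i)
    agree {a} {x} {y} kx ky eu e1 i≤ = back (combine {a} {x} {y} (- 1ℚ) kx ky (fwd eu) (fwd e1) i≤)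
      where
      open ℚ-Solver
      fwd : ∀ {s t} → s ≡ t → s +ℚ (- 1ℚ) *ℚ t ≡ 0ℚ
      fwd {s} refl = solve 1 (λ s → s :+ (:- con 1ℚ) :* s := con 0ℚ) refl s
      back : ∀ {s t} → s +ℚ (- 1ℚ) *ℚ t ≡ 0ℚ → s ≡ t
      back {s} {t} e = trans (solve 2 (λ s t → s := (s :+ (:- con 1ℚ) :* t) :+ t) refl s t) (trans (cong (_+ℚ t) e) (ℚ.+-identityˡ t))

    at-end : ∀ a {x : Fin n → ℚ} {c} → x (p a (l a)) ≡ c → x v ≡ c
    at-end a {x} e = trans (cong x (sym (end (N a)))) e

    kernel-from : ∀ {x} → (∀ a → PathKer a x) → row u x ≡ 0ℚ → row v x ≡ 0ℚ → Ker A x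
    kernel-from {x} k ru rv = ker at
      where
      at : ∀ y → row y x ≡ 0ℚ
      at y with covers y
      ... | a , zero , _ , e = subst (λ t → row t x ≡ 0ℚ) (trans (sym (start (N a))) e) ru
      ... | a , suc i , i≤ , refl with ℕ.m≤n⇒m<n∨m≡n i≤
      ...   | inj₂ e = subst (λ t → row t x ≡ 0ℚ) (trans (sym (end (N a))) (cong (p a) (sym e))) rv
      ...   | inj₁ i< = trans (row-pair x (proj₂ (proj₂ (path-step (N a) i<))) others) (k a i<)
        where
        others : ∀ j → Adj Γ (p a (suc i)) j → j ≢ p a i → j ≢ p a (2 + i) → x j ≡ 0ℚ
        others j aj ne ne′ with nbr-int a i< aj
        ... | inj₁ e = ⊥-elim (ne e)
        ... | inj₂ e = ⊥-elim (ne′ e)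

    module Third {a b c : Fin 3} (a≢b : a ≢ b) (c≢a : c ≢ a) (c≢b : c ≢ b) (three : ∀ d → d ≡ a ⊎ d ≡ b ⊎ d ≡ c) {x : Fin n → ℚ} (P : PairKer a≢b x) where
      open PairKer P

      third-on : ∀ {i} → i ≤ l c → OnCycle (G.C a≢b) (p c i) → p c i ≡ u ⊎ p c i ≡ v
      third-on i≤ on with G.off a≢b on
      ... | inj₁ (j , j≤ , e) = disj c≢a i≤ j≤ (sym e)
      ... | inj₂ (j , _ , j< , e) = disj c≢b i≤ (ℕ.<⇒≤ j<) (sym e)

      module _ (xu : x u ≡ 0ℚ) (xv : x v ≡ 0ℚ) where

        third-zero : ∀ {i} → i ≤ l c → x (p c i) ≡ 0ℚ
        third-zero {i} i≤ with onCycle? (G.C a≢b) (p c i)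
        ... | no o = off o
        ... | yes o with third-on i≤ o
        ...   | inj₁ e = trans (cong x e) xu
        ...   | inj₂ e = trans (cong x e) xv

        -- Vanishing at both ends makes `x` zero on all of the third path. Its equations hold
        -- trivially, and it contributes nothing to the equations at `u` and `v`.
        kernel-third : Ker A x
        kernel-third = kernel-from paths row-u row-v
          where
          paths : ∀ d → PathKer d x
          paths d {i} si< with three d
          ... | inj₁ refl = ker-a si<
          ... | inj₂ (inj₁ refl) = ker-b si<
          ... | inj₂ (inj₂ refl) = trans (cong₂ (λ s t → A (p c (suc i)) (p c i) *ℚ s +ℚ A (p c (suc i)) (p c (2 + i)) *ℚ t)
                (third-zero (ℕ.≤-trans (ℕ.n≤1+n i) (ℕ.<⇒≤ si<))) (third-zero si<))
              (trans (cong₂ _+ℚ_ (ℚ.*-zeroʳ (A (p c (suc i)) (p c i))) (ℚ.*-zeroʳ (A (p c (suc i)) (p c (2 + i))))) refl)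
          row-u : row u x ≡ 0ℚ
          row-u = trans (row-pair x (first-≢ a≢b) others) eq-u
            where
            others : ∀ j → Adj Γ u j → j ≢ first a → j ≢ first b → x j ≡ 0ℚ
            others j uj ne ne′ with nbr-u uj
            ... | d , refl with three d
            ...   | inj₁ refl = ⊥-elim (ne refl)
            ...   | inj₂ (inj₁ refl) = ⊥-elim (ne′ refl)
            ...   | inj₂ (inj₂ refl) = third-zero (1≤l c)
          row-v : row v x ≡ 0ℚ
          row-v = trans (row-pair x (last-≢ a≢b) others) eq-v
            where
            others : ∀ j → Adj Γ v j → j ≢ last a → j ≢ last b → x j ≡ 0ℚ
            others j vj ne ne′ with nbr-v vj
            ... | d , refl with three d
            ...   | inj₁ refl = ⊥-elim (ne refl)
            ...   | inj₂ (inj₁ refl) = ⊥-elim (ne′ refl)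
            ...   | inj₂ (inj₂ refl) = third-zero (ℕ.<⇒≤ (l′<l c))

    f₀ f₁ f₂ : Fin 3
    f₀ = zero
    f₁ = suc zero
    f₂ = suc (suc zero)

    0≢1 : f₀ ≢ f₁
    0≢1 ()
    0≢2 : f₀ ≢ f₂
    0≢2 ()
    1≢2 : f₁ ≢ f₂
    1≢2 ()

    three₀₁ : ∀ d → d ≡ f₀ ⊎ d ≡ f₁ ⊎ d ≡ f₂
    three₀₁ zero = inj₁ refl
    three₀₁ (suc zero) = inj₂ (inj₁ refl)
    three₀₁ (suc (suc zero)) = inj₂ (inj₂ refl)

    three₀₂ : ∀ d → d ≡ f₀ ⊎ d ≡ f₂ ⊎ d ≡ f₁
    three₀₂ zero = inj₁ refl
    three₀₂ (suc zero) = inj₂ (inj₂ refl)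
    three₀₂ (suc (suc zero)) = inj₂ (inj₁ refl)

    second-first : ∀ {a b} (a≢b : a ≢ b) {x} → PairKer a≢b x → x (first a) ≡ 0ℚ → x (first b) ≡ 0ℚ
    second-first {a} {b} a≢b {x} P xa = *-≢0 (A≢0 (u-first b)) (trans (sym (ℚ.+-identityˡ _))
      (trans (cong (_+ℚ at-u b x) (sym (trans (cong (A u (first a) *ℚ_) xa) (ℚ.*-zeroʳ (A u (first a)))))) (PairKer.eq-u P)))

    -- Vectors z vanishing at u. Comparing the three of them along the three paths gives z v = − z v.
    module Odd {z₀₁ z₀₂ z₁₂ : Fin n → ℚ} (P₀₁ : PairKer 0≢1 z₀₁) (P₀₂ : PairKer 0≢2 z₀₂) (P₁₂ : PairKer 1≢2 z₁₂)
      (u₀₁ : z₀₁ u ≡ 0ℚ) (u₀₂ : z₀₂ u ≡ 0ℚ) (u₁₂ : z₁₂ u ≡ 0ℚ)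
      (o₀₁ : z₀₁ (first f₀) ≡ 1ℚ) (o₀₂ : z₀₂ (first f₀) ≡ 1ℚ) (o₁₂ : z₁₂ (first f₁) ≡ 1ℚ) where
      module P₀₁ = PairKer P₀₁
      module P₀₂ = PairKer P₀₂
      module P₁₂ = PairKer P₁₂
      open ℚ-Solver

      β = z₀₁ (first f₁)

      zero-comb : ∀ {s t} c → s ≡ 0ℚ → t ≡ 0ℚ → s +ℚ c *ℚ t ≡ 0ℚ
      zero-comb c refl refl = trans (ℚ.+-identityˡ _) (ℚ.*-zeroʳ c)

      v₀ : z₀₁ v ≡ z₀₂ v
      v₀ = trans (cong z₀₁ (sym (end (N f₀)))) (trans (agree {f₀} {z₀₁} {z₀₂} P₀₁.ker-a P₀₂.ker-a (trans u₀₁ (sym u₀₂)) (trans o₀₁ (sym o₀₂)) ℕ.≤-refl)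
        (cong z₀₂ (end (N f₀))))

      v₁ : z₀₁ v +ℚ (- β) *ℚ z₁₂ v ≡ 0ℚ
      v₁ = at-end f₁ {λ j → z₀₁ j +ℚ (- β) *ℚ z₁₂ j} (combine {f₁} {z₀₁} {z₁₂} (- β) P₀₁.ker-b P₁₂.ker-a (zero-comb (- β) u₀₁ u₁₂)
        (trans (cong (λ t → β +ℚ (- β) *ℚ t) o₁₂) (solve 1 (λ b → b :+ (:- b) :* con 1ℚ := con 0ℚ) refl β)) ℕ.≤-refl)

      α₀ = A u (first f₀)
      α₁ = A u (first f₁)
      α₂ = A u (first f₂)

      -- Take the equation at `u` for paths 0 and 2, add `β` times the one for paths 1 and 2, and
      -- subtract the one for paths 0 and 1: the terms on paths 0 and 1 cancel.
      at-first : z₀₂ (first f₂) +ℚ β *ℚ z₁₂ (first f₂) ≡ 0ℚ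
      at-first = *-≢0 (A≢0 (u-first f₂)) (begin
        α₂ *ℚ (s +ℚ β *ℚ t)
          ≡⟨ solve 6 (λ a₀ a₁ a₂ b s t → a₂ :* (s :+ b :* t) :=
               ((a₀ :* con 1ℚ :+ a₂ :* s) :+ b :* (a₁ :* con 1ℚ :+ a₂ :* t)) :+ (:- (a₀ :* con 1ℚ :+ a₁ :* b))) refl α₀ α₁ α₂ β s t ⟩
        ((α₀ *ℚ 1ℚ +ℚ α₂ *ℚ s) +ℚ β *ℚ (α₁ *ℚ 1ℚ +ℚ α₂ *ℚ t)) +ℚ - (α₀ *ℚ 1ℚ +ℚ α₁ *ℚ β)
          ≡⟨ cong₂ (λ x y → x +ℚ - y) (zero-comb β (trans (cong (λ o → α₀ *ℚ o +ℚ α₂ *ℚ s) (sym o₀₂)) P₀₂.eq-u)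
               (trans (cong (λ o → α₁ *ℚ o +ℚ α₂ *ℚ t) (sym o₁₂)) P₁₂.eq-u)) (trans (cong (λ o → α₀ *ℚ o +ℚ α₁ *ℚ β) (sym o₀₁)) P₀₁.eq-u) ⟩
        0ℚ +ℚ - 0ℚ ≡⟨ refl ⟩
        0ℚ ∎)
        where
        open ≡-Reasoning
        s = z₀₂ (first f₂)
        t = z₁₂ (first f₂)

      v₂ : z₀₂ v +ℚ β *ℚ z₁₂ v ≡ 0ℚ
      v₂ = at-end f₂ {λ j → z₀₂ j +ℚ β *ℚ z₁₂ j} (combine {f₂} {z₀₂} {z₁₂} β P₀₂.ker-b P₁₂.ker-b (zero-comb β u₀₂ u₁₂) at-first ℕ.≤-refl)

      z₀₁v : z₀₁ v ≡ 0ℚ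
      z₀₁v = x+x≡0 (trans (cong (z₀₁ v +ℚ_) v₀) (trans
        (solve 4 (λ x y b t → x :+ y := (x :+ (:- b) :* t) :+ (y :+ b :* t)) refl (z₀₁ v) (z₀₂ v) β (z₁₂ v))
        (trans (cong₂ _+ℚ_ v₁ v₂) (ℚ.+-identityˡ 0ℚ))))

      z₀₂v : z₀₂ v ≡ 0ℚ
      z₀₂v = trans (sym v₀) z₀₁v

    -- Vectors y with y u = 1 and zero next to u. The three equations at v force the values next to v to vanish.
    module Even {y₀₁ y₀₂ y₁₂ : Fin n → ℚ} (P₀₁ : PairKer 0≢1 y₀₁) (P₀₂ : PairKer 0≢2 y₀₂) (P₁₂ : PairKer 1≢2 y₁₂)
      (u₀₁ : y₀₁ u ≡ 1ℚ) (u₀₂ : y₀₂ u ≡ 1ℚ) (u₁₂ : y₁₂ u ≡ 1ℚ)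
      (o₀₁ : y₀₁ (first f₀) ≡ 0ℚ) (o₀₂ : y₀₂ (first f₀) ≡ 0ℚ) (o₁₂ : y₁₂ (first f₁) ≡ 0ℚ) where
      module P₀₁ = PairKer P₀₁
      module P₀₂ = PairKer P₀₂
      module P₁₂ = PairKer P₁₂

      b₀₁ : y₀₁ (first f₁) ≡ 0ℚ
      b₀₁ = second-first 0≢1 P₀₁ o₀₁
      b₀₂ : y₀₂ (first f₂) ≡ 0ℚ
      b₀₂ = second-first 0≢2 P₀₂ o₀₂
      b₁₂ : y₁₂ (first f₂) ≡ 0ℚ
      b₁₂ = second-first 1≢2 P₁₂ o₁₂

      on₀ : ∀ {i} → i ≤ l f₀ → y₀₁ (p f₀ i) ≡ y₀₂ (p f₀ i)
      on₀ = agree {f₀} {y₀₁} {y₀₂} P₀₁.ker-a P₀₂.ker-a (trans u₀₁ (sym u₀₂)) (trans o₀₁ (sym o₀₂))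
      on₁ : ∀ {i} → i ≤ l f₁ → y₀₁ (p f₁ i) ≡ y₁₂ (p f₁ i)
      on₁ = agree {f₁} {y₀₁} {y₁₂} P₀₁.ker-b P₁₂.ker-a (trans u₀₁ (sym u₁₂)) (trans b₀₁ (sym o₁₂))
      on₂ : ∀ {i} → i ≤ l f₂ → y₀₂ (p f₂ i) ≡ y₁₂ (p f₂ i)
      on₂ = agree {f₂} {y₀₂} {y₁₂} P₀₂.ker-b P₁₂.ker-b (trans u₀₂ (sym u₁₂)) (trans b₀₂ (sym b₁₂))

      λ₀ = at-v f₀ y₀₁
      λ₁ = at-v f₁ y₀₁
      λ₂ = at-v f₂ y₀₂

      e₀₁ : λ₀ +ℚ λ₁ ≡ 0ℚ
      e₀₁ = P₀₁.eq-v
      e₀₂ : λ₀ +ℚ λ₂ ≡ 0ℚ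
      e₀₂ = trans (cong (λ t → A v (last f₀) *ℚ t +ℚ λ₂) (on₀ (ℕ.<⇒≤ (l′<l f₀)))) P₀₂.eq-v
      e₁₂ : λ₁ +ℚ λ₂ ≡ 0ℚ
      e₁₂ = trans (cong₂ (λ s t → A v (last f₁) *ℚ s +ℚ A v (last f₂) *ℚ t) (on₁ (ℕ.<⇒≤ (l′<l f₁))) (on₂ (ℕ.<⇒≤ (l′<l f₂)))) P₁₂.eq-v

      cancel : ∀ {a b c} → a +ℚ b ≡ 0ℚ → a +ℚ c ≡ 0ℚ → b +ℚ c ≡ 0ℚ → a ≡ 0ℚ
      cancel {a} {b} {c} ab ac bc = x+x≡0 (trans (solve 3 (λ a b c → a :+ a := ((a :+ b) :+ (a :+ c)) :+ (:- (b :+ c))) refl a b c)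
        (trans (cong₂ (λ s t → s +ℚ - t) (cong₂ _+ℚ_ ab ac) bc) refl))
        where open ℚ-Solver

      last₀ : y₀₁ (last f₀) ≡ 0ℚ
      last₀ = *-≢0 (A≢0 (v-last f₀)) (cancel e₀₁ e₀₂ e₁₂)
      last₁ : y₀₁ (last f₁) ≡ 0ℚ
      last₁ = *-≢0 (A≢0 (v-last f₁)) (cancel (trans (ℚ.+-comm λ₁ λ₀) e₀₁) e₁₂ e₀₂)
      last₂ : y₀₂ (last f₂) ≡ 0ℚ
      last₂ = *-≢0 (A≢0 (v-last f₂)) (cancel (trans (ℚ.+-comm λ₂ λ₀) e₀₂) (trans (ℚ.+-comm λ₂ λ₁) e₁₂) e₀₁)

      -- The two pieces agree at `u` and `v`, so the equations along all three paths survive the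
      -- gluing. All neighbours of `u` and of `v` receive the value 0, which settles the equations
      -- there.
      Y : Fin n → ℚ
      Y x with onCycle? (G.C 0≢1) x
      ... | yes _ = y₀₁ x
      ... | no _ = y₀₂ x

      Y-on : ∀ {x} → OnCycle (G.C 0≢1) x → Y x ≡ y₀₁ x
      Y-on {x} on with onCycle? (G.C 0≢1) x
      ... | yes _ = refl
      ... | no o = ⊥-elim (o on)

      Y₀ : ∀ {i} → i ≤ l f₀ → Y (p f₀ i) ≡ y₀₁ (p f₀ i)
      Y₀ i≤ = Y-on (G.on-p 0≢1 i≤)
      Y₁ : ∀ {i} → i ≤ l f₁ → Y (p f₁ i) ≡ y₀₁ (p f₁ i)
      Y₁ i≤ = Y-on (G.on-q 0≢1 i≤)

      ends-agree : ∀ {x} → x ≡ u ⊎ x ≡ v → y₀₁ x ≡ y₀₂ x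
      ends-agree (inj₁ refl) = trans u₀₁ (sym u₀₂)
      ends-agree (inj₂ refl) = trans (cong y₀₁ (sym (end (N f₀)))) (trans (on₀ ℕ.≤-refl) (cong y₀₂ (end (N f₀))))

      Y₂ : ∀ {i} → i ≤ l f₂ → Y (p f₂ i) ≡ y₀₂ (p f₂ i)
      Y₂ {i} i≤ with onCycle? (G.C 0≢1) (p f₂ i)
      ... | no _ = refl
      ... | yes on = ends-agree (Third.third-on {c = f₂} 0≢1 (λ ()) (λ ()) three₀₁ P₀₁ i≤ on)

      Y-u : Y u ≡ 1ℚ
      Y-u = trans (Y-on (subst (OnCycle (G.C 0≢1)) (start (N f₀)) (G.on-p 0≢1 z≤n))) u₀₁

      transfer : ∀ {a x} → PathKer a x → (∀ {i} → i ≤ l a → Y (p a i) ≡ x (p a i)) → PathKer a Y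
      transfer {a} k e {i} si< = trans (cong₂ (λ s t → A (p a (suc i)) (p a i) *ℚ s +ℚ A (p a (suc i)) (p a (2 + i)) *ℚ t)
        (e (ℕ.≤-trans (ℕ.n≤1+n i) (ℕ.<⇒≤ si<))) (e si<)) (k si<)

      Y-first : ∀ a → Y (first a) ≡ 0ℚ
      Y-first zero = trans (Y₀ (1≤l f₀)) o₀₁
      Y-first (suc zero) = trans (Y₁ (1≤l f₁)) b₀₁
      Y-first (suc (suc zero)) = trans (Y₂ (1≤l f₂)) b₀₂

      Y-last : ∀ a → Y (last a) ≡ 0ℚ
      Y-last zero = trans (Y₀ (ℕ.<⇒≤ (l′<l f₀))) last₀
      Y-last (suc zero) = trans (Y₁ (ℕ.<⇒≤ (l′<l f₁))) last₁
      Y-last (suc (suc zero)) = trans (Y₂ (ℕ.<⇒≤ (l′<l f₂))) last₂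

      Y-ker : Ker A Y
      Y-ker = kernel-from paths (row-0 Y (λ j uj → let (a , e) = nbr-u uj in trans (cong Y e) (Y-first a)))
          (row-0 Y (λ j vj → let (a , e) = nbr-v vj in trans (cong Y e) (Y-last a)))
        where
        paths : ∀ a → PathKer a Y
        paths zero = transfer {f₀} {y₀₁} P₀₁.ker-a Y₀
        paths (suc zero) = transfer {f₁} {y₀₁} P₀₁.ker-b Y₁
        paths (suc (suc zero)) = transfer {f₂} {y₀₂} P₀₂.ker-b Y₂

    OddVec EvenVec : ∀ {a b} → a ≢ b → Set
    OddVec {a} a≢b = ∃ λ x → PairKer a≢b x × x u ≡ 0ℚ × x (first a) ≡ 1ℚ
    EvenVec {a} a≢b = ∃ λ x → PairKer a≢b x × x (first a) ≡ 0ℚ × x u ≡ 1ℚ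

    -- The three vectors are diagonal at `u`, `first f₁` and `first f₂`: `Y` vanishes next to `u`,
    -- and each odd vector vanishes at `u` and on the path outside its cycle.
    dimension : OddVec 0≢1 → OddVec 0≢2 → OddVec 1≢2 → EvenVec 0≢1 → EvenVec 0≢2 → EvenVec 1≢2 → DimAtLeast (Ker A) 3
    dimension (z₀₁ , P₀₁ , u₀₁ , o₀₁) (z₀₂ , P₀₂ , u₀₂ , o₀₂) (z₁₂ , P₁₂ , u₁₂ , o₁₂)
        (y₀₁ , Q₀₁ , s₀₁ , t₀₁) (y₀₂ , Q₀₂ , s₀₂ , t₀₂) (y₁₂ , Q₁₂ , s₁₂ , t₁₂) =
      adjoin-all {P = Ker A} 3 {vs = λ ()} (λ _ _ ()) (λ ()) vecs coords
        (λ { zero → E.Y-ker ; (suc zero) → T₀₁.kernel-third u₀₁ O.z₀₁v ; (suc (suc zero)) → T₀₂.kernel-third u₀₂ O.z₀₂v }) nonzero off (λ ())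
      where
      module O = Odd P₀₁ P₀₂ P₁₂ u₀₁ u₀₂ u₁₂ o₀₁ o₀₂ o₁₂
      module E = Even Q₀₁ Q₀₂ Q₁₂ t₀₁ t₀₂ t₁₂ s₀₁ s₀₂ s₁₂
      module T₀₁ = Third {c = f₂} 0≢1 (λ ()) (λ ()) three₀₁ P₀₁
      module T₀₂ = Third {c = f₁} 0≢2 (λ ()) (λ ()) three₀₂ P₀₂
      vecs : Fin 3 → Fin n → ℚ
      vecs zero = E.Y
      vecs (suc zero) = z₀₁
      vecs (suc (suc zero)) = z₀₂
      coords : Fin 3 → Fin n
      coords zero = u
      coords (suc zero) = first f₁
      coords (suc (suc zero)) = first f₂
      odd-nonzero : ∀ {a b} (a≢b : a ≢ b) {x} → PairKer a≢b x → x (first a) ≡ 1ℚ → x (first b) ≢ 0ℚ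
      odd-nonzero {a} {b} a≢b {x} P x1 xb = A≢0 (u-first a) (trans (solve 2 (λ s t → s := s :* con 1ℚ :+ t :* con 0ℚ) refl (A u (first a)) (A u (first b)))
        (trans (cong₂ (λ s t → A u (first a) *ℚ s +ℚ A u (first b) *ℚ t) (sym x1) (sym xb)) (PairKer.eq-u P)))
        where open ℚ-Solver
      nonzero : ∀ a → vecs a (coords a) ≢ 0ℚ
      nonzero zero e = 1ℚ≢0ℚ (trans (sym E.Y-u) e)
      nonzero (suc zero) = odd-nonzero 0≢1 P₀₁ o₀₁
      nonzero (suc (suc zero)) = odd-nonzero 0≢2 P₀₂ o₀₂
      off : ∀ a b → a ≢ b → vecs a (coords b) ≡ 0ℚ
      off zero zero ne = ⊥-elim (ne refl)
      off zero (suc zero) _ = E.Y-first f₁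
      off zero (suc (suc zero)) _ = E.Y-first f₂
      off (suc zero) zero _ = u₀₁
      off (suc zero) (suc zero) ne = ⊥-elim (ne refl)
      off (suc zero) (suc (suc zero)) _ = T₀₁.third-zero u₀₁ O.z₀₁v (1≤l f₂)
      off (suc (suc zero)) zero _ = u₀₂
      off (suc (suc zero)) (suc zero) _ = T₀₂.third-zero u₀₂ O.z₀₂v (1≤l f₁)
      off (suc (suc zero)) (suc (suc zero)) ne = ⊥-elim (ne refl)

    odd-vec : ∀ {a b} (a≢b : a ≢ b) → OddVec a≢b
    odd-vec a≢b = pair-vector a≢b (edge₁ a≢b)

    even-vec : ∀ {a b} (a≢b : a ≢ b) → EvenVec a≢b
    even-vec a≢b = pair-vector a≢b (CycleEdge-sym (G.C a≢b) (edge₁ a≢b))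

    listed : ∀ (g : Fin 3 → Fin n) {x} → (∃ λ a → x ≡ g a) → x ∈ (g f₀ ∷ g f₁ ∷ g f₂ ∷ [])
    listed g (zero , e) = here e
    listed g (suc zero , e) = there (here e)
    listed g (suc (suc zero) , e) = there (there (here e))

    excess≤2 : excess Γ ≤ 2
    excess≤2 = subst (excess Γ ≤_) (trans (sum-+ (δ u) (δ v)) (cong₂ _+_ (sum-δ u) (sum-δ v))) (sum-mono point)
      where
      inner : ∀ x → x ≢ u → x ≢ v → deg Γ x ≤ 2
      inner x x≢u x≢v with covers x
      ... | a , zero , _ , e = ⊥-elim (x≢u (trans (sym e) (start (N a))))
      ... | a , suc i , i≤ , refl with ℕ.m≤n⇒m<n∨m≡n i≤
      ...   | inj₂ e = ⊥-elim (x≢v (trans (cong (p a) e) (end (N a))))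
      ...   | inj₁ i< = deg≤ (p a i ∷ p a (2 + i) ∷ []) (λ j aj → sort (nbr-int a i< aj))
        where
        sort : ∀ {j} → j ≡ p a i ⊎ j ≡ p a (2 + i) → j ∈ (p a i ∷ p a (2 + i) ∷ [])
        sort (inj₁ e) = here e
        sort (inj₂ e) = there (here e)
      point : ∀ x → deg Γ x ∸ 2 ≤ δ u x + δ v x
      point x with x ≟ u | x ≟ v
      ... | yes refl | _ = ℕ.≤-trans (ℕ.∸-monoˡ-≤ 2 (deg≤ _ (λ j uj → listed first (nbr-u uj)))) (s≤s z≤n)
      ... | no _ | yes refl = ℕ.∸-monoˡ-≤ 2 (deg≤ _ (λ j vj → listed last (nbr-v vj)))
      ... | no x≢u | no x≢v = ℕ.∸-monoˡ-≤ 2 (inner x x≢u x≢v)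

  form3 : η≡ Γ (2 * cyc Γ + pendant Γ ∸ 1)
  form3 = exact (G.C 0≢1) (subst (OnCycle (G.C 0≢1)) (start (N f₀)) (G.on-p 0≢1 z≤n))
    (deg≥3 (u-first f₀) (u-first f₁) (u-first f₂) (first-≢ 0≢1) (first-≢ 0≢2) (first-≢ 1≢2)) (s≤s excess≤2)
    (dimension (odd-vec 0≢1) (odd-vec 0≢2) (odd-vec 1≢2) (even-vec 0≢1) (even-vec 0≢2) (even-vec 1≢2))

-- The characterisation

module FromPath {n} (Γ : SGraph n) (sg : IsSignedGraph Γ) {u v : Fin n} (P : Path Γ u v) where

  open Paths Γ sg

  private
    a = plen P

  -- Constant outside the range 0, …, plen P.
  vertex : ℕ → Fin n
  vertex i with i ℕ.≤? a
  ... | yes i≤ = pvtx P (fromℕ< (s≤s i≤))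
  ... | no _ = u

  vertex-toℕ : ∀ j → vertex (toℕ j) ≡ pvtx P j
  vertex-toℕ j with toℕ j ℕ.≤? a
  ... | yes i≤ = cong (pvtx P) (toℕ-injective (toℕ-fromℕ< (s≤s i≤)))
  ... | no i≰ = ⊥-elim (i≰ (ℕ.≤-pred (toℕ<n j)))

  vertex-at : ∀ {i} → i ≤ a → ∃ λ j → toℕ j ≡ i × vertex i ≡ pvtx P j
  vertex-at {i} i≤ = fromℕ< (s≤s i≤) , toℕ-fromℕ< (s≤s i≤) ,
    trans (cong vertex (sym (toℕ-fromℕ< (s≤s i≤)))) (vertex-toℕ (fromℕ< (s≤s i≤)))

  npath : NPath u v vertex a
  npath = record
    { 1≤len = ppos P ; start = trans (vertex-toℕ zero) (pstart P)
    ; end = trans (cong vertex (sym (toℕ-fromℕ a))) (trans (vertex-toℕ (fromℕ a)) (pend P))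
    ; walk = λ {i} i< → subst (λ s → Adj Γ (vertex s) (vertex (suc s))) (toℕ-fromℕ< i<) (step-adj (fromℕ< i<))
    ; inj-≤ = λ i≤ j≤ e → let (i′ , ti , vi) = vertex-at i≤ ; (j′ , tj , vj) = vertex-at j≤ in
        trans (sym ti) (trans (cong toℕ (pinj P (trans (sym vi) (trans e vj)))) tj) }
    where
    step-adj : ∀ (j : Fin a) → Adj Γ (vertex (toℕ j)) (vertex (suc (toℕ j)))
    step-adj j = subst (λ s → Adj Γ s (vertex (suc (toℕ j)))) (trans (sym (vertex-toℕ (inject₁ j))) (cong vertex (toℕ-inject₁ j)))
      (subst (Adj Γ (pvtx P (inject₁ j))) (sym (vertex-toℕ (suc j))) (padj P j))

  on-path : ∀ {x} → OnPath P x → ∃ λ i → i ≤ a × vertex i ≡ x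
  on-path (j , e) = toℕ j , ℕ.≤-pred (toℕ<n j) , trans (vertex-toℕ j) e

  path-edge : ∀ {x y} → PathEdge P x y → ∃ λ i → i < a × ((vertex i ≡ x × vertex (suc i) ≡ y) ⊎ (vertex i ≡ y × vertex (suc i) ≡ x))
  path-edge (j , e) = toℕ j , toℕ<n j , orient-edge e
    where
    at : vertex (toℕ j) ≡ pvtx P (inject₁ j)
    at = trans (cong vertex (sym (toℕ-inject₁ j))) (vertex-toℕ (inject₁ j))
    orient-edge : ∀ {x y} → (pvtx P (inject₁ j) ≡ x × pvtx P (suc j) ≡ y) ⊎ (pvtx P (inject₁ j) ≡ y × pvtx P (suc j) ≡ x) →
      (vertex (toℕ j) ≡ x × vertex (suc (toℕ j)) ≡ y) ⊎ (vertex (toℕ j) ≡ y × vertex (suc (toℕ j)) ≡ x)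
    orient-edge (inj₁ (p , q)) = inj₁ (trans at p , trans (vertex-toℕ (suc j)) q)
    orient-edge (inj₂ (p , q)) = inj₂ (trans at p , trans (vertex-toℕ (suc j)) q)

module _ {n} (Γ : SGraph n) (sg : IsSignedGraph Γ) (conn : Connected Γ) (1≤c : 1 ≤ cyc Γ) where

  theta⇒nullity : IsThetaGraph Γ → AllCyclesNullity2 Γ → η≡ Γ (2 * cyc Γ + pendant Γ ∸ 1)
  theta⇒nullity (u , v , P₁ , P₂ , P₃ , d₁₂ , d₁₃ , d₂₃ , n₁₂ , n₁₃ , n₂₃ , covers , edges) null =
    FromTheta.form3 Γ sg conn 1≤c (λ a → plen (P a)) (λ a → F.vertex a) (λ a → F.npath a) disj long covers′ edges′ null
    where
    P : Fin 3 → Path Γ u v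
    P zero = P₁
    P (suc zero) = P₂
    P (suc (suc zero)) = P₃
    module F (a : Fin 3) = FromPath Γ sg (P a)
    disjoint : ∀ a b → a ≢ b → InternallyDisjoint (P a) (P b)
    disjoint zero zero ne = ⊥-elim (ne refl)
    disjoint zero (suc zero) _ = d₁₂
    disjoint zero (suc (suc zero)) _ = d₁₃
    disjoint (suc zero) zero _ i j e = subst (λ x → x ≡ u ⊎ x ≡ v) (sym e) (d₁₂ j i (sym e))
    disjoint (suc zero) (suc zero) ne = ⊥-elim (ne refl)
    disjoint (suc zero) (suc (suc zero)) _ = d₂₃
    disjoint (suc (suc zero)) zero _ i j e = subst (λ x → x ≡ u ⊎ x ≡ v) (sym e) (d₁₃ j i (sym e))
    disjoint (suc (suc zero)) (suc zero) _ i j e = subst (λ x → x ≡ u ⊎ x ≡ v) (sym e) (d₂₃ j i (sym e))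
    disjoint (suc (suc zero)) (suc (suc zero)) ne = ⊥-elim (ne refl)
    disj : ∀ {a b} → a ≢ b → Paths.Disjoint Γ sg u v (F.vertex a) (plen (P a)) (F.vertex b) (plen (P b))
    disj {a} {b} a≢b i≤ j≤ e = let (i′ , _ , vi) = F.vertex-at a i≤ ; (j′ , _ , vj) = F.vertex-at b j≤ in
      subst (λ x → x ≡ u ⊎ x ≡ v) (sym vi) (disjoint a b a≢b i′ j′ (trans (sym vi) (trans e vj)))
    long : ∀ {a b} → a ≢ b → ¬ (plen (P a) ≡ 1 × plen (P b) ≡ 1)
    long {zero} {zero} ne = ⊥-elim (ne refl)
    long {zero} {suc zero} _ = n₁₂
    long {zero} {suc (suc zero)} _ = n₁₃
    long {suc zero} {zero} _ (p , q) = n₁₂ (q , p)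
    long {suc zero} {suc zero} ne = ⊥-elim (ne refl)
    long {suc zero} {suc (suc zero)} _ = n₂₃
    long {suc (suc zero)} {zero} _ (p , q) = n₁₃ (q , p)
    long {suc (suc zero)} {suc zero} _ (p , q) = n₂₃ (q , p)
    long {suc (suc zero)} {suc (suc zero)} ne = ⊥-elim (ne refl)
    covers′ : ∀ x → ∃ λ a → ∃ λ i → i ≤ plen (P a) × F.vertex a i ≡ x
    covers′ x with covers x
    ... | inj₁ o = zero , F.on-path zero o
    ... | inj₂ (inj₁ o) = suc zero , F.on-path (suc zero) o
    ... | inj₂ (inj₂ o) = suc (suc zero) , F.on-path (suc (suc zero)) o
    edges′ : ∀ x y → Adj Γ x y → ∃ λ a → ∃ λ i → i < plen (P a) ×
      ((F.vertex a i ≡ x × F.vertex a (suc i) ≡ y) ⊎ (F.vertex a i ≡ y × F.vertex a (suc i) ≡ x))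
    edges′ x y xy with edges x y xy
    ... | inj₁ e = zero , F.path-edge zero e
    ... | inj₂ (inj₁ e) = suc zero , F.path-edge (suc zero) e
    ... | inj₂ (inj₂ e) = suc (suc zero) , F.path-edge (suc (suc zero)) e

  forms⇒nullity : Form1 Γ ⊎ Form2 Γ ⊎ Form3 Γ → η≡ Γ (2 * cyc Γ + pendant Γ ∸ 1)
  forms⇒nullity (inj₁ (m , f , C , leaf , f-inj , tree , nullity , _ , leaf-inj , leaf-deg , disjoint , on-leaf , only-leaf , C-nullity , cover , edges)) =
    Converse.FromTree.form1 Γ sg conn 1≤c record
      { m = m ; f = f ; C = C ; leaf = leaf ; f-inj = f-inj ; tree = tree ; nullity = nullity ; leaf-inj = leaf-inj ; leaf-deg = leaf-deg
      ; disjoint = disjoint ; on-leaf = on-leaf ; only-leaf = only-leaf ; C-nullity = C-nullity ; cover = cover ; edges = edges }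
  forms⇒nullity (inj₂ (inj₁ ((C₁ , C₂ , w , w∈₁ , w∈₂ , common , covers , edges) , null))) =
    Converse.FromInfinity.form2 Γ sg conn 1≤c C₁ C₂ w w∈₁ w∈₂ common covers edges null
  forms⇒nullity (inj₂ (inj₂ (θ , null))) = theta⇒nullity θ null

  nullity⇒forms : Fin n → η≡ Γ (2 * cyc Γ + pendant Γ ∸ 1) → Form1 Γ ⊎ Form2 Γ ⊎ Form3 Γ
  nullity⇒forms a η = decide (any? (λ v → deg Γ v ℕ.≟ 1)) (any? (λ v → 3 ℕ.≤? deg Γ v))
    where
    C = n≤E⇒cycle Γ sg a (1≤cyc⇒n≤E Γ 1≤c)
    1≤deg : ∀ v → 1 ≤ deg Γ v
    1≤deg = Basic.connected⇒deg≥1 Γ sg conn (adj C zero)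
    η′ : η≡ Γ (suc (excess Γ))
    η′ = subst (η≡ Γ) (2cyc+pendant∸1 Γ sg 1≤deg 1≤c) η
    decide : Dec (∃ λ v → deg Γ v ≡ 1) → Dec (∃ λ v → 3 ≤ deg Γ v) → Form1 Γ ⊎ Form2 Γ ⊎ Form3 Γ
    decide (yes (v , d1)) _ = inj₁ (leaf⇒Form1 Γ sg conn d1 (proj₁ η′))
    decide (no no-leaf) branch? = branch branch?
      where
      2≤deg : ∀ v → 2 ≤ deg Γ v
      2≤deg v = ℕ.≤∧≢⇒< (1≤deg v) (λ e → no-leaf (v , sym e))
      open NoLeaf Γ sg conn 2≤deg (proj₁ η′)
      branch : Dec (∃ λ v → 3 ≤ deg Γ v) → Form1 Γ ⊎ Form2 Γ ⊎ Form3 Γ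
      branch (yes (b , 3≤d)) = branch⇒forms 3≤d
      -- All degrees are 2. Here the exactness of the nullity is used, and not only its lower bound.
      branch (no none) = ⊥-elim (2-regular⇒⊥ a (λ v → ℕ.≤-antisym (ℕ.≤-pred (ℕ.≰⇒> (λ h → none (v , h)))) (2≤deg v)) (proj₂ η′))

theorem5p4 : ∀ {n} (Γ : SGraph n) → IsSignedGraph Γ → Connected Γ → 1 ≤ cyc Γ →
    (η≡ Γ (2 * cyc Γ + pendant Γ ∸ 1) ⇔ (Form1 Γ ⊎ Form2 Γ ⊎ Form3 Γ))
theorem5p4 {zero} Γ sg conn 1≤c = mk⇔ (λ { (D , _) → ⊥-elim (no-vertex D) }) (forms⇒nullity Γ sg conn 1≤c)
  where
  -- Without vertices the truncated subtraction in cyc gives 1, so this case is not vacuous.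
  no-vertex : ¬ KerDimAtLeast (adjMat Γ) 1
  no-vertex D with dim-nonzero (fromKer (adjMat Γ) D)
  ... | _ , _ , () , _
theorem5p4 {suc n} Γ sg conn 1≤c = mk⇔ (nullity⇒forms Γ sg conn 1≤c zero) (forms⇒nullity Γ sg conn 1≤c)
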